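{- Write "$X \geq Y$" (for two circuit distances $X,Y$) to mean that for every polyhedron $P$ of the form below and every pair of vertices $v^{(1)},v^{(2)}$ of $P$ one has $X(v^{(1)},v^{(2)})\geq Y(v^{(1)},v^{(2)})$, and "$X>Y$" to mean that $X\geq Y$ holds and, in addition, there exist such a polyhedron and a pair of its vertices for which $X(v^{(1)},v^{(2)})>Y(v^{(1)},v^{(2)})$. Then the circuit distances satisfy the following hierarchy: (i) $\mathcal{CD}_{efmb}>\mathcal{CD}_{efm}$ and $\mathcal{CD}_{efmr}>\mathcal{CD}_{efm}$; (ii) $\mathcal{CD}_{efmb}>\mathcal{CD}_{fmb}$, $\mathcal{CD}_{efm}>\mathcal{CD}_{fm}$, $\mathcal{CD}_{efmr}>\mathcal{CD}_{fmr}$; (iii) $\mathcal{CD}_{fmb}>\mathcal{CD}_{fm}$ and $\mathcal{CD}_{fmr}>\mathcal{CD}_{fm}$; (iv) $\mathcal{CD}_{fmb}>\mathcal{CD}_{fb}$, $\mathcal{CD}_{fm}>\mathcal{CD}_{f}$, $\mathcal{CD}_{fmr}>\mathcal{CD}_{fr}$; (v) $\mathcal{CD}_{fb}\geq\mathcal{CD}_{f}$ and $\mathcal{CD}_{fr}>\mathcal{CD}_{f}$; (vi) $\mathcal{CD}_{fbr}>\mathcal{CD}_{fb}$ and $\mathcal{CD}_{fbr}\geq\mathcal{CD}_{fr}$; (vii) $\mathcal{CD}_{fs}>\mathcal{CD}_{fbr}$; (viii) $\mathcal{CD}_{f}>\mathcal{CD}$.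
   Context: Polyhedra are of the form $P=\{z\in\mathbb{R}^n: Az=b,\ Bz\leq d\}$ with $A\in\mathbb{Z}^{m_A\times n}$, $B\in\mathbb{Z}^{m_B\times n}$ (if no matrix $A$ is present, $\ker A=\mathbb{R}^n$ and $\operatorname{rank}A=0$). A circuit of $(A,B)$ is a vector $g\in\ker(A)\setminus\{0\}$ such that $Bg$ has inclusion-minimal support in $\{Bz: z\in\ker(A)\setminus\{0\}\}$, normalized to have coprime integer components. For vertices $v^{(1)},v^{(2)}$ of $P$, a circuit walk of length $k$ from $v^{(1)}$ to $v^{(2)}$ is a sequence $v^{(1)}=y^{(0)},y^{(1)},\dots,y^{(k)}=v^{(2)}$ with $y^{(i+1)}-y^{(i)}=\alpha_i g^i$ for circuits $g^i$ and reals $\alpha_i>0$. Possible properties of a walk: (e) edge walk: $y^{(i)},y^{(i+1)}$ are adjacent vertices of $P$ for all $i$; (f) feasible: $y^{(i)}\in P$ for all $i$; (m) maximal: for all $i$, $y^{(i)}+\alpha g^i\notin P$ for every $\alpha>\alpha_i$; (r) non-repetitive: $g^i\neq g^j$ for $i\neq j$; (b) non-backwards: $g^j\neq -g^i$ for all $i,j$; (s) sign-compatible: $(Bg^i)_l(Bg^j)_l\geq0$ and $(Bg^i)_l\,(B(v^{(2)}-v^{(1)}))_l\geq 0$ for all $i,j$ and all $l=1,\dots,m_B$. For a set $X$ of these letters, $\mathcal{CD}_X(v^{(1)},v^{(2)})$ denotes the minimum length of a finite circuit walk from $v^{(1)}$ to $v^{(2)}$ having all properties in $X$; $\mathcal{CD}$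 without subscript imposes no restriction. -}

module Defs where

open import Level using (0ℓ)
open import Data.Nat as ℕ using (ℕ; zero; suc)
open import Data.Nat.Divisibility using (_∣_)
open import Data.Integer as ℤ using (ℤ; +_; -[1+_]; ∣_∣)
open import Data.Fin using (Fin; zero; suc)
open import Data.List using (List; []; _∷_; length)
open import Data.List.Relation.Unary.All using (All)
open import Data.List.Relation.Unary.AllPairs using (AllPairs)
open import Data.List.Relation.Unary.Any using (Any)
open import Data.List.Membership.Propositional using (_∈_)
open import Data.Product using (Σ; ∃; _×_; _,_; proj₁; proj₂)
open import Data.Sum using (_⊎_)
open import Data.Unit using (⊤)
open import Data.Empty using (⊥)
open import Relation.Nullary using (¬_)
open import Relation.Binary.PropositionalEquality using (_≡_; _≢_)

-- The real numbers, axiomatised as a complete ordered field.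
-- (Any two models are isomorphic, so quantifying over all models is the
-- same as speaking about ℝ.)

record RealField : Set₁ where
  infixl 6 _+_
  infixl 7 _*_
  infix 4 _<_ _≤_
  field
    Carrier : Set
    0r 1r   : Carrier
    _+_ _*_ : Carrier → Carrier → Carrier
    -_      : Carrier → Carrier
    _<_     : Carrier → Carrier → Set
    +-assoc     : ∀ x y z → (x + y) + z ≡ x + (y + z)
    +-comm      : ∀ x y → x + y ≡ y + x
    +-identityˡ : ∀ x → 0r + x ≡ x
    -‿inverseˡ  : ∀ x → (- x) + x ≡ 0r
    *-assoc     : ∀ x y z → (x * y) * z ≡ x * (y * z)
    *-comm      : ∀ x y → x * y ≡ y * x
    *-identityˡ : ∀ x → 1r * x ≡ x
    distribˡ    : ∀ x y z → x * (y + z) ≡ (x * y) + (x * z)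
    0≢1         : 0r ≢ 1r
    *-inverse   : ∀ x → x ≢ 0r → ∃ λ y → y * x ≡ 1r
    <-irrefl    : ∀ x → ¬ (x < x)
    <-trans     : ∀ {x y z} → x < y → y < z → x < z
    <-trichotomy : ∀ x y → (x < y) ⊎ (x ≡ y) ⊎ (y < x)
    +-mono-<    : ∀ {x y} z → x < y → x + z < y + z
    *-pos       : ∀ {x y} → 0r < x → 0r < y → 0r < x * y

  _≤_ : Carrier → Carrier → Set
  x ≤ y = (x < y) ⊎ (x ≡ y)

  _-_ : Carrier → Carrier → Carrier
  x - y = x + (- y)

  field
    complete : (S : Carrier → Set) → (∃ λ x → S x) →
               (∃ λ u → ∀ x → S x → x ≤ u) →
               ∃ λ s → (∀ x → S x → x ≤ s) ×
                       (∀ u → (∀ x → S x → x ≤ u) → s ≤ u)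

Σℤ : ∀ {n} → (Fin n → ℤ) → ℤ
Σℤ {zero}  f = + 0
Σℤ {suc n} f = f zero ℤ.+ Σℤ (λ i → f (suc i))

-- Polyhedra P = { z ∈ ℝⁿ : A z = b, B z ≤ d }, A, B integer matrices.
-- (mA = 0 encodes "no matrix A".)

record Polyhedron (ℝ : RealField) : Set where
  field
    n mA mB : ℕ
    A : Fin mA → Fin n → ℤ
    bA : Fin mA → RealField.Carrier ℝ
    B : Fin mB → Fin n → ℤ
    dB : Fin mB → RealField.Carrier ℝ

data WalkProp : Set where
  e f m r b s : WalkProp

module Theory (ℝ : RealField) (P : Polyhedron ℝ) where
  open RealField ℝ
  open Polyhedron P

  fromℕ : ℕ → Carrier
  fromℕ zero    = 0r
  fromℕ (suc k) = 1r + fromℕ k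

  fromℤ : ℤ → Carrier
  fromℤ (+ k)      = fromℕ k
  fromℤ -[1+ k ]   = - fromℕ (suc k)

  Σr : ∀ {k} → (Fin k → Carrier) → Carrier
  Σr {zero}  h = 0r
  Σr {suc k} h = h zero + Σr (λ i → h (suc i))

  Point : Set
  Point = Fin n → Carrier

  IntVec : Set
  IntVec = Fin n → ℤ

  _≐_ : Point → Point → Set
  x ≐ y = ∀ i → x i ≡ y i

  A·_ : Point → Fin mA → Carrier
  (A· z) l = Σr (λ j → fromℤ (A l j) * z j)

  B·_ : Point → Fin mB → Carrier
  (B· z) l = Σr (λ j → fromℤ (B l j) * z j)

  Aℤ·_ : IntVec → Fin mA → ℤ
  (Aℤ· g) l = Σℤ (λ j → A l j ℤ.* g j)

  Bℤ·_ : IntVec → Fin mB → ℤ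
  (Bℤ· g) l = Σℤ (λ j → B l j ℤ.* g j)

  _+[_]_ : Point → Carrier → IntVec → Point
  (y +[ α ] g) i = y i + α * fromℤ (g i)

  comb : Carrier → Point → Point → Point
  comb t x y i = t * x i + (1r - t) * y i

  InP : Point → Set
  InP z = (∀ l → (A· z) l ≡ bA l) × (∀ l → (B· z) l ≤ dB l)

  IsVertex : Point → Set
  IsVertex v = InP v ×
    (∀ x y t → InP x → InP y → 0r < t → t < 1r → v ≐ comb t x y → x ≐ v × y ≐ v)

  -- adjacent vertices: v ≠ w and the segment [v,w] is a face of P,
  -- i.e. it is the set of maximisers in P of some linear functional c.
  Adjacent : Point → Point → Set
  Adjacent v w = IsVertex v × IsVertex w × ¬ (v ≐ w) ×
    Σ Point λ c →
      (∀ z → InP z → Σr (λ i → c i * z i) ≤ Σr (λ i → c i * v i)) ×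
      Σr (λ i → c i * w i) ≡ Σr (λ i → c i * v i) ×
      (∀ z → InP z → Σr (λ i → c i * z i) ≡ Σr (λ i → c i * v i) →
         Σ Carrier λ t → 0r ≤ t × t ≤ 1r × z ≐ comb t v w)

  IsCircuit : IntVec → Set
  IsCircuit g =
    (∀ l → (Aℤ· g) l ≡ + 0) ×
    ¬ (∀ i → g i ≡ + 0) ×
    (∀ z → (∀ l → (A· z) l ≡ 0r) → ¬ (∀ i → z i ≡ 0r) →
       (∀ l → (B· z) l ≢ 0r → (Bℤ· g) l ≢ + 0) →
       (∀ l → (Bℤ· g) l ≢ + 0 → (B· z) l ≢ 0r)) ×
    (∀ k → (∀ i → k ∣ ∣ g i ∣) → k ≡ 1)

  Step : Set
  Step = IntVec × Carrier

  endpoint : Point → List Step → Point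
  endpoint y []             = y
  endpoint y ((g , α) ∷ ws) = endpoint (y +[ α ] g) ws

  IsWalk : Point → Point → List Step → Set
  IsWalk v1 v2 ws = All (λ st → IsCircuit (proj₁ st) × 0r < proj₂ st) ws ×
                    endpoint v1 ws ≐ v2

  EdgeW : Point → List Step → Set
  EdgeW y []             = ⊤
  EdgeW y ((g , α) ∷ ws) = Adjacent y (y +[ α ] g) × EdgeW (y +[ α ] g) ws

  FeasW : Point → List Step → Set
  FeasW y []             = InP y
  FeasW y ((g , α) ∷ ws) = InP y × FeasW (y +[ α ] g) ws

  MaxW : Point → List Step → Set
  MaxW y []             = ⊤
  MaxW y ((g , α) ∷ ws) = (∀ β → α < β → ¬ InP (y +[ β ] g)) × MaxW (y +[ α ] g) ws

  _≐ℤ_ : IntVec → IntVec → Set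
  g ≐ℤ h = ∀ i → g i ≡ h i

  NonRep : List Step → Set
  NonRep ws = AllPairs (λ s t → ¬ (proj₁ s ≐ℤ proj₁ t)) ws

  NonBack : List Step → Set
  NonBack ws = All (λ s → All (λ t → ¬ (proj₁ t ≐ℤ (λ i → ℤ.- proj₁ s i))) ws) ws

  SignW : Point → Point → List Step → Set
  SignW v1 v2 ws =
    All (λ s → All (λ t → ∀ l → + 0 ℤ.≤ (Bℤ· proj₁ s) l ℤ.* (Bℤ· proj₁ t) l) ws) ws ×
    All (λ s → ∀ l → 0r ≤ fromℤ ((Bℤ· proj₁ s) l) * (B· (λ i → v2 i - v1 i)) l) ws

  HasProp : Point → Point → List Step → WalkProp → Set
  HasProp v1 v2 ws e = EdgeW v1 ws
  HasProp v1 v2 ws f = FeasW v1 ws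
  HasProp v1 v2 ws m = MaxW v1 ws
  HasProp v1 v2 ws r = NonRep ws
  HasProp v1 v2 ws b = NonBack ws
  HasProp v1 v2 ws s = SignW v1 v2 ws

  WalkX : List WalkProp → Point → Point → List Step → Set
  WalkX X v1 v2 ws = IsWalk v1 v2 ws × All (HasProp v1 v2 ws) X

  -- CD_X(v1,v2) ≤ k   (CD_X = ∞ when no such walk exists)
  CD≤ : List WalkProp → Point → Point → ℕ → Set
  CD≤ X v1 v2 k = Σ (List Step) λ ws → WalkX X v1 v2 ws × length ws ℕ.≤ k

-- X ≥ Y : CD_X(v1,v2) ≥ CD_Y(v1,v2) for all polyhedra and vertex pairs,
-- i.e. every X-walk is matched by a Y-walk that is no longer.
CD-≥ : RealField → List WalkProp → List WalkProp → Set
CD-≥ ℝ X Y = (P : Polyhedron ℝ) → let open Theory ℝ P in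
  ∀ v1 v2 → IsVertex v1 → IsVertex v2 →
  ∀ k → CD≤ X v1 v2 k → CD≤ Y v1 v2 k

-- X > Y : X ≥ Y, and for some polyhedron and vertex pair
-- CD_X(v1,v2) > CD_Y(v1,v2), i.e. there is a Y-walk of some length k
-- and no X-walk of length ≤ k.
CD-> : RealField → List WalkProp → List WalkProp → Set
CD-> ℝ X Y = CD-≥ ℝ X Y ×
  Σ (Polyhedron ℝ) λ P → let open Theory ℝ P in
  Σ Point λ v1 → Σ Point λ v2 → IsVertex v1 × IsVertex v2 ×
  Σ ℕ λ k → CD≤ Y v1 v2 k × ¬ CD≤ X v1 v2 k

{-# OPTIONS --safe #-}
module Submission where

-- Feasible sign-compatible walks: every row is monotone along the walk, so equal directions can be merged
-- without leaving the polyhedron, and a direction together with its opposite would span a line through a vertex.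
--
-- The strict inequalities come from five polyhedra (integer data, no equations).  Boxes [0,c]ⁿ with redundant
-- extra rows have the faces of a cube but more circuits: steps leaving the origin or entering the opposite corner
-- are nonnegative, and minimality of the support leaves only few nonnegative circuits.
--   * [0,1]³ with x − y + z, x − 3z: the circuit (1,1,0) is no edge, and (1,1,0), e₃ is not sign-compatible.
--   * [0,2]⁴ with 2x₃ − x₄, x₁ + x₄, x₂ + x₄: from 0 to (2,2,2,2) the walk g, 2h, g with g = (0,0,1,2), h = (1,1,0,−1)
--     is feasible, but every feasible walk of length at most 3 repeats a direction, and 2g, 2h is infeasible.
--   * [0,2]⁵ with w − xⱼ, w = x₁ + x₂ + x₃ + x₄ + 6t: from 0 to (2,2,2,2,0) the maximal walk 2eₜ, h, −eₜ with
--     h = (2,2,2,2,−1) overshoots, while eₜ, h is not maximal.  After 2eₜ the total of w is −4, and the only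
--     available circuit with w < 0 is −eₜ.
-- For edge walks: a heptagon whose only edge path of length 3 between two vertices uses e₁ and −e₁, and an
-- unbounded polyhedron whose graph is two pentagons sharing a vertex, where the shortest path uses e₃ twice.

open import Defs
open import Algebra.Bundles using (CommutativeRing)
import Algebra.Properties.Ring as Ringₚ
import Algebra.Solver.Ring
open import Algebra.Solver.Ring.AlmostCommutativeRing using (AlmostCommutativeRing; _-Raw-AlmostCommutative⟶_; fromCommutativeRing)
open import Data.Bool using (Bool; true; false; T; _∨_)
open import Data.Bool.Properties using (T-≡)
open import Data.Empty using (⊥; ⊥-elim)
open import Data.Fin using (Fin; zero; suc; splitAt; _↑ˡ_; _↑ʳ_; inject₁)
open import Data.Fin.Patterns using (0F; 1F; 2F; 3F; 4F; 5F; 6F; 7F; 8F; 9F)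
import Data.Fin.Properties as Finₚ
open import Data.Integer as ℤ using (ℤ; +_; -[1+_]; +[1+_]; ∣_∣; _⊖_)
import Data.Integer.Properties as ℤₚ
open import Data.List using (List; []; _∷_; length; map)
import Data.List as List
open import Data.List.Relation.Unary.All as All using (All; []; _∷_)
open import Data.List.Relation.Unary.All.Properties using (++⁺; map⁺)
open import Data.List.Relation.Unary.AllPairs using ([]; _∷_; allPairs?)
open import Data.List.Relation.Unary.Any as Any using (Any; here; there)
open import Data.Maybe using (Maybe; just; nothing)
open import Data.Nat as ℕ using (ℕ; zero; suc)
import Data.Nat.Divisibility as ∣
import Data.Nat.Properties as ℕₚ
open import Data.Product using (Σ; ∃; _×_; _,_; proj₁; proj₂)
open import Data.Sum using (_⊎_; inj₁; inj₂; [_,_]′)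
open import Data.Unit using (⊤; tt)
open import Data.Vec using (Vec; []; _∷_; lookup; tabulate; _++_)
open import Function.Bundles using (Equivalence)
open import Level using (0ℓ)
open import Relation.Nullary using (¬_; Dec; yes; no)
open import Relation.Nullary.Decidable using (¬?; _×-dec_; _→-dec_; from-yes; decidable-stable)
open import Relation.Binary.PropositionalEquality

-- The field is abstract, so nothing real-valued can be evaluated. Existence of walks is therefore
-- decided on integer points and transported; non-existence is reduced to systems of linear facts
-- with integer coefficients, which a proved Fourier-Motzkin check refutes. The obstacle in the
-- lower bounds is that a walk may use any circuit. Circuits are not enumerated: a circuit `g` is
-- compared with a small integer test vector `z`. If every row nonzero on `z` is nonzero on `g`,
-- minimality forces `g` to vanish on every row on which `z` does. The extra rows are tuned so that
-- the intended circuits are cut out by them. The 6 in w, for instance, gives w = 8 - 6 = 2 on h, so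
-- that all four w - xⱼ vanish there. In the two edge-walk examples the vertices have unimodular
-- sets of tight rows, so edges and neighbours can be read off an integer inverse.

-- The integers inside an abstract ordered field, and a ring solver over them.

module Embedding (ℝ : RealField) (P : Polyhedron ℝ) where
  open RealField ℝ hiding (_-_)
  open Theory ℝ P using (fromℕ; fromℤ)

  commutativeRing : CommutativeRing 0ℓ 0ℓ
  commutativeRing = record
    { Carrier = Carrier ; _≈_ = _≡_ ; _+_ = _+_ ; _*_ = _*_ ; -_ = -_ ; 0# = 0r ; 1# = 1r
    ; isCommutativeRing = record
      { isRing = record
        { +-isAbelianGroup = record
          { isGroup = record
            { isMonoid = record
              { isSemigroup = record
                { isMagma = record { isEquivalence = isEquivalence ; ∙-cong = cong₂ _+_ }
                ; assoc = +-assoc }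
              ; identity = +-identityˡ , λ x → trans (+-comm x 0r) (+-identityˡ x) }
            ; inverse = -‿inverseˡ , λ x → trans (+-comm x (- x)) (-‿inverseˡ x)
            ; ⁻¹-cong = cong -_ }
          ; comm = +-comm }
        ; *-cong = cong₂ _*_
        ; *-assoc = *-assoc
        ; *-identity = *-identityˡ , λ x → trans (*-comm x 1r) (*-identityˡ x)
        ; distrib = distribˡ , λ x y z →
            trans (*-comm (y + z) x) (trans (distribˡ x y z) (cong₂ _+_ (*-comm x y) (*-comm x z))) }
      ; *-comm = *-comm } }

  +-identityʳ : ∀ x → x + 0r ≡ x
  +-identityʳ = CommutativeRing.+-identityʳ commutativeRing

  -‿inverseʳ : ∀ x → x + - x ≡ 0r
  -‿inverseʳ = CommutativeRing.-‿inverseʳ commutativeRing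

  *-identityʳ : ∀ x → x * 1r ≡ x
  *-identityʳ = CommutativeRing.*-identityʳ commutativeRing

  zeroˡ : ∀ x → 0r * x ≡ 0r
  zeroˡ = CommutativeRing.zeroˡ commutativeRing

  zeroʳ : ∀ x → x * 0r ≡ 0r
  zeroʳ = CommutativeRing.zeroʳ commutativeRing

  distribʳ : ∀ x y z → (y + z) * x ≡ y * x + z * x
  distribʳ = CommutativeRing.distribʳ commutativeRing

  -‿distribˡ-* : ∀ x y → - (x * y) ≡ - x * y
  -‿distribˡ-* = Ringₚ.-‿distribˡ-* (CommutativeRing.ring commutativeRing)

  -‿involutive : ∀ x → - (- x) ≡ x
  -‿involutive = Ringₚ.-‿involutive (CommutativeRing.ring commutativeRing)

  -0≡0 : - 0r ≡ 0r
  -0≡0 = Ringₚ.-0#≈0# (CommutativeRing.ring commutativeRing)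

  neg-+ : ∀ x y → - x + - y ≡ - (x + y)
  neg-+ = Ringₚ.-‿+-comm (CommutativeRing.ring commutativeRing)

  open ≡-Reasoning

  fromℕ-+ : ∀ a c → fromℕ (a ℕ.+ c) ≡ fromℕ a + fromℕ c
  fromℕ-+ zero    c = sym (+-identityˡ _)
  fromℕ-+ (suc a) c = trans (cong (λ u → 1r + u) (fromℕ-+ a c)) (sym (+-assoc _ _ _))

  fromℕ-* : ∀ a c → fromℕ (a ℕ.* c) ≡ fromℕ a * fromℕ c
  fromℕ-* zero    c = sym (zeroˡ _)
  fromℕ-* (suc a) c = begin
    fromℕ (c ℕ.+ a ℕ.* c)            ≡⟨ fromℕ-+ c (a ℕ.* c) ⟩
    fromℕ c + fromℕ (a ℕ.* c)        ≡⟨ cong₂ _+_ (sym (*-identityˡ _)) (fromℕ-* a c) ⟩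
    1r * fromℕ c + fromℕ a * fromℕ c ≡⟨ distribʳ _ _ _ ⟨
    (1r + fromℕ a) * fromℕ c         ∎

  fromℤ-neg : ∀ z → fromℤ (ℤ.- z) ≡ - fromℤ z
  fromℤ-neg (+ zero)  = sym -0≡0
  fromℤ-neg +[1+ k ]  = refl
  fromℤ-neg -[1+ k ]  = sym (-‿involutive _)

  cancel-1 : ∀ x y → (1r + x) + - (1r + y) ≡ x + - y
  cancel-1 x y = begin
    (1r + x) + - (1r + y)     ≡⟨ cong₂ _+_ (+-comm 1r x) (sym (neg-+ 1r y)) ⟩
    (x + 1r) + (- 1r + - y)   ≡⟨ +-assoc x 1r _ ⟩
    x + (1r + (- 1r + - y))   ≡⟨ cong (λ u → x + u) (sym (+-assoc 1r _ _)) ⟩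
    x + ((1r + - 1r) + - y)   ≡⟨ cong (λ u → x + (u + - y)) (-‿inverseʳ 1r) ⟩
    x + (0r + - y)            ≡⟨ cong (λ u → x + u) (+-identityˡ _) ⟩
    x + - y                   ∎

  fromℤ-⊖ : ∀ a c → fromℤ (a ⊖ c) ≡ fromℕ a + - fromℕ c
  fromℤ-⊖ zero    zero    = sym (-‿inverseʳ 0r)
  fromℤ-⊖ zero    (suc c) = sym (+-identityˡ _)
  fromℤ-⊖ (suc a) zero    = sym (trans (cong (λ u → fromℕ (suc a) + u) -0≡0) (+-identityʳ _))
  fromℤ-⊖ (suc a) (suc c) = trans (cong fromℤ (ℤₚ.[1+m]⊖[1+n]≡m⊖n a c))
                           (trans (fromℤ-⊖ a c) (sym (cancel-1 _ _)))

  fromℤ-+ : ∀ y z → fromℤ (y ℤ.+ z) ≡ fromℤ y + fromℤ z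
  fromℤ-+ (+ a)    (+ c)    = fromℕ-+ a c
  fromℤ-+ (+ a)    -[1+ c ] = fromℤ-⊖ a (suc c)
  fromℤ-+ -[1+ a ] (+ c)    = trans (fromℤ-⊖ c (suc a)) (+-comm _ _)
  fromℤ-+ -[1+ a ] -[1+ c ] = begin
    - fromℕ (suc (suc (a ℕ.+ c)))          ≡⟨ cong (λ k → - fromℕ k) (sym (ℕₚ.+-suc (suc a) c)) ⟩
    - fromℕ (suc a ℕ.+ suc c)              ≡⟨ cong -_ (fromℕ-+ (suc a) (suc c)) ⟩
    - (fromℕ (suc a) + fromℕ (suc c))      ≡⟨ neg-+ _ _ ⟨
    - fromℕ (suc a) + - fromℕ (suc c)      ∎

  fromℤ-pos* : ∀ a z → fromℤ (+ a ℤ.* z) ≡ fromℕ a * fromℤ z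
  fromℤ-pos* zero    z = sym (zeroˡ _)
  fromℤ-pos* (suc a) z = begin
    fromℤ (+ suc a ℤ.* z)              ≡⟨ cong fromℤ (ℤₚ.suc-* (+ a) z) ⟩
    fromℤ (z ℤ.+ + a ℤ.* z)            ≡⟨ fromℤ-+ z (+ a ℤ.* z) ⟩
    fromℤ z + fromℤ (+ a ℤ.* z)        ≡⟨ cong₂ _+_ (sym (*-identityˡ _)) (fromℤ-pos* a z) ⟩
    1r * fromℤ z + fromℕ a * fromℤ z   ≡⟨ distribʳ _ _ _ ⟨
    (1r + fromℕ a) * fromℤ z           ∎

  fromℤ-* : ∀ y z → fromℤ (y ℤ.* z) ≡ fromℤ y * fromℤ z
  fromℤ-* (+ a)    z = fromℤ-pos* a z
  fromℤ-* -[1+ a ] z = begin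
    fromℤ (-[1+ a ] ℤ.* z)         ≡⟨ cong fromℤ (sym (ℤₚ.neg-distribˡ-* (+ suc a) z)) ⟩
    fromℤ (ℤ.- (+ suc a ℤ.* z))    ≡⟨ fromℤ-neg (+ suc a ℤ.* z) ⟩
    - fromℤ (+ suc a ℤ.* z)        ≡⟨ cong -_ (fromℤ-pos* (suc a) z) ⟩
    - (fromℕ (suc a) * fromℤ z)    ≡⟨ -‿distribˡ-* _ _ ⟩
    - fromℕ (suc a) * fromℤ z      ∎

module RingSolver (ℝ : RealField) (P : Polyhedron ℝ) where
  open Theory ℝ P using (fromℤ)
  open Embedding ℝ P

  almostRing : AlmostCommutativeRing 0ℓ 0ℓ
  almostRing = fromCommutativeRing commutativeRing

  -- `fromℤ (+ 1)` unfolds to `1r + 0r`, so `1r` is a numeral only propositionally. Later solver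
  -- calls pass `1r` as a variable, often called `o`, and keep `con` for images of integers.
  fromℤ-morphism : CommutativeRing.rawRing ℤₚ.+-*-commutativeRing -Raw-AlmostCommutative⟶ almostRing
  fromℤ-morphism = record
    { ⟦_⟧ = fromℤ ; +-homo = fromℤ-+ ; *-homo = fromℤ-* ; -‿homo = fromℤ-neg
    ; 0-homo = refl ; 1-homo = +-identityʳ (RealField.1r ℝ) }

  fromℤ-≟ : ∀ y z → Maybe (fromℤ y ≡ fromℤ z)
  fromℤ-≟ y z with y ℤ.≟ z
  ... | yes p = just (cong fromℤ p)
  ... | no _  = nothing

  open Algebra.Solver.Ring
    (CommutativeRing.rawRing ℤₚ.+-*-commutativeRing) almostRing fromℤ-morphism fromℤ-≟ public

-- Order, convex combinations and a decision procedure for linear arithmetic.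

module Reals (ℝ : RealField) (P : Polyhedron ℝ) where
  open RealField ℝ hiding (_-_)
  open Theory ℝ P using (fromℕ; fromℤ)
  open Embedding ℝ P public
  open ≡-Reasoning

  infix 9 :-_
  infixl 8 _:*_
  infixl 7 _:+_
  infix 4 _:=_

  Polynomial : ℕ → Set
  Polynomial = RingSolver.Polynomial ℝ P

  con : ∀ {k} → ℤ → Polynomial k
  con = RingSolver.con

  _:+_ _:*_ : ∀ {k} → Polynomial k → Polynomial k → Polynomial k
  _:+_ = RingSolver._:+_ ℝ P
  _:*_ = RingSolver._:*_ ℝ P

  :-_ : ∀ {k} → Polynomial k → Polynomial k
  :-_ = RingSolver.:-_

  _:=_ : ∀ {k} → Polynomial k → Polynomial k → Polynomial k × Polynomial k
  _:=_ = _,_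

  solve = RingSolver.solve ℝ P

  -- Order

  ≤-refl : ∀ {x} → x ≤ x
  ≤-refl = inj₂ refl

  <-≤-trans : ∀ {x y z} → x < y → y ≤ z → x < z
  <-≤-trans p (inj₁ q)    = <-trans p q
  <-≤-trans p (inj₂ refl) = p

  ≤-<-trans : ∀ {x y z} → x ≤ y → y < z → x < z
  ≤-<-trans (inj₁ p)    q = <-trans p q
  ≤-<-trans (inj₂ refl) q = q

  ≤-trans : ∀ {x y z} → x ≤ y → y ≤ z → x ≤ z
  ≤-trans (inj₁ p)    q = inj₁ (<-≤-trans p q)
  ≤-trans (inj₂ refl) q = q

  ≤⇒≯ : ∀ {x y} → x ≤ y → ¬ (y < x)
  ≤⇒≯ p q = <-irrefl _ (≤-<-trans p q)

  ≮⇒≥ : ∀ {x y} → ¬ (x < y) → y ≤ x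
  ≮⇒≥ {x} {y} p with <-trichotomy x y
  ... | inj₁ q        = ⊥-elim (p q)
  ... | inj₂ (inj₁ q) = inj₂ (sym q)
  ... | inj₂ (inj₂ q) = inj₁ q

  ≤-or-> : ∀ x y → (x ≤ y) ⊎ (y < x)
  ≤-or-> x y with <-trichotomy x y
  ... | inj₁ q        = inj₁ (inj₁ q)
  ... | inj₂ (inj₁ q) = inj₁ (inj₂ q)
  ... | inj₂ (inj₂ q) = inj₂ q

  ≤-antisym : ∀ {x y} → x ≤ y → y ≤ x → x ≡ y
  ≤-antisym (inj₂ p) _ = p
  ≤-antisym (inj₁ p) q = ⊥-elim (≤⇒≯ q p)

  zero-or-pos : ∀ {x} → 0r ≤ x → (x ≡ 0r) ⊎ (0r < x)
  zero-or-pos (inj₁ p) = inj₂ p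
  zero-or-pos (inj₂ p) = inj₁ (sym p)

  _≟_ : (x y : Carrier) → Dec (x ≡ y)
  x ≟ y with <-trichotomy x y
  ... | inj₁ q        = no λ { refl → <-irrefl _ q }
  ... | inj₂ (inj₁ q) = yes q
  ... | inj₂ (inj₂ q) = no λ { refl → <-irrefl _ q }

  +-mono-≤ : ∀ {x y u v} → x ≤ y → u ≤ v → x + u ≤ y + v
  +-mono-≤ {x} {y} {u} {v} p q = ≤-trans (right p) (left q)
    where
    right : x ≤ y → x + u ≤ y + u
    right (inj₁ p)    = inj₁ (+-mono-< u p)
    right (inj₂ refl) = ≤-refl
    left : u ≤ v → y + u ≤ y + v
    left (inj₁ q)    = inj₁ (subst₂ _<_ (+-comm u y) (+-comm v y) (+-mono-< y q))
    left (inj₂ refl) = ≤-refl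

  0≤-+ : ∀ {x y} → 0r ≤ x → 0r ≤ y → 0r ≤ x + y
  0≤-+ p q = subst (_≤ _) (+-identityˡ 0r) (+-mono-≤ p q)

  0<-+ : ∀ {x y} → 0r < x → 0r ≤ y → 0r < x + y
  0<-+ {x} {y} p q = ≤-<-trans (subst (0r ≤_) (sym (+-identityˡ y)) q) (+-mono-< y p)

  0≤-* : ∀ {x y} → 0r ≤ x → 0r ≤ y → 0r ≤ x * y
  0≤-* (inj₁ p)    (inj₁ q)    = inj₁ (*-pos p q)
  0≤-* (inj₂ refl) _           = inj₂ (sym (zeroˡ _))
  0≤-* (inj₁ _)    (inj₂ refl) = inj₂ (sym (zeroʳ _))

  <⇒0< : ∀ {x y} → x < y → 0r < y + - x
  <⇒0< {x} p = subst (_< _) (-‿inverseʳ x) (+-mono-< (- x) p)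

  ≤⇒0≤ : ∀ {x y} → x ≤ y → 0r ≤ y + - x
  ≤⇒0≤ (inj₁ p)    = inj₁ (<⇒0< p)
  ≤⇒0≤ (inj₂ refl) = inj₂ (sym (-‿inverseʳ _))

  0<⇒< : ∀ {x y} → 0r < y + - x → x < y
  0<⇒< {x} {y} p = subst₂ _<_ (+-identityˡ x)
    (solve 2 (λ x y → (y :+ :- x) :+ x := y) refl x y) (+-mono-< x p)

  0≤⇒≤ : ∀ {x y} → 0r ≤ y + - x → x ≤ y
  0≤⇒≤ {x} {y} p = ≮⇒≥ λ q → ≤⇒≯ p (subst (_< 0r)
    (solve 2 (λ x y → :- (x :+ :- y) := y :+ :- x) refl x y)
    (subst (- (x + - y) <_) -0≡0 (neg-mono (<⇒0< q))))
    where
    neg-mono : ∀ {u v} → u < v → - v < - u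
    neg-mono {u} {v} p = 0<⇒< (subst (0r <_)
      (solve 2 (λ u v → v :+ :- u := :- u :+ :- (:- v)) refl u v) (<⇒0< p))

  0<1 : 0r < 1r
  0<1 with <-trichotomy 0r 1r
  ... | inj₁ p        = p
  ... | inj₂ (inj₁ p) = ⊥-elim (0≢1 p)
  -- If `1r` were negative, `0r - 1r` would be positive with square `1r`, so the claim holds in this
  -- case as well.
  ... | inj₂ (inj₂ p) = subst (0r <_) (solve 1 (λ x → (con (+ 0) :+ :- x) :* (con (+ 0) :+ :- x) := x :* x) refl 1r ⟨≡⟩ *-identityˡ 1r)
                          (*-pos (<⇒0< p) (<⇒0< p))
    where _⟨≡⟩_ = trans

  *-cancelˡ-pos : ∀ {x y} → 0r < x → 0r < x * y → 0r < y
  *-cancelˡ-pos {x} {y} p q with <-trichotomy 0r y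
  ... | inj₁ h           = h
  ... | inj₂ (inj₁ refl) = ⊥-elim (<-irrefl _ (subst (0r <_) (zeroʳ x) q))
  ... | inj₂ (inj₂ h)    = ⊥-elim (<-irrefl _ (<-trans q (0<⇒< (subst (0r <_)
      (solve 2 (λ x y → x :* (con (+ 0) :+ :- y) := con (+ 0) :+ :- (x :* y)) refl x y) (*-pos p (<⇒0< h))))))

  *-zero-product : ∀ x y → x * y ≡ 0r → x ≢ 0r → y ≡ 0r
  *-zero-product x y p x≢0 with *-inverse x x≢0
  ... | x⁻¹ , inv = begin
    y              ≡⟨ *-identityˡ y ⟨
    1r * y         ≡⟨ cong (_* y) inv ⟨
    x⁻¹ * x * y    ≡⟨ *-assoc x⁻¹ x y ⟩
    x⁻¹ * (x * y)  ≡⟨ cong (x⁻¹ *_) p ⟩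
    x⁻¹ * 0r       ≡⟨ zeroʳ x⁻¹ ⟩
    0r             ∎

  pos⇒≢0 : ∀ {x} → 0r < x → x ≢ 0r
  pos⇒≢0 p refl = <-irrefl _ p

  weighted-zero : ∀ {t x y} → 0r < t → t < 1r → 0r ≤ x → 0r ≤ y → t * x + (1r + - t) * y ≡ 0r → x ≡ 0r × y ≡ 0r
  weighted-zero {t} {x} {y} 0<t t<1 0≤x 0≤y sum = ≤-antisym (≮⇒≥ x≯0) 0≤x , ≤-antisym (≮⇒≥ y≯0) 0≤y
    where
    0<1-t = <⇒0< t<1
    x≯0 : ¬ (0r < x)
    x≯0 q = pos⇒≢0 (0<-+ (*-pos 0<t q) (0≤-* (inj₁ 0<1-t) 0≤y)) sum
    y≯0 : ¬ (0r < y)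
    y≯0 q = pos⇒≢0 (0<-+ (*-pos 0<1-t q) (0≤-* (inj₁ 0<t) 0≤x)) (trans (+-comm _ _) sum)

  -- This is `weighted-zero` for the gaps `C - x` and `C - y`. With `C` the bound of a tight row it
  -- is how points are shown to be extreme.
  weighted-max : ∀ {t x y C} → 0r < t → t < 1r → x ≤ C → y ≤ C → t * x + (1r + - t) * y ≡ C → x ≡ C × y ≡ C
  weighted-max {t} {x} {y} {C} 0<t t<1 x≤C y≤C sum =
      let (p₁ , p₂) = weighted-zero 0<t t<1 (≤⇒0≤ x≤C) (≤⇒0≤ y≤C) gap in close p₁ , close p₂
    where
    close : ∀ {u} → C + - u ≡ 0r → u ≡ C
    close {u} p = trans (solve 2 (λ u C → u := C :+ :- (C :+ :- u)) refl u C) (trans (cong (λ w → C + - w) p) (solve 1 (λ C → C :+ :- con (+ 0) := C) refl C))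
    gap : t * (C + - x) + (1r + - t) * (C + - y) ≡ 0r
    gap = begin
      t * (C + - x) + (1r + - t) * (C + - y)
        ≡⟨ solve 5 (λ t C x y o → t :* (C :+ :- x) :+ (o :+ :- t) :* (C :+ :- y) := o :* C :+ :- (t :* x :+ (o :+ :- t) :* y)) refl t C x y 1r ⟩
      1r * C + - (t * x + (1r + - t) * y) ≡⟨ cong₂ (λ u w → u + - w) (*-identityˡ C) sum ⟩
      C + - C ≡⟨ -‿inverseʳ C ⟩
      0r ∎

  0≤fromℕ : ∀ k → 0r ≤ fromℕ k
  0≤fromℕ zero    = ≤-refl
  0≤fromℕ (suc k) = inj₁ (0<-+ 0<1 (0≤fromℕ k))

  0<fromℕ : ∀ k → 0r < fromℕ (suc k)
  0<fromℕ k = 0<-+ 0<1 (0≤fromℕ k)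

  fromℤ-neg<0 : ∀ k → fromℤ -[1+ k ] < 0r
  fromℤ-neg<0 k = 0<⇒< (subst (0r <_)
    (solve 1 (λ x → x := con (+ 0) :+ :- (:- x)) refl (fromℕ (suc k))) (0<fromℕ k))

  fromℤ-mono-≤ : ∀ {y z} → y ℤ.≤ z → fromℤ y ≤ fromℤ z
  fromℤ-mono-≤ {y} {z} p with z ℤ.- y in eq | ℤₚ.i≤j⇒0≤j-i p
  ... | + k | _ = 0≤⇒≤ (subst (0r ≤_) (trans (cong fromℤ (sym eq)) (trans (fromℤ-+ z (ℤ.- y)) (cong (λ t → fromℤ z + t) (fromℤ-neg y)))) (0≤fromℕ k))

  fromℤ-pos : ∀ {z} → + 0 ℤ.< z → 0r < fromℤ z
  fromℤ-pos {+[1+ k ]} _ = 0<fromℕ k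
  fromℤ-pos {+ zero} (ℤ.+<+ ())

  fromℤ-≡0 : ∀ z → fromℤ z ≡ 0r → z ≡ + 0
  fromℤ-≡0 (+ zero) p = refl
  fromℤ-≡0 +[1+ k ] p = ⊥-elim (pos⇒≢0 (0<fromℕ k) p)
  fromℤ-≡0 -[1+ k ] p = ⊥-elim (<-irrefl _ (subst (_< 0r) p (fromℤ-neg<0 k)))

  scaled-zero : ∀ {α} g → 0r < α → α * fromℤ g ≡ 0r → g ≡ + 0
  scaled-zero g 0<α p = fromℤ-≡0 g (*-zero-product _ _ p (pos⇒≢0 0<α))

  -- Linear arithmetic by Fourier–Motzkin elimination

  infixl 6 _⊕_ _⊝_
  infixr 7 _⊛_ ‵_

  data Lin (k : ℕ) : Set where
    var  : Fin k → Lin k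
    ‵_   : ℤ → Lin k
    _⊕_ _⊝_ : Lin k → Lin k → Lin k
    _⊛_  : ℤ → Lin k → Lin k

  ⟦_⟧ : ∀ {k} → Lin k → Vec Carrier k → Carrier
  ⟦ var i ⟧ ρ = lookup ρ i
  ⟦ ‵ z ⟧   ρ = fromℤ z
  ⟦ x ⊕ y ⟧ ρ = ⟦ x ⟧ ρ + ⟦ y ⟧ ρ
  ⟦ x ⊝ y ⟧ ρ = ⟦ x ⟧ ρ + - ⟦ y ⟧ ρ
  ⟦ z ⊛ x ⟧ ρ = fromℤ z * ⟦ x ⟧ ρ

  -- Follows the recursion of `Σr`, so in a concrete dimension its value unfolds to the same sum as
  -- a row of the polyhedron, and proofs about rows serve as facts without conversion.
  form-of : ∀ {k m} → (Fin k → ℤ) → (Fin k → Lin m) → Lin m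
  form-of {zero}  a xs = ‵ + 0
  form-of {suc k} a xs = a zero ⊛ xs zero ⊕ form-of (λ i → a (suc i)) (λ i → xs (suc i))

  Affine : ℕ → Set
  Affine k = ℤ × Vec ℤ k

  dot : ∀ {k} → Vec ℤ k → Vec Carrier k → Carrier
  dot []       []      = 0r
  dot (z ∷ zs) (x ∷ ρ) = fromℤ z * x + dot zs ρ

  ⟪_⟫ : ∀ {k} → Affine k → Vec Carrier k → Carrier
  ⟪ z , zs ⟫ ρ = fromℤ z + dot zs ρ

  zeros : ∀ k → Vec ℤ k
  zeros zero    = []
  zeros (suc k) = + 0 ∷ zeros k

  unit : ∀ {k} → Fin k → Vec ℤ k
  unit {suc k} zero    = + 1 ∷ zeros k
  unit {suc k} (suc i) = + 0 ∷ unit i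

  lincomb : ∀ {k} → ℤ → Vec ℤ k → ℤ → Vec ℤ k → Vec ℤ k
  lincomb p []       q []       = []
  lincomb p (y ∷ ys) q (z ∷ zs) = p ℤ.* y ℤ.+ q ℤ.* z ∷ lincomb p ys q zs

  normal : ∀ {k} → Lin k → Affine k
  normal {k} (var i) = + 0 , unit i
  normal {k} (‵ z)   = z , zeros k
  normal (x ⊕ y) = let (u , us) = normal x ; (v , vs) = normal y in u ℤ.+ v , lincomb (+ 1) us (+ 1) vs
  normal (x ⊝ y) = let (u , us) = normal x ; (v , vs) = normal y in u ℤ.+ ℤ.- v , lincomb (+ 1) us (ℤ.- + 1) vs
  normal (z ⊛ x) = let (u , us) = normal x in z ℤ.* u , lincomb z us (+ 0) us

  dot-zeros : ∀ {k} (ρ : Vec Carrier k) → dot (zeros k) ρ ≡ 0r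
  dot-zeros []      = refl
  dot-zeros (x ∷ ρ) = trans (cong₂ _+_ (zeroˡ x) (dot-zeros ρ)) (+-identityʳ 0r)

  dot-unit : ∀ {k} i (ρ : Vec Carrier k) → dot (unit i) ρ ≡ lookup ρ i
  dot-unit zero    (x ∷ ρ) = trans (cong (λ t → fromℤ (+ 1) * x + t) (dot-zeros ρ))
                                   (solve 1 (λ x → con (+ 1) :* x :+ con (+ 0) := x) refl x)
  dot-unit (suc i) (x ∷ ρ) = trans (cong (λ t → fromℤ (+ 0) * x + t) (dot-unit i ρ))
                                   (solve 2 (λ x y → con (+ 0) :* x :+ y := y) refl x _)

  dot-lincomb : ∀ {k} p (ys : Vec ℤ k) q zs ρ →
                dot (lincomb p ys q zs) ρ ≡ fromℤ p * dot ys ρ + fromℤ q * dot zs ρ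
  dot-lincomb p []       q []       []      = solve 2 (λ p q → con (+ 0) := p :* con (+ 0) :+ q :* con (+ 0)) refl (fromℤ p) (fromℤ q)
  dot-lincomb p (y ∷ ys) q (z ∷ zs) (x ∷ ρ) = begin
    fromℤ (p ℤ.* y ℤ.+ q ℤ.* z) * x + dot (lincomb p ys q zs) ρ
      ≡⟨ cong₂ (λ u v → u * x + v)
           (trans (fromℤ-+ (p ℤ.* y) (q ℤ.* z)) (cong₂ _+_ (fromℤ-* p y) (fromℤ-* q z)))
           (dot-lincomb p ys q zs ρ) ⟩
    (fromℤ p * fromℤ y + fromℤ q * fromℤ z) * x + (fromℤ p * dot ys ρ + fromℤ q * dot zs ρ)
      ≡⟨ solve 7 (λ p y q z x u v → (p :* y :+ q :* z) :* x :+ (p :* u :+ q :* v)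
                                 := p :* (y :* x :+ u) :+ q :* (z :* x :+ v)) refl
           (fromℤ p) (fromℤ y) (fromℤ q) (fromℤ z) x (dot ys ρ) (dot zs ρ) ⟩
    fromℤ p * (fromℤ y * x + dot ys ρ) + fromℤ q * (fromℤ z * x + dot zs ρ) ∎

  normal-correct : ∀ {k} (x : Lin k) ρ → ⟦ x ⟧ ρ ≡ ⟪ normal x ⟫ ρ
  normal-correct (var i) ρ = sym (trans (+-identityˡ _) (dot-unit i ρ))
  normal-correct (‵ z)   ρ = sym (trans (cong (λ t → fromℤ z + t) (dot-zeros ρ)) (+-identityʳ _))
  normal-correct (x ⊕ y) ρ = let (u , us) = normal x ; (v , vs) = normal y in begin
    ⟦ x ⟧ ρ + ⟦ y ⟧ ρ ≡⟨ cong₂ _+_ (normal-correct x ρ) (normal-correct y ρ) ⟩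
    (fromℤ u + dot us ρ) + (fromℤ v + dot vs ρ)
      ≡⟨ solve 4 (λ u us v vs → (u :+ us) :+ (v :+ vs) := (u :+ v) :+ (con (+ 1) :* us :+ con (+ 1) :* vs)) refl
           (fromℤ u) (dot us ρ) (fromℤ v) (dot vs ρ) ⟩
    (fromℤ u + fromℤ v) + (fromℤ (+ 1) * dot us ρ + fromℤ (+ 1) * dot vs ρ)
      ≡⟨ cong₂ _+_ (fromℤ-+ u v) (dot-lincomb (+ 1) us (+ 1) vs ρ) ⟨
    ⟪ normal (x ⊕ y) ⟫ ρ ∎
  normal-correct (x ⊝ y) ρ = let (u , us) = normal x ; (v , vs) = normal y in begin
    ⟦ x ⟧ ρ + - ⟦ y ⟧ ρ ≡⟨ cong₂ (λ p q → p + - q) (normal-correct x ρ) (normal-correct y ρ) ⟩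
    (fromℤ u + dot us ρ) + - (fromℤ v + dot vs ρ)
      ≡⟨ solve 4 (λ u us v vs → (u :+ us) :+ :- (v :+ vs) := (u :+ :- v) :+ (con (+ 1) :* us :+ con (ℤ.- + 1) :* vs)) refl
           (fromℤ u) (dot us ρ) (fromℤ v) (dot vs ρ) ⟩
    (fromℤ u + - fromℤ v) + (fromℤ (+ 1) * dot us ρ + fromℤ (ℤ.- + 1) * dot vs ρ)
      ≡⟨ cong₂ _+_ (trans (fromℤ-+ u (ℤ.- v)) (cong (λ t → fromℤ u + t) (fromℤ-neg v))) (dot-lincomb (+ 1) us (ℤ.- + 1) vs ρ) ⟨
    ⟪ normal (x ⊝ y) ⟫ ρ ∎
  normal-correct (z ⊛ x) ρ = let (u , us) = normal x in begin
    fromℤ z * ⟦ x ⟧ ρ ≡⟨ cong (fromℤ z *_) (normal-correct x ρ) ⟩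
    fromℤ z * (fromℤ u + dot us ρ)
      ≡⟨ solve 3 (λ z u us → z :* (u :+ us) := z :* u :+ (z :* us :+ con (+ 0) :* us)) refl (fromℤ z) (fromℤ u) (dot us ρ) ⟩
    fromℤ z * fromℤ u + (fromℤ z * dot us ρ + fromℤ (+ 0) * dot us ρ)
      ≡⟨ cong₂ _+_ (fromℤ-* z u) (dot-lincomb z us (+ 0) us ρ) ⟨
    ⟪ normal (z ⊛ x) ⟫ ρ ∎

  data Relation : Set where
    equal atLeast above : Relation

  Constraint : ℕ → Set
  Constraint k = Relation × Affine k

  Holds : ∀ {k} → Vec Carrier k → Constraint k → Set
  Holds ρ (equal   , φ) = ⟪ φ ⟫ ρ ≡ 0r
  Holds ρ (atLeast , φ) = 0r ≤ ⟪ φ ⟫ ρ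
  Holds ρ (above   , φ) = 0r < ⟪ φ ⟫ ρ

  combine : ∀ {k} → ℤ → Affine k → ℤ → Affine k → Affine k
  combine p (y , ys) q (z , zs) = p ℤ.* y ℤ.+ q ℤ.* z , lincomb p ys q zs

  combine-correct : ∀ {k} p (φ : Affine k) q ψ ρ → ⟪ combine p φ q ψ ⟫ ρ ≡ fromℤ p * ⟪ φ ⟫ ρ + fromℤ q * ⟪ ψ ⟫ ρ
  combine-correct p (y , ys) q (z , zs) ρ = trans
    (cong₂ _+_ (trans (fromℤ-+ (p ℤ.* y) (q ℤ.* z)) (cong₂ _+_ (fromℤ-* p y) (fromℤ-* q z))) (dot-lincomb p ys q zs ρ))
    (solve 6 (λ p y q z u v → p :* y :+ q :* z :+ (p :* u :+ q :* v) := p :* (y :+ u) :+ q :* (z :+ v)) refl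
      (fromℤ p) (fromℤ y) (fromℤ q) (fromℤ z) (dot ys ρ) (dot zs ρ))

  -- `φ` is going to vanish, so its multiplier `z` may have any sign; `ψ` is scaled by a positive
  -- number, which preserves the relation `R`.
  reduceBy : ∀ {k} → ℕ → ℤ → Affine k → Constraint k → Constraint k
  reduceBy a z φ (R , ψ) = R , combine +[1+ a ] ψ z φ

  reduceBy-holds : ∀ {k} {ρ : Vec Carrier k} a z φ c → ⟪ φ ⟫ ρ ≡ 0r → Holds ρ c → Holds ρ (reduceBy a z φ c)
  reduceBy-holds {ρ = ρ} a z φ (R , ψ) φ≡0 h = go R h
    where
    value : ⟪ combine +[1+ a ] ψ z φ ⟫ ρ ≡ fromℤ +[1+ a ] * ⟪ ψ ⟫ ρ
    value = trans (combine-correct +[1+ a ] ψ z φ ρ) (trans (cong (λ u → fromℤ +[1+ a ] * ⟪ ψ ⟫ ρ + fromℤ z * u) φ≡0)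
              (trans (cong (λ u → fromℤ +[1+ a ] * ⟪ ψ ⟫ ρ + u) (zeroʳ _)) (+-identityʳ _)))
    go : ∀ R → Holds ρ (R , ψ) → Holds ρ (R , combine +[1+ a ] ψ z φ)
    go equal   h = trans value (trans (cong (fromℤ +[1+ a ] *_) h) (zeroʳ _))
    go atLeast h = subst (0r ≤_) (sym value) (0≤-* (0≤fromℕ (suc a)) h)
    go above   h = subst (0r <_) (sym value) (*-pos (0<fromℕ a) h)

  join : Relation → Relation → Relation
  join above _     = above
  join _     above = above
  join _     _     = atLeast

  addTo : ∀ {k} → ℕ → ℕ → Constraint k → Constraint k → Constraint k
  addTo a c (R , φ) (S , ψ) = join R S , combine +[1+ a ] φ +[1+ c ] ψ

  Holds⇒≥0 : ∀ {k} {ρ : Vec Carrier k} R φ → Holds ρ (R , φ) → 0r ≤ ⟪ φ ⟫ ρ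
  Holds⇒≥0 equal   φ h = inj₂ (sym h)
  Holds⇒≥0 atLeast φ h = h
  Holds⇒≥0 above   φ h = inj₁ h

  addTo-holds : ∀ {k} {ρ : Vec Carrier k} a c x y → Holds ρ x → Holds ρ y → Holds ρ (addTo a c x y)
  addTo-holds {ρ = ρ} a c (R , φ) (S , ψ) h₁ h₂ = go R S h₁ h₂
    where
    χ = combine +[1+ a ] φ +[1+ c ] ψ
    value = combine-correct +[1+ a ] φ +[1+ c ] ψ ρ
    nonneg : ∀ k {x} → 0r ≤ x → 0r ≤ fromℤ +[1+ k ] * x
    nonneg k = 0≤-* (0≤fromℕ (suc k))
    weak : 0r ≤ ⟪ χ ⟫ ρ
    weak = subst (0r ≤_) (sym value) (0≤-+ (nonneg a (Holds⇒≥0 R φ h₁)) (nonneg c (Holds⇒≥0 S ψ h₂)))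
    left : 0r < ⟪ φ ⟫ ρ → 0r < ⟪ χ ⟫ ρ
    left p = subst (0r <_) (sym value) (0<-+ (*-pos (0<fromℕ a) p) (nonneg c (Holds⇒≥0 S ψ h₂)))
    right : 0r < ⟪ ψ ⟫ ρ → 0r < ⟪ χ ⟫ ρ
    right p = subst (0r <_) (trans (+-comm _ _) (sym value)) (0<-+ (*-pos (0<fromℕ c) p) (nonneg a (Holds⇒≥0 R φ h₁)))
    go : ∀ R S → Holds ρ (R , φ) → Holds ρ (S , ψ) → Holds ρ (join R S , χ)
    go above   _       h _ = left h
    go equal   above   _ h = right h
    go atLeast above   _ h = right h
    go equal   equal   _ _ = weak
    go equal   atLeast _ _ = weak
    go atLeast equal   _ _ = weak
    go atLeast atLeast _ _ = weak

  pivot : ∀ {k} → List (Constraint (suc k)) → Maybe (Affine (suc k))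
  pivot []                                   = nothing
  pivot ((equal , φ@(_ , +[1+ _ ] ∷ _)) ∷ cs) = just φ
  pivot ((equal , φ@(_ , -[1+ _ ] ∷ _)) ∷ cs) = just φ
  pivot (_ ∷ cs)                             = pivot cs

  pivot-vanishes : ∀ {k} {ρ : Vec Carrier (suc k)} cs {φ} → All (Holds ρ) cs → pivot cs ≡ just φ → ⟪ φ ⟫ ρ ≡ 0r
  pivot-vanishes ((equal   , (_ , +[1+ _ ] ∷ _)) ∷ cs) (h ∷ hs) refl = h
  pivot-vanishes ((equal   , (_ , -[1+ _ ] ∷ _)) ∷ cs) (h ∷ hs) refl = h
  pivot-vanishes ((equal   , (_ , + zero ∷ _)) ∷ cs) (h ∷ hs) p = pivot-vanishes cs hs p
  pivot-vanishes ((atLeast , _) ∷ cs) (h ∷ hs) p = pivot-vanishes cs hs p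
  pivot-vanishes ((above   , _) ∷ cs) (h ∷ hs) p = pivot-vanishes cs hs p

  -- Constraints that still contain the eliminated variable are discarded. This only weakens the
  -- system, which is harmless for refutation.
  drop : ∀ {k} → List (Constraint (suc k)) → List (Constraint k)
  drop []                               = []
  drop ((R , (z , + zero ∷ zs)) ∷ cs)   = (R , (z , zs)) ∷ drop cs
  drop ((R , (z , +[1+ _ ] ∷ zs)) ∷ cs) = drop cs
  drop ((R , (z , -[1+ _ ] ∷ zs)) ∷ cs) = drop cs

  drop-value : ∀ {k} (x : Carrier) (ρ : Vec Carrier k) z zs → ⟪ z , + 0 ∷ zs ⟫ (x ∷ ρ) ≡ ⟪ z , zs ⟫ ρ
  drop-value x ρ z zs = cong (λ t → fromℤ z + t) (trans (cong (_+ dot zs ρ) (zeroˡ x)) (+-identityˡ _))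

  drop-holds : ∀ {k} {x : Carrier} {ρ : Vec Carrier k} cs → All (Holds (x ∷ ρ)) cs → All (Holds ρ) (drop cs)
  drop-holds [] [] = []
  drop-holds {x = x} {ρ} ((equal   , (z , + zero ∷ zs)) ∷ cs) (h ∷ hs) = trans (sym (drop-value x ρ z zs)) h ∷ drop-holds cs hs
  drop-holds {x = x} {ρ} ((atLeast , (z , + zero ∷ zs)) ∷ cs) (h ∷ hs) = subst (0r ≤_) (drop-value x ρ z zs) h ∷ drop-holds cs hs
  drop-holds {x = x} {ρ} ((above   , (z , + zero ∷ zs)) ∷ cs) (h ∷ hs) = subst (0r <_) (drop-value x ρ z zs) h ∷ drop-holds cs hs
  drop-holds ((R , (z , +[1+ _ ] ∷ zs)) ∷ cs) (h ∷ hs) = drop-holds cs hs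
  drop-holds ((R , (z , -[1+ _ ] ∷ zs)) ∷ cs) (h ∷ hs) = drop-holds cs hs

  -- Cross-multiplication cancels the leading coefficient. For a negative pivot the sign of `z` is
  -- kept instead of being flipped, so that the constraint itself is always scaled by a positive
  -- factor.
  substitute : ∀ {k} → Affine (suc k) → Constraint (suc k) → Constraint (suc k)
  substitute φ@(_ , +[1+ a ] ∷ _) c@(_ , (_ , z ∷ _)) = reduceBy a (ℤ.- z) φ c
  substitute φ@(_ , -[1+ a ] ∷ _) c@(_ , (_ , z ∷ _)) = reduceBy a z φ c
  substitute φ@(_ , + zero ∷ _)   c                   = c

  substitute-holds : ∀ {k} {ρ : Vec Carrier (suc k)} φ c → ⟪ φ ⟫ ρ ≡ 0r → Holds ρ c → Holds ρ (substitute φ c)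
  substitute-holds φ@(_ , +[1+ a ] ∷ _) c@(_ , (_ , z ∷ _)) = reduceBy-holds a (ℤ.- z) φ c
  substitute-holds φ@(_ , -[1+ a ] ∷ _) c@(_ , (_ , z ∷ _)) = reduceBy-holds a z φ c
  substitute-holds φ@(_ , + zero ∷ _)   c                   = λ _ h → h

  -- Two constraints with opposite leading signs are combined, each weighted by the absolute leading
  -- coefficient of the other, so that the variable cancels. `eliminate` comes here only when no
  -- equality contains the variable.
  against : ∀ {k} → Constraint (suc k) → List (Constraint (suc k)) → List (Constraint (suc k))
  against x [] = []
  against x@(_ , (_ , +[1+ a ] ∷ _)) (y@(_ , (_ , -[1+ c ] ∷ _)) ∷ ys) = addTo c a x y ∷ against x ys
  against x@(_ , (_ , -[1+ a ] ∷ _)) (y@(_ , (_ , +[1+ c ] ∷ _)) ∷ ys) = addTo c a x y ∷ against x ys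
  against x (_ ∷ ys) = against x ys

  against-holds : ∀ {k} {ρ : Vec Carrier (suc k)} x ys → Holds ρ x → All (Holds ρ) ys → All (Holds ρ) (against x ys)
  against-holds x [] h [] = []
  against-holds x@(_ , (_ , +[1+ a ] ∷ _)) (y@(_ , (_ , -[1+ c ] ∷ _)) ∷ ys) h (k ∷ ks) = addTo-holds c a x y h k ∷ against-holds x ys h ks
  against-holds x@(_ , (_ , +[1+ a ] ∷ _)) (y@(_ , (_ , + _ ∷ _)) ∷ ys) h (k ∷ ks) = against-holds x ys h ks
  against-holds x@(_ , (_ , -[1+ a ] ∷ _)) (y@(_ , (_ , +[1+ c ] ∷ _)) ∷ ys) h (k ∷ ks) = addTo-holds c a x y h k ∷ against-holds x ys h ks
  against-holds x@(_ , (_ , -[1+ a ] ∷ _)) (y@(_ , (_ , + zero ∷ _)) ∷ ys) h (k ∷ ks) = against-holds x ys h ks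
  against-holds x@(_ , (_ , -[1+ a ] ∷ _)) (y@(_ , (_ , -[1+ _ ] ∷ _)) ∷ ys) h (k ∷ ks) = against-holds x ys h ks
  against-holds x@(_ , (_ , + zero ∷ _)) (y ∷ ys) h (k ∷ ks) = against-holds x ys h ks

  pairs : ∀ {k} → List (Constraint (suc k)) → List (Constraint (suc k))
  pairs []       = []
  -- `x` itself is kept in case it is free of the variable; otherwise `drop` removes it.
  pairs (x ∷ xs) = x ∷ (against x xs List.++ pairs xs)

  pairs-holds : ∀ {k} {ρ : Vec Carrier (suc k)} xs → All (Holds ρ) xs → All (Holds ρ) (pairs xs)
  pairs-holds []       []       = []
  pairs-holds (x ∷ xs) (h ∷ hs) = h ∷ ++⁺ (against-holds x xs h hs) (pairs-holds xs hs)

  eliminate : ∀ {k} → List (Constraint (suc k)) → List (Constraint k)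
  eliminate cs with pivot cs
  ... | just φ  = drop (map (substitute φ) cs)
  ... | nothing = drop (pairs cs)

  eliminate-holds : ∀ {k} {x : Carrier} {ρ : Vec Carrier k} cs → All (Holds (x ∷ ρ)) cs → All (Holds ρ) (eliminate cs)
  eliminate-holds cs hs with pivot cs in p
  ... | just φ  = drop-holds _ (map⁺ (All.map (λ {c} → substitute-holds φ c (pivot-vanishes cs hs p)) hs))
  ... | nothing = drop-holds _ (pairs-holds cs hs)

  absurd : Constraint 0 → Bool
  absurd (equal   , (+ zero   , [])) = false
  absurd (equal   , (_        , [])) = true
  absurd (atLeast , (-[1+ _ ] , [])) = true
  absurd (atLeast , (_        , [])) = false
  absurd (above   , (+[1+ _ ] , [])) = false
  absurd (above   , (_        , [])) = true

  absurd-fails : ∀ c → absurd c ≡ true → ¬ Holds [] c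
  absurd-fails (equal   , (+[1+ k ] , [])) _ h = pos⇒≢0 (0<fromℕ k) (trans (sym (+-identityʳ _)) h)
  absurd-fails (equal   , (-[1+ k ] , [])) _ h = <-irrefl _ (subst (_< 0r) (trans (sym (+-identityʳ _)) h) (fromℤ-neg<0 k))
  absurd-fails (atLeast , (-[1+ k ] , [])) _ h = ≤⇒≯ h (subst (_< 0r) (sym (+-identityʳ _)) (fromℤ-neg<0 k))
  absurd-fails (above   , (+ zero   , [])) _ h = <-irrefl _ (subst (0r <_) (+-identityʳ _) h)
  absurd-fails (above   , (-[1+ k ] , [])) _ h = <-irrefl _ (<-trans h (subst (_< 0r) (sym (+-identityʳ _)) (fromℤ-neg<0 k)))

  inconsistent : ∀ k → List (Constraint k) → Bool
  inconsistent zero    []       = false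
  inconsistent zero    (c ∷ cs) = absurd c ∨ inconsistent zero cs
  inconsistent (suc k) cs       = inconsistent k (eliminate cs)

  inconsistent-sound : ∀ {k} (ρ : Vec Carrier k) cs → inconsistent k cs ≡ true → ¬ All (Holds ρ) cs
  inconsistent-sound []      (c ∷ cs) p (h ∷ hs) with absurd c in q
  ... | true  = absurd-fails c q h
  ... | false = inconsistent-sound [] cs p hs
  inconsistent-sound (x ∷ ρ) cs       p hs = inconsistent-sound ρ (eliminate cs) p (eliminate-holds cs hs)

  infix 5 _≼_by_ _≺_by_ _≈_by_

  -- `constraint` forgets the proof stored in a fact, so the check computes on integer coefficients
  -- alone although the proofs concern abstract reals.
  data Fact {k} (ρ : Vec Carrier k) : Set where
    _≼_by_ : (x y : Lin k) → ⟦ x ⟧ ρ ≤ ⟦ y ⟧ ρ → Fact ρ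
    _≺_by_ : (x y : Lin k) → ⟦ x ⟧ ρ < ⟦ y ⟧ ρ → Fact ρ
    _≈_by_ : (x y : Lin k) → ⟦ x ⟧ ρ ≡ ⟦ y ⟧ ρ → Fact ρ

  constraint : ∀ {k} {ρ : Vec Carrier k} → Fact ρ → Constraint k
  constraint (x ≼ y by _) = atLeast , normal (y ⊝ x)
  constraint (x ≺ y by _) = above   , normal (y ⊝ x)
  constraint (x ≈ y by _) = equal   , normal (y ⊝ x)

  constraint-holds : ∀ {k} {ρ : Vec Carrier k} (h : Fact ρ) → Holds ρ (constraint h)
  constraint-holds {ρ = ρ} (x ≼ y by p) = subst (0r ≤_) (normal-correct (y ⊝ x) ρ) (≤⇒0≤ p)
  constraint-holds {ρ = ρ} (x ≺ y by p) = subst (0r <_) (normal-correct (y ⊝ x) ρ) (<⇒0< p)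
  constraint-holds {ρ = ρ} (x ≈ y by p) = trans (sym (normal-correct (y ⊝ x) ρ)) (trans (cong (λ u → ⟦ y ⟧ ρ + - u) p) (-‿inverseʳ _))

  refuted : ∀ {k} {ρ : Vec Carrier k} → List (Fact ρ) → Bool
  refuted {k} hs = inconsistent k (map constraint hs)

  -- The implicit T argument is inferred exactly when the elimination finds a contradiction.
  refute : ∀ {k} (ρ : Vec Carrier k) (hs : List (Fact ρ)) {_ : T (refuted hs)} → ⊥
  refute ρ hs {p} = inconsistent-sound ρ (map constraint hs) (Equivalence.to T-≡ p) (map⁺ (All.universal constraint-holds hs))

  strictly : ∀ {k} (ρ : Vec Carrier k) → Lin k → Lin k → List (Fact ρ) → Bool
  strictly {k} ρ x y hs = inconsistent k ((above , normal (y ⊝ x)) ∷ map constraint hs)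

  weakly : ∀ {k} (ρ : Vec Carrier k) → Lin k → Lin k → List (Fact ρ) → Bool
  weakly {k} ρ x y hs = inconsistent k ((atLeast , normal (y ⊝ x)) ∷ map constraint hs)

  -- Refutes the strict negation of the goal together with the hypotheses; `strictly ρ y x hs`
  -- unfolds to exactly the check that `refute` asks for.
  linear-≤ : ∀ {k} (ρ : Vec Carrier k) (x y : Lin k) (hs : List (Fact ρ)) {_ : T (strictly ρ y x hs)} → ⟦ x ⟧ ρ ≤ ⟦ y ⟧ ρ
  linear-≤ ρ x y hs {check} = ≮⇒≥ λ p → refute ρ ((y ≺ x by p) ∷ hs) {check}

  linear-< : ∀ {k} (ρ : Vec Carrier k) (x y : Lin k) (hs : List (Fact ρ)) {_ : T (weakly ρ y x hs)} → ⟦ x ⟧ ρ < ⟦ y ⟧ ρ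
  linear-< ρ x y hs {check} with ≤-or-> (⟦ y ⟧ ρ) (⟦ x ⟧ ρ)
  ... | inj₁ p = ⊥-elim (refute ρ ((y ≼ x by p) ∷ hs) {check})
  ... | inj₂ p = p

  nonzero : ∀ {k} (ρ : Vec Carrier k) (x : Lin k) (hs : List (Fact ρ)) {_ : T (inconsistent k ((equal , normal (‵ + 0 ⊝ x)) ∷ map constraint hs))} →
            ⟦ x ⟧ ρ ≢ 0r
  nonzero ρ x hs {check} p = refute ρ ((x ≈ ‵ + 0 by p) ∷ hs) {check}

  linear-≡ : ∀ {k} (ρ : Vec Carrier k) (x y : Lin k) (hs : List (Fact ρ)) {_ : T (strictly ρ y x hs)} {_ : T (strictly ρ x y hs)} →
             ⟦ x ⟧ ρ ≡ ⟦ y ⟧ ρ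
  linear-≡ ρ x y hs {p} {q} = ≤-antisym (linear-≤ ρ x y hs {p}) (linear-≤ ρ y x hs {q})

δ : ∀ {k} → Fin k → Fin k → ℤ
δ zero    zero    = + 1
δ zero    (suc j) = + 0
δ (suc i) zero    = + 0
δ (suc i) (suc j) = δ i j

sumAbs : ∀ {k} → (Fin k → ℤ) → ℕ
sumAbs {zero}  a = 0
sumAbs {suc k} a = ∣ a zero ∣ ℕ.+ sumAbs (λ i → a (suc i))

-- Linear forms, vertices, adjacency and walks in a general polyhedron.

module Walks (ℝ : RealField) (P : Polyhedron ℝ) where
  open RealField ℝ hiding (_-_)
  open Polyhedron P
  open Theory ℝ P public
  open Reals ℝ P public
  open ≡-Reasoning

  Σr-cong : ∀ {k} {x y : Fin k → Carrier} → (∀ i → x i ≡ y i) → Σr x ≡ Σr y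
  Σr-cong {zero}  p = refl
  Σr-cong {suc k} p = cong₂ _+_ (p zero) (Σr-cong (λ i → p (suc i)))

  Σr-+ : ∀ {k} (x y : Fin k → Carrier) → Σr (λ i → x i + y i) ≡ Σr x + Σr y
  Σr-+ {zero}  x y = sym (+-identityˡ 0r)
  Σr-+ {suc k} x y = trans (cong (λ t → x zero + y zero + t) (Σr-+ (λ i → x (suc i)) (λ i → y (suc i))))
    (solve 4 (λ p q t u → p :+ q :+ (t :+ u) := p :+ t :+ (q :+ u)) refl _ _ _ _)

  Σr-* : ∀ {k} c (x : Fin k → Carrier) → Σr (λ i → c * x i) ≡ c * Σr x
  Σr-* {zero}  c x = sym (zeroʳ c)
  Σr-* {suc k} c x = trans (cong (λ t → c * x zero + t) (Σr-* c (λ i → x (suc i)))) (sym (distribˡ c _ _))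

  Σr-fromℤ : ∀ {k} (z : Fin k → ℤ) → Σr (λ i → fromℤ (z i)) ≡ fromℤ (Σℤ z)
  Σr-fromℤ {zero}  z = refl
  Σr-fromℤ {suc k} z = trans (cong (λ t → fromℤ (z zero) + t) (Σr-fromℤ (λ i → z (suc i)))) (sym (fromℤ-+ (z zero) _))

  Σr-zeros : ∀ {k} {x : Fin k → Carrier} → (∀ i → x i ≡ 0r) → Σr x ≡ 0r
  Σr-zeros {zero}  p = refl
  Σr-zeros {suc k} p = trans (cong₂ _+_ (p zero) (Σr-zeros (λ i → p (suc i)))) (+-identityʳ 0r)

  Σr-swap : ∀ {j k} (x : Fin j → Fin k → Carrier) → Σr (λ i → Σr (x i)) ≡ Σr (λ l → Σr (λ i → x i l))
  Σr-swap {zero}  {k} x = sym (Σr-zeros {k} (λ _ → refl))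
  Σr-swap {suc j} {k} x = trans (cong (λ t → Σr (x zero) + t) (Σr-swap (λ i → x (suc i)))) (sym (Σr-+ {k} (x zero) _))

  Σr-≥0 : ∀ {k} (x : Fin k → Carrier) → (∀ i → 0r ≤ x i) → 0r ≤ Σr x
  Σr-≥0 {zero}  x p = ≤-refl
  Σr-≥0 {suc k} x p = 0≤-+ (p zero) (Σr-≥0 _ (λ i → p (suc i)))

  Σr-≥0-vanish : ∀ {k} (x : Fin k → Carrier) → (∀ i → 0r ≤ x i) → Σr x ≡ 0r → ∀ i → x i ≡ 0r
  Σr-≥0-vanish {suc k} x p sum zero = ≤-antisym (≮⇒≥ λ q → pos⇒≢0 (0<-+ q (Σr-≥0 _ (λ i → p (suc i)))) sum) (p zero)
  Σr-≥0-vanish {suc k} x p sum (suc i) = Σr-≥0-vanish (λ i → x (suc i)) (λ i → p (suc i))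
    (≤-antisym (≮⇒≥ λ q → pos⇒≢0 (0<-+ q (p zero)) (trans (+-comm _ _) sum)) (Σr-≥0 _ (λ i → p (suc i)))) i

  -- A linear form; both A· and B· unfold to it.
  row : (Fin n → ℤ) → Point → Carrier
  row a z = Σr (λ j → fromℤ (a j) * z j)

  row-cong : ∀ a {x y} → x ≐ y → row a x ≡ row a y
  row-cong a p = Σr-cong (λ j → cong (fromℤ (a j) *_) (p j))

  row-lin : ∀ a p q x y → row a (λ i → p * x i + q * y i) ≡ p * row a x + q * row a y
  row-lin a p q x y = begin
    Σr (λ j → fromℤ (a j) * (p * x j + q * y j))
      ≡⟨ Σr-cong (λ j → solve 5 (λ a p q x y → a :* (p :* x :+ q :* y) := p :* (a :* x) :+ q :* (a :* y)) refl
           (fromℤ (a j)) p q (x j) (y j)) ⟩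
    Σr (λ j → p * (fromℤ (a j) * x j) + q * (fromℤ (a j) * y j))
      ≡⟨ Σr-+ {n} _ _ ⟩
    Σr (λ j → p * (fromℤ (a j) * x j)) + Σr (λ j → q * (fromℤ (a j) * y j))
      ≡⟨ cong₂ _+_ (Σr-* {n} p _) (Σr-* {n} q _) ⟩
    p * row a x + q * row a y ∎

  row-sub : ∀ a x y → row a (λ i → x i + - y i) ≡ row a x + - row a y
  row-sub a x y = trans (row-cong a (λ i → solve 2 (λ x y → x :+ :- y := con (+ 1) :* x :+ con (ℤ.- + 1) :* y) refl (x i) (y i)))
    (trans (row-lin a (fromℤ (+ 1)) (fromℤ (ℤ.- + 1)) x y) (solve 2 (λ x y → con (+ 1) :* x :+ con (ℤ.- + 1) :* y := x :+ :- y) refl (row a x) (row a y)))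

  row-fromℤ : ∀ a (g : IntVec) → row a (λ j → fromℤ (g j)) ≡ fromℤ (Σℤ (λ j → a j ℤ.* g j))
  row-fromℤ a g = trans (Σr-cong (λ j → sym (fromℤ-* (a j) (g j)))) (Σr-fromℤ (λ j → a j ℤ.* g j))

  row-step : ∀ a y α g → row a (y +[ α ] g) ≡ row a y + α * fromℤ (Σℤ (λ j → a j ℤ.* g j))
  row-step a y α g = begin
    row a (y +[ α ] g)
      ≡⟨ row-cong a (λ i → cong (_+ α * fromℤ (g i)) (sym (*-identityˡ (y i)))) ⟩
    row a (λ i → 1r * y i + α * fromℤ (g i))
      ≡⟨ row-lin a 1r α y (λ j → fromℤ (g j)) ⟩
    1r * row a y + α * row a (λ j → fromℤ (g j))
      ≡⟨ cong₂ _+_ (*-identityˡ _) (cong (α *_) (row-fromℤ a g)) ⟩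
    row a y + α * fromℤ (Σℤ (λ j → a j ℤ.* g j)) ∎

  Σr-δ : ∀ {k} (i : Fin k) (y : Fin k → Carrier) → Σr (λ j → fromℤ (δ i j) * y j) ≡ y i
  Σr-δ {suc k} zero y = trans (cong (λ u → fromℤ (+ 1) * y zero + u) (Σr-0 (λ j → y (suc j))))
      (solve 1 (λ x → con (+ 1) :* x :+ con (+ 0) := x) refl (y zero))
    where
    Σr-0 : ∀ {k} (y : Fin k → Carrier) → Σr (λ j → fromℤ (+ 0) * y j) ≡ 0r
    Σr-0 {k} y = trans (Σr-* {k} 0r y) (zeroˡ _)
  Σr-δ {suc k} (suc i) y = trans (cong (λ u → fromℤ (+ 0) * y zero + u) (Σr-δ i (λ j → y (suc j))))
      (solve 2 (λ x z → con (+ 0) :* x :+ z := z) refl (y zero) (y (suc i)))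

  row-neg : ∀ a y → row (λ j → ℤ.- a j) y ≡ - row a y
  row-neg a y = begin
    Σr (λ j → fromℤ (ℤ.- a j) * y j)
      ≡⟨ Σr-cong (λ j → trans (cong (_* y j) (fromℤ-neg (a j))) (solve 2 (λ a y → :- a :* y := con (ℤ.- + 1) :* (a :* y)) refl (fromℤ (a j)) (y j))) ⟩
    Σr (λ j → fromℤ (ℤ.- + 1) * (fromℤ (a j) * y j)) ≡⟨ Σr-* {n} (fromℤ (ℤ.- + 1)) (λ j → fromℤ (a j) * y j) ⟩
    fromℤ (ℤ.- + 1) * row a y ≡⟨ solve 1 (λ u → con (ℤ.- + 1) :* u := :- u) refl (row a y) ⟩
    - row a y ∎

  -- A nonnegative coefficient contributes at most its value times `c`, a negative one at most 0.
  -- This makes the extra rows of a box redundant.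
  row-bound : ∀ {k} c (a : Fin k → ℤ) (y : Fin k → Carrier) → (∀ j → 0r ≤ y j × y j ≤ fromℕ c) →
              Σr (λ j → fromℤ (a j) * y j) ≤ fromℕ (sumAbs a ℕ.* c)
  row-bound {zero}  c a y p = ≤-refl
  row-bound {suc k} c a y p = subst (Σr (λ j → fromℤ (a j) * y j) ≤_)
      (trans (cong (_+ fromℕ (sumAbs (λ i → a (suc i)) ℕ.* c)) (sym (fromℕ-* ∣ a zero ∣ c)))
        (trans (sym (fromℕ-+ (∣ a zero ∣ ℕ.* c) _)) (cong fromℕ (sym (ℕₚ.*-distribʳ-+ c ∣ a zero ∣ _)))))
      (+-mono-≤ (term (a zero) (p zero)) (row-bound c (λ i → a (suc i)) (λ i → y (suc i)) (λ i → p (suc i))))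
    where
    term : ∀ z {x} → 0r ≤ x × x ≤ fromℕ c → fromℤ z * x ≤ fromℕ ∣ z ∣ * fromℕ c
    term (+ k) {x} (_ , q) = 0≤⇒≤ (subst (0r ≤_) (solve 3 (λ k c x → k :* (c :+ :- x) := k :* c :+ :- (k :* x)) refl (fromℕ k) (fromℕ c) x)
                           (0≤-* (0≤fromℕ k) (≤⇒0≤ q)))
    term -[1+ k ] {x} (p , _) = ≤-trans (0≤⇒≤ (subst (0r ≤_) (solve 2 (λ k x → k :* x := con (+ 0) :+ :- (:- k :* x)) refl (fromℕ (suc k)) x)
                           (0≤-* (0≤fromℕ (suc k)) p))) (0≤-* (0≤fromℕ (suc k)) (0≤fromℕ c))

  Σℤ-δ : ∀ {k} (i : Fin k) (y : Fin k → ℤ) → Σℤ (λ j → δ i j ℤ.* y j) ≡ y i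
  Σℤ-δ {suc k} zero y = trans (cong₂ ℤ._+_ (ℤₚ.*-identityˡ (y zero)) (Σℤ-0 (λ j → y (suc j)))) (ℤₚ.+-identityʳ _)
    where
    Σℤ-0 : ∀ {k} (y : Fin k → ℤ) → Σℤ (λ j → + 0 ℤ.* y j) ≡ + 0
    Σℤ-0 {zero}  y = refl
    Σℤ-0 {suc k} y = trans (ℤₚ.+-identityˡ _) (Σℤ-0 (λ j → y (suc j)))
  Σℤ-δ {suc k} (suc i) y = trans (ℤₚ.+-identityˡ _) (Σℤ-δ i (λ j → y (suc j)))

  row-scaled : ∀ a α g → row a (λ j → α * fromℤ (g j)) ≡ α * fromℤ (Σℤ (λ j → a j ℤ.* g j))
  row-scaled a α g = begin
    row a (λ j → α * fromℤ (g j)) ≡⟨ Σr-cong (λ j → solve 3 (λ a α g → a :* (α :* g) := α :* (a :* g)) refl (fromℤ (a j)) α (fromℤ (g j))) ⟩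
    Σr (λ j → α * (fromℤ (a j) * fromℤ (g j))) ≡⟨ Σr-* {n} α _ ⟩
    α * row a (λ j → fromℤ (g j)) ≡⟨ cong (α *_) (row-fromℤ a g) ⟩
    α * fromℤ (Σℤ (λ j → a j ℤ.* g j)) ∎

  δ-diagonal : ∀ {k} (i : Fin k) → δ i i ≡ + 1
  δ-diagonal zero    = refl
  δ-diagonal (suc i) = δ-diagonal i

  δ-off-diagonal : ∀ {k} (i j : Fin k) → i ≢ j → δ i j ≡ + 0
  δ-off-diagonal zero    zero    p = ⊥-elim (p refl)
  δ-off-diagonal zero    (suc j) p = refl
  δ-off-diagonal (suc i) zero    p = refl
  δ-off-diagonal (suc i) (suc j) p = δ-off-diagonal i j (λ q → p (cong suc q))

  ≐-sym : ∀ {x y} → x ≐ y → y ≐ x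
  ≐-sym p i = sym (p i)

  ≐-trans : ∀ {x y z} → x ≐ y → y ≐ z → x ≐ z
  ≐-trans p q i = trans (p i) (q i)

  -- Points are functions compared only pointwise, so every notion that is transported between
  -- points needs such a lemma.
  InP-resp : ∀ {x y} → x ≐ y → InP x → InP y
  InP-resp p (inA , inB) = (λ l → trans (sym (row-cong (A l) p)) (inA l)) ,
                           (λ l → subst (_≤ dB l) (row-cong (B l) p) (inB l))

  +[]-cong : ∀ {x y} α g → x ≐ y → (x +[ α ] g) ≐ (y +[ α ] g)
  +[]-cong α g p i = cong (_+ α * fromℤ (g i)) (p i)

  ½ : ∃ λ t → t + t ≡ 1r × 0r < t × t < 1r
  ½ with *-inverse (1r + 1r) (pos⇒≢0 (0<-+ 0<1 (inj₁ 0<1)))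
  ... | t , inv = t , t+t , 0<t , subst (_< 1r) (+-identityˡ t) (subst (0r + t <_) t+t (+-mono-< t 0<t))
    where
    t+t : t + t ≡ 1r
    t+t = trans (trans (cong₂ _+_ (sym (*-identityʳ t)) (sym (*-identityʳ t))) (sym (distribˡ t 1r 1r))) inv
    0<t : 0r < t
    0<t = *-cancelˡ-pos (0<-+ 0<1 (inj₁ 0<1)) (subst (0r <_) (trans (sym inv) (*-comm t _)) 0<1)

  -- Every row is constant in direction `g`, so `v + g` and `v - g` both lie in the polyhedron with
  -- midpoint `v`; extremality of `v` forces `g` to vanish.
  vertex⇒pointed : ∀ {v} → IsVertex v → ∀ g → (∀ l → (Aℤ· g) l ≡ + 0) → (∀ l → (Bℤ· g) l ≡ + 0) → ∀ i → g i ≡ + 0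
  vertex⇒pointed {v} ((inA , inB) , extreme) g Ag≡0 Bg≡0 i = fromℤ-≡0 (g i) gi≡0
    where
    fixed : ∀ a α → Σℤ (λ j → a j ℤ.* g j) ≡ + 0 → row a (v +[ α ] g) ≡ row a v
    fixed a α p = trans (row-step a v α g) (trans (cong (λ z → row a v + α * fromℤ z) p)
                    (trans (cong (λ u → row a v + u) (zeroʳ α)) (+-identityʳ _)))
    onLine : ∀ α → InP (v +[ α ] g)
    onLine α = (λ l → trans (fixed (A l) α (Ag≡0 l)) (inA l)) ,
               (λ l → subst (_≤ dB l) (sym (fixed (B l) α (Bg≡0 l))) (inB l))
    t = proj₁ ½
    mid : v ≐ comb t (v +[ 1r ] g) (v +[ - 1r ] g)
    mid j = sym (begin
      t * (v j + 1r * fromℤ (g j)) + (1r + - t) * (v j + - 1r * fromℤ (g j))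
        ≡⟨ solve 4 (λ t v u g → t :* (v :+ u :* g) :+ (u :+ :- t) :* (v :+ :- u :* g) :=
             u :* v :+ ((t :+ t) :* u :+ :- (u :* u)) :* g) refl t (v j) 1r (fromℤ (g j)) ⟩
      1r * v j + ((t + t) * 1r + - (1r * 1r)) * fromℤ (g j)
        ≡⟨ cong₂ (λ p q → p + (q * 1r + - (1r * 1r)) * fromℤ (g j)) (*-identityˡ (v j)) (proj₁ (proj₂ ½)) ⟩
      v j + (1r * 1r + - (1r * 1r)) * fromℤ (g j)
        ≡⟨ solve 3 (λ v u g → v :+ (u :+ :- u) :* g := v) refl (v j) (1r * 1r) (fromℤ (g j)) ⟩
      v j ∎)
    gi≡0 : fromℤ (g i) ≡ 0r
    gi≡0 = begin
      fromℤ (g i) ≡⟨ solve 2 (λ v g → g := (v :+ con (+ 1) :* g) :+ :- v) refl (v i) (fromℤ (g i)) ⟩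
      (v i + fromℤ (+ 1) * fromℤ (g i)) + - v i
        ≡⟨ cong (λ u → (v i + u * fromℤ (g i)) + - v i) (+-identityʳ 1r) ⟩
      (v i + 1r * fromℤ (g i)) + - v i
        ≡⟨ cong (_+ - v i) (proj₁ (extreme _ _ t (onLine 1r) (onLine (- 1r)) (proj₁ (proj₂ (proj₂ ½))) (proj₂ (proj₂ (proj₂ ½))) mid) i) ⟩
      v i + - v i ≡⟨ -‿inverseʳ _ ⟩
      0r ∎

  ⟨_,_⟩ : Point → Point → Carrier
  ⟨ c , z ⟩ = Σr (λ i → c i * z i)

  ⟨⟩-cong : ∀ c {x y} → x ≐ y → ⟨ c , x ⟩ ≡ ⟨ c , y ⟩
  ⟨⟩-cong c p = Σr-cong (λ i → cong (c i *_) (p i))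

  ⟨⟩-step : ∀ c x t y → ⟨ c , (λ i → x i + t * y i) ⟩ ≡ ⟨ c , x ⟩ + t * ⟨ c , y ⟩
  ⟨⟩-step c x t y = trans (Σr-cong (λ i → solve 4 (λ c x t y → c :* (x :+ t :* y) := c :* x :+ t :* (c :* y)) refl (c i) (x i) t (y i)))
    (trans (Σr-+ {n} _ _) (cong (λ u → ⟨ c , x ⟩ + u) (Σr-* {n} t _)))

  ⟨⟩-sub : ∀ c x y → ⟨ c , (λ i → x i + - y i) ⟩ ≡ ⟨ c , x ⟩ + - ⟨ c , y ⟩
  ⟨⟩-sub c x y = trans (⟨⟩-cong c (λ i → solve 2 (λ x y → x :+ :- y := x :+ con (ℤ.- + 1) :* y) refl (x i) (y i)))
    (trans (⟨⟩-step c x (fromℤ (ℤ.- + 1)) y) (solve 2 (λ x y → x :+ con (ℤ.- + 1) :* y := x :+ :- y) refl ⟨ c , x ⟩ ⟨ c , y ⟩))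

  IsVertex-resp : ∀ {x y} → x ≐ y → IsVertex x → IsVertex y
  IsVertex-resp p (x∈ , extreme) = InP-resp p x∈ , λ u w t u∈ w∈ 0<t t<1 q →
    let (u≐ , w≐) = extreme u w t u∈ w∈ 0<t t<1 (≐-trans p q) in ≐-trans u≐ p , ≐-trans w≐ p

  Adjacent-resp : ∀ {v v′ w w′} → v ≐ v′ → w ≐ w′ → Adjacent v w → Adjacent v′ w′
  Adjacent-resp p q (vert-v , vert-w , v≢w , c , c-max , c-eq , face) =
    IsVertex-resp p vert-v , IsVertex-resp q vert-w , (λ h → v≢w (≐-trans p (≐-trans h (≐-sym q)))) , c ,
    (λ z z∈ → subst (⟨ c , z ⟩ ≤_) (⟨⟩-cong c p) (c-max z z∈)) ,
    trans (sym (⟨⟩-cong c q)) (trans c-eq (⟨⟩-cong c p)) ,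
    λ z z∈ h → let (t , 0≤t , t≤1 , on) = face z z∈ (trans h (sym (⟨⟩-cong c p))) in
      t , 0≤t , t≤1 , λ i → trans (on i) (cong₂ (λ x y → t * x + (1r + - t) * y) (p i) (q i))

  Adjacent-sym : ∀ {v w} → Adjacent v w → Adjacent w v
  Adjacent-sym {v} {w} (vert-v , vert-w , v≢w , c , c-max , c-eq , face) =
    vert-w , vert-v , (λ h → v≢w (≐-sym h)) , c ,
    (λ z z∈ → subst (⟨ c , z ⟩ ≤_) (sym c-eq) (c-max z z∈)) , sym c-eq ,
    λ z z∈ h → let (t , 0≤t , t≤1 , on) = face z z∈ (trans h c-eq) in
      1r + - t , ≤⇒0≤ t≤1 ,
      0≤⇒≤ (subst (0r ≤_) (solve 2 (λ o t → t := o :+ :- (o :+ :- t)) refl 1r t) 0≤t) ,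
      λ i → trans (on i) (solve 4 (λ o t v w → t :* v :+ (o :+ :- t) :* w := (o :+ :- t) :* w :+ (o :+ :- (o :+ :- t)) :* v) refl 1r t (v i) (w i))

  -- The functional exposing the edge is at most its maximum at `x` and at `y`, while the two values
  -- add up to twice the maximum; so `x` lies on the exposed face. A parallelogram with diagonal
  -- from `v` to `w` thus disproves adjacency if its other corners are feasible and off the segment.
  adjacent-midpoint : ∀ {v w x y} → Adjacent v w → InP x → InP y → (∀ i → x i + y i ≡ v i + w i) → ∃ λ t → x ≐ comb t v w
  adjacent-midpoint {v} {w} {x} {y} (_ , _ , _ , c , c-max , c-eq , face) x∈ y∈ mid =
      let (t , _ , _ , p) = face x x∈ (≤-antisym (c-max x x∈) (≮⇒≥ x-low)) in t , p
    where
    add : ∀ p q → Σr (λ i → c i * (p i + q i)) ≡ ⟨ c , p ⟩ + ⟨ c , q ⟩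
    add p q = trans (Σr-cong (λ i → distribˡ (c i) (p i) (q i))) (Σr-+ {n} _ _)
    total≡ : ⟨ c , x ⟩ + ⟨ c , y ⟩ ≡ ⟨ c , v ⟩ + ⟨ c , v ⟩
    total≡ = trans (sym (add x y)) (trans (Σr-cong (λ i → cong (c i *_) (mid i))) (trans (add v w) (cong (λ u → ⟨ c , v ⟩ + u) c-eq)))
    x-low : ¬ (⟨ c , x ⟩ < ⟨ c , v ⟩)
    x-low p = <-irrefl _ (subst (_< ⟨ c , v ⟩ + ⟨ c , v ⟩) total≡ (<-≤-trans (+-mono-< ⟨ c , y ⟩ p) (+-mono-≤ ≤-refl (c-max y y∈))))

  Steps : List Step → Set
  Steps = All (λ st → IsCircuit (proj₁ st) × 0r < proj₂ st)

  -- Sign-compatible walks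

  _≐ℤ?_ : (g h : IntVec) → Dec (g ≐ℤ h)
  g ≐ℤ? h = Finₚ.all? (λ i → g i ℤ.≟ h i)

  -- A step is absorbed by a later one with the same direction, the lengths being added. The
  -- intermediate points change, only the endpoint survives, so feasibility has to be proved afresh
  -- for the merged walk.
  insert : Step → List Step → List Step
  insert st [] = st ∷ []
  insert (g , α) ((h , β) ∷ ws) with g ≐ℤ? h
  ... | yes _ = (h , β + α) ∷ ws
  ... | no  _ = (h , β) ∷ insert (g , α) ws

  merge : List Step → List Step
  merge []        = []
  merge (st ∷ ws) = insert st (merge ws)

  length-insert : ∀ st ws → length (insert st ws) ℕ.≤ suc (length ws)
  length-insert st [] = ℕₚ.≤-refl
  length-insert (g , α) ((h , β) ∷ ws) with g ≐ℤ? h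
  ... | yes _ = ℕₚ.n≤1+n _
  ... | no  _ = ℕ.s≤s (length-insert (g , α) ws)

  length-merge : ∀ ws → length (merge ws) ℕ.≤ length ws
  length-merge []        = ℕ.z≤n
  length-merge (st ∷ ws) = ℕₚ.≤-trans (length-insert st (merge ws)) (ℕ.s≤s (length-merge ws))

  module _ {Q : IntVec → Set} where
    All-insert : ∀ {g α ws} → Q g → 0r < α → All (λ st → Q (proj₁ st) × 0r < proj₂ st) ws →
                 All (λ st → Q (proj₁ st) × 0r < proj₂ st) (insert (g , α) ws)
    All-insert q 0<α [] = (q , 0<α) ∷ []
    All-insert {g} {α} {(h , β) ∷ ws} q 0<α ((q′ , 0<β) ∷ qs) with g ≐ℤ? h
    ... | yes _ = (q′ , 0<-+ 0<β (inj₁ 0<α)) ∷ qs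
    ... | no  _ = (q′ , 0<β) ∷ All-insert q 0<α qs

    All-merge : ∀ {ws} → All (λ st → Q (proj₁ st) × 0r < proj₂ st) ws → All (λ st → Q (proj₁ st) × 0r < proj₂ st) (merge ws)
    All-merge []               = []
    All-merge ((q , 0<α) ∷ qs) = All-insert q 0<α (All-merge qs)

  All-distinct-insert : ∀ h {g α} ws → ¬ (h ≐ℤ g) → All (λ t → ¬ (h ≐ℤ proj₁ t)) ws →
                        All (λ t → ¬ (h ≐ℤ proj₁ t)) (insert (g , α) ws)
  All-distinct-insert h []                     h≢g []       = h≢g ∷ []
  All-distinct-insert h {g} ((h′ , β) ∷ ws) h≢g (p ∷ ps) with g ≐ℤ? h′
  ... | yes _ = p ∷ ps
  ... | no  _ = p ∷ All-distinct-insert h ws h≢g ps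

  NonRep-insert : ∀ {g α} ws → NonRep ws → NonRep (insert (g , α) ws)
  NonRep-insert []                []       = [] ∷ []
  NonRep-insert {g} ((h , β) ∷ ws) (p ∷ ps) with g ≐ℤ? h
  ... | yes _   = p ∷ ps
  ... | no  g≢h = All-distinct-insert h ws (λ q → g≢h (λ i → sym (q i))) p ∷ NonRep-insert ws ps

  NonRep-merge : ∀ ws → NonRep (merge ws)
  NonRep-merge []        = []
  NonRep-merge (st ∷ ws) = NonRep-insert (merge ws) (NonRep-merge ws)

  endpoint-cong : ∀ {x y} ws → x ≐ y → endpoint x ws ≐ endpoint y ws
  endpoint-cong []             p = p
  endpoint-cong ((g , α) ∷ ws) p = endpoint-cong ws (+[]-cong α g p)

  endpoint-insert : ∀ y g α ws → endpoint y (insert (g , α) ws) ≐ endpoint y ((g , α) ∷ ws)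
  endpoint-insert y g α []             i = refl
  endpoint-insert y g α ((h , β) ∷ ws) with g ≐ℤ? h
  ... | yes g≐h = endpoint-cong ws (λ i → trans
      (solve 4 (λ y β α h → y :+ (β :+ α) :* h := (y :+ α :* h) :+ β :* h) refl (y i) β α (fromℤ (h i)))
      (cong (λ z → (y i + α * fromℤ z) + β * fromℤ (h i)) (sym (g≐h i))))
  ... | no  _   = ≐-trans (endpoint-insert (y +[ β ] h) g α ws) (endpoint-cong ws (λ i →
      solve 3 (λ y p q → (y :+ p) :+ q := (y :+ q) :+ p) refl (y i) (β * fromℤ (h i)) (α * fromℤ (g i))))

  endpoint-merge : ∀ y ws → endpoint y (merge ws) ≐ endpoint y ws
  endpoint-merge y []             i = refl
  endpoint-merge y ((g , α) ∷ ws) = ≐-trans (endpoint-insert y g α (merge ws)) (endpoint-merge (y +[ α ] g) ws)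

  -- Feasibility one row at a time, since whether a row rises or falls along the walk depends on the
  -- row.
  RowFeas : Fin mB → Point → List Step → Set
  RowFeas l y []             = (B· y) l ≤ dB l
  RowFeas l y ((g , α) ∷ ws) = (B· y) l ≤ dB l × RowFeas l (y +[ α ] g) ws

  0≤-scaled : ∀ {α} z → 0r < α → + 0 ℤ.≤ z → 0r ≤ α * fromℤ z
  0≤-scaled z 0<α 0≤z = 0≤-* (inj₁ 0<α) (fromℤ-mono-≤ 0≤z)

  row-≤-step : ∀ {y α} g l → 0r < α → + 0 ℤ.≤ (Bℤ· g) l → (B· y) l ≤ (B· (y +[ α ] g)) l
  row-≤-step {y} {α} g l 0<α p = subst₂ _≤_ (+-identityʳ _) (sym (row-step (B l) y α g))
    (+-mono-≤ ≤-refl (0≤-scaled _ 0<α p))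

  row-≥-step : ∀ {y α} g l → 0r < α → (Bℤ· g) l ℤ.≤ + 0 → (B· (y +[ α ] g)) l ≤ (B· y) l
  row-≥-step {y} {α} g l 0<α p = subst₂ _≤_ (sym (row-step (B l) y α g)) (+-identityʳ _)
    (+-mono-≤ ≤-refl (0≤⇒≤ (subst (0r ≤_)
      (trans (cong (α *_) (fromℤ-neg ((Bℤ· g) l)))
        (solve 2 (λ a z → a :* (:- z) := con (+ 0) :+ :- (a :* z)) refl α (fromℤ ((Bℤ· g) l))))
      (0≤-scaled (ℤ.- (Bℤ· g) l) 0<α (ℤₚ.neg-mono-≤ p)))))

  -- When the row never falls, its final value bounds all earlier ones. The induction hands the
  -- bound back from the end to the start, hence the second component.
  increasing-feasible : ∀ l y ws → All (λ st → + 0 ℤ.≤ (Bℤ· proj₁ st) l × 0r < proj₂ st) ws →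
                        (B· endpoint y ws) l ≤ dB l → RowFeas l y ws × (B· y) l ≤ dB l
  increasing-feasible l y []             _              end = end , end
  increasing-feasible l y ((g , α) ∷ ws) ((p , 0<α) ∷ ps) end with increasing-feasible l (y +[ α ] g) ws ps end
  ... | rest , next = (now , rest) , now
    where now = ≤-trans (row-≤-step g l 0<α p) next

  decreasing-feasible : ∀ l y ws → All (λ st → (Bℤ· proj₁ st) l ℤ.≤ + 0 × 0r < proj₂ st) ws →
                        (B· y) l ≤ dB l → RowFeas l y ws
  decreasing-feasible l y []             _              start = start
  decreasing-feasible l y ((g , α) ∷ ws) ((p , 0<α) ∷ ps) start =
    start , decreasing-feasible l (y +[ α ] g) ws ps (≤-trans (row-≥-step g l 0<α p) start)

  RowFeas⇒FeasW : ∀ y ws → (∀ l → (A· y) l ≡ bA l) → All (λ st → ∀ l → (Aℤ· proj₁ st) l ≡ + 0) ws →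
                  (∀ l → RowFeas l y ws) → FeasW y ws
  RowFeas⇒FeasW y []             inA _        rows = inA , rows
  RowFeas⇒FeasW y ((g , α) ∷ ws) inA (p ∷ ps) rows = (inA , λ l → proj₁ (rows l)) ,
    RowFeas⇒FeasW (y +[ α ] g) ws (λ l → trans (row-step (A l) y α g)
      (trans (cong (λ z → (A· y) l + α * fromℤ z) (p l))
        (trans (cong (λ u → (A· y) l + u) (zeroʳ α)) (trans (+-identityʳ _) (inA l))))) ps (λ l → proj₂ (rows l))

  Agree : List Step → Set
  Agree ws = All (λ x → All (λ y → ∀ l → + 0 ℤ.≤ (Bℤ· proj₁ x) l ℤ.* (Bℤ· proj₁ y) l) ws) ws

  private
    agree-pos : ∀ k z → + 0 ℤ.≤ +[1+ k ] ℤ.* z → + 0 ℤ.≤ z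
    agree-pos k (+ z)    _ = ℤ.+≤+ ℕ.z≤n
    agree-pos k -[1+ z ] ()

    agree-neg : ∀ k z → + 0 ℤ.≤ -[1+ k ] ℤ.* z → z ℤ.≤ + 0
    agree-neg k (+ zero) _ = ℤ.+≤+ ℕ.z≤n
    agree-neg k +[1+ z ] ()
    agree-neg k -[1+ z ] _ = ℤ.-≤+

  -- The first step that moves row `l` dictates the sign of all the others. The list appears twice
  -- so that the recursion on `ws` keeps the full list in `us`.
  one-sided : ∀ l (ws us : List Step) → All (λ x → All (λ y → ∀ l → + 0 ℤ.≤ (Bℤ· proj₁ x) l ℤ.* (Bℤ· proj₁ y) l) us) ws →
              All (λ x → (Bℤ· proj₁ x) l ≡ + 0) ws ⊎
              All (λ y → + 0 ℤ.≤ (Bℤ· proj₁ y) l) us ⊎ All (λ y → (Bℤ· proj₁ y) l ℤ.≤ + 0) us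
  one-sided l []       us [] = inj₁ []
  one-sided l (x ∷ ws) us (p ∷ ps) with (Bℤ· proj₁ x) l in q
  ... | +[1+ k ] = inj₂ (inj₁ (All.map (λ {y} h → agree-pos k _ (subst (λ z → + 0 ℤ.≤ z ℤ.* (Bℤ· proj₁ y) l) q (h l))) p))
  ... | -[1+ k ] = inj₂ (inj₂ (All.map (λ {y} h → agree-neg k _ (subst (λ z → + 0 ℤ.≤ z ℤ.* (Bℤ· proj₁ y) l) q (h l))) p))
  ... | + zero with one-sided l ws us ps
  ... | inj₁ zs = inj₁ (q ∷ zs)
  ... | inj₂ h  = inj₂ h

  -- A rising row is bounded at the endpoint `w`, a falling or constant one at the start `v`. No
  -- intermediate point of another walk enters, so this applies after merging.
  Agree⇒FeasW : ∀ {v w} ws → InP v → InP w → endpoint v ws ≐ w → Steps ws →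
                Agree ws → FeasW v ws
  Agree⇒FeasW {v} {w} ws (vA , vB) (wA , wB) end steps agree =
    RowFeas⇒FeasW v ws vA (All.map (λ st → proj₁ (proj₁ st)) steps) rowFeas
    where
    atEnd : ∀ l → (B· endpoint v ws) l ≤ dB l
    atEnd l = subst (_≤ dB l) (sym (row-cong (B l) end)) (wB l)
    positive = All.map proj₂ steps
    rowFeas : ∀ l → RowFeas l v ws
    rowFeas l with one-sided l ws ws agree
    ... | inj₁ zs        = decreasing-feasible l v ws (All.zip (All.map ℤₚ.≤-reflexive zs , positive)) (vB l)
    ... | inj₂ (inj₁ ps) = proj₁ (increasing-feasible l v ws (All.zip (ps , positive)) (atEnd l))
    ... | inj₂ (inj₂ ps) = decreasing-feasible l v ws (All.zip (ps , positive)) (vB l)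

  private
    square-sign : ∀ z → + 0 ℤ.≤ z ℤ.* (ℤ.- z) → z ≡ + 0
    square-sign (+ zero) _ = refl
    square-sign +[1+ k ] ()
    square-sign -[1+ k ] ()

  Σℤ-neg : ∀ {k} (x y : Fin k → ℤ) → (∀ i → x i ≡ ℤ.- y i) → Σℤ x ≡ ℤ.- Σℤ y
  Σℤ-neg {zero}  x y p = refl
  Σℤ-neg {suc k} x y p = trans (cong₂ ℤ._+_ (p zero) (Σℤ-neg _ _ (λ i → p (suc i)))) (sym (ℤₚ.neg-distrib-+ (y zero) _))

  -- For opposite directions the product of their values on a row is minus a square, so agreement
  -- makes all rows vanish on them, and `vertex⇒pointed` contradicts the circuit being nonzero.
  Agree⇒NonBack : ∀ {v} ws → IsVertex v → Steps ws → Agree ws → NonBack ws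
  Agree⇒NonBack ws vertex steps agree = All.zipWith (λ { {x} ((circ , _) , agrees) → All.map (λ {y} agr opp →
      let (Ag , g≢0 , _) = circ in
      g≢0 (vertex⇒pointed vertex (proj₁ x) Ag (λ l → square-sign _ (subst (λ z → + 0 ℤ.≤ (Bℤ· proj₁ x) l ℤ.* z)
        (Σℤ-neg _ _ (λ j → trans (cong (B l j ℤ.*_) (opp j)) (sym (ℤₚ.neg-distribʳ-* (B l j) (proj₁ x j))))) (agr l))))) agrees }) (steps , agree)

  -- Agreement is a binary relation, so `All-merge` is applied twice: to the second step with the
  -- first one fixed, and then to the first.
  Agree-merge : ∀ ws → Steps ws → Agree ws → Agree (merge ws)
  Agree-merge ws steps agree = All.map proj₁ (All-merge {Q = λ g → All (λ y → ∀ l → + 0 ℤ.≤ (Bℤ· g) l ℤ.* (Bℤ· proj₁ y) l) (merge ws)}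
    (All.zip (All.map (λ {x} agrees → All.map proj₁ (All-merge {Q = λ g → ∀ l → + 0 ℤ.≤ (Bℤ· proj₁ x) l ℤ.* (Bℤ· g) l} (All.zip (agrees , positive)))) agree , positive)))
    where positive = All.map proj₂ steps

-- The one weak inequality of the hierarchy in which the walk has to be changed; the others keep the
-- walk and come from `weaken`.
fs≥fbr : ∀ ℝ → CD-≥ ℝ (f ∷ s ∷ []) (f ∷ b ∷ r ∷ [])
fs≥fbr ℝ P v₁ v₂ vert₁ vert₂ k (ws , ((steps , end) , _ ∷ (agree , _) ∷ []) , len) =
  merge ws , ((steps′ , end′) , Agree⇒FeasW (merge ws) (proj₁ vert₁) (proj₁ vert₂) end′ steps′ agree′ ∷
    Agree⇒NonBack (merge ws) vert₁ steps′ agree′ ∷ NonRep-merge ws ∷ []) ,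
  ℕₚ.≤-trans (length-merge ws) len
  where
  open Walks ℝ P
  steps′ = All-merge steps
  end′   = ≐-trans (endpoint-merge v₁ ws) end
  agree′ = Agree-merge ws steps agree

-- Polyhedra with integer data and walks through integer points.

module _ (ℝ : RealField) where
  open RealField ℝ hiding (_-_)

  -- `fromℕ` becomes available only once a polyhedron is fixed, but the bounds `dB` belong to the
  -- polyhedron. The embedding is therefore repeated here and identified with `fromℤ` afterwards.
  natural : ℕ → Carrier
  natural zero    = 0r
  natural (suc k) = 1r + natural k

  integer : ℤ → Carrier
  integer (+ k)    = natural k
  integer -[1+ k ] = - natural (suc k)

  integral : (n mB : ℕ) → (Fin mB → Fin n → ℤ) → (Fin mB → ℤ) → Polyhedron ℝ
  integral n mB B d = record
    { n = n ; mA = 0 ; mB = mB ; A = λ () ; bA = λ () ; B = B ; dB = λ l → integer (d l) }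

1≢0 : + 1 ≢ + 0
1≢0 ()

unit-square : ∀ z → ∣ z ∣ ≡ 1 → z ℤ.* z ≡ + 1
unit-square (+ 1)    _ = refl
unit-square -[1+ 0 ] _ = refl

module Integral (ℝ : RealField) (n mB : ℕ) (B : Fin mB → Fin n → ℤ) (d : Fin mB → ℤ) where
  P = integral ℝ n mB B d

  open RealField ℝ hiding (_-_)
  open Walks ℝ P public
  open ≡-Reasoning

  integer≡fromℤ : ∀ z → integer ℝ z ≡ fromℤ z
  integer≡fromℤ (+ k) = natural≡fromℕ k
    where
    natural≡fromℕ : ∀ k → natural ℝ k ≡ fromℕ k
    natural≡fromℕ zero    = refl
    natural≡fromℕ (suc k) = cong (λ u → 1r + u) (natural≡fromℕ k)
  integer≡fromℤ -[1+ k ] = cong -_ (integer≡fromℤ (+ suc k))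

  InP-rows : ∀ {y} → InP y → ∀ l → row (B l) y ≤ fromℤ (d l)
  InP-rows {y} (_ , inB) l = subst (row (B l) y ≤_) (integer≡fromℤ (d l)) (inB l)

  rows-InP : ∀ {y} → (∀ l → row (B l) y ≤ fromℤ (d l)) → InP y
  rows-InP {y} p = (λ ()) , λ l → subst (row (B l) y ≤_) (sym (integer≡fromℤ (d l))) (p l)

  pt : IntVec → Point
  pt v i = fromℤ (v i)

  Feasibleℤ : IntVec → Set
  Feasibleℤ v = ∀ l → (Bℤ· v) l ℤ.≤ d l

  feasibleℤ? : ∀ v → Dec (Feasibleℤ v)
  feasibleℤ? v = Finₚ.all? (λ l → (Bℤ· v) l ℤ.≤? d l)

  pt-InP : ∀ v → Feasibleℤ v → InP (pt v)
  pt-InP v p = rows-InP (λ l → subst (_≤ fromℤ (d l)) (sym (row-fromℤ (B l) v)) (fromℤ-mono-≤ (p l)))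

  -- Integer points and lengths make feasibility, maximality and the endpoint decidable by
  -- evaluation; the concrete walks are checked in this form and then carried over by `real`.
  IntStep : Set
  IntStep = IntVec × ℕ

  real : List IntStep → List Step
  real []             = []
  real ((g , k) ∷ ws) = (g , fromℕ k) ∷ real ws

  move : IntVec → IntStep → IntVec
  move v (g , k) i = v i ℤ.+ + k ℤ.* g i

  endpointℤ : IntVec → List IntStep → IntVec
  endpointℤ v []        = v
  endpointℤ v (st ∷ ws) = endpointℤ (move v st) ws

  move-pt : ∀ {y} v g k → y ≐ pt v → (y +[ fromℕ k ] g) ≐ pt (move v (g , k))
  move-pt v g k p i = sym (trans (fromℤ-+ (v i) (+ k ℤ.* g i)) (cong₂ _+_ (sym (p i)) (fromℤ-* (+ k) (g i))))

  endpoint-pt : ∀ {y} v ws → y ≐ pt v → endpoint y (real ws) ≐ pt (endpointℤ v ws)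
  endpoint-pt v []             p = p
  endpoint-pt v ((g , k) ∷ ws) p = endpoint-pt (move v (g , k)) ws (move-pt v g k p)

  Reaches : IntVec → IntVec → List IntStep → Set
  Reaches v w ws = All (λ st → 1 ℕ.≤ proj₂ st) ws × (∀ i → endpointℤ v ws i ≡ w i)

  reaches? : ∀ v w ws → Dec (Reaches v w ws)
  reaches? v w ws = All.all? (λ st → 1 ℕ.≤? proj₂ st) ws ×-dec Finₚ.all? (λ i → endpointℤ v ws i ℤ.≟ w i)

  Reaches⇒IsWalk : ∀ v w ws → Reaches v w ws → All (λ st → IsCircuit (proj₁ st)) ws → IsWalk (pt v) (pt w) (real ws)
  Reaches⇒IsWalk v w ws (pos , end) circ = steps pos circ , λ i → trans (endpoint-pt v ws (λ _ → refl) i) (cong fromℤ (end i))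
    where
    steps : ∀ {ws} → All (λ st → 1 ℕ.≤ proj₂ st) ws → All (λ st → IsCircuit (proj₁ st)) ws →
            Steps (real ws)
    steps []               []       = []
    steps (ℕ.s≤s {n = k} _ ∷ ps) (q ∷ qs) = (q , 0<fromℕ k) ∷ steps ps qs

  FeasWℤ : IntVec → List IntStep → Set
  FeasWℤ v []        = Feasibleℤ v
  FeasWℤ v (st ∷ ws) = Feasibleℤ v × FeasWℤ (move v st) ws

  feasWℤ? : ∀ v ws → Dec (FeasWℤ v ws)
  feasWℤ? v []        = feasibleℤ? v
  feasWℤ? v (st ∷ ws) = feasibleℤ? v ×-dec feasWℤ? (move v st) ws

  feasW : ∀ v ws → FeasWℤ v ws → FeasW (pt v) (real ws)
  feasW v ws = go v ws (λ _ → refl)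
    where
    go : ∀ {y} v ws → y ≐ pt v → FeasWℤ v ws → FeasW y (real ws)
    go v []             p q       = InP-resp (≐-sym p) (pt-InP v q)
    go v ((g , k) ∷ ws) p (q , h) = InP-resp (≐-sym p) (pt-InP v q) , go (move v (g , k)) ws (move-pt v g k p) h

  -- A certificate of maximality: some row grows in direction `g` and has already reached its bound
  -- at `w`.
  Blocked : IntVec → IntVec → Set
  Blocked g w = ∃ λ l → + 0 ℤ.< (Bℤ· g) l × d l ℤ.≤ (Bℤ· w) l

  MaxWℤ : IntVec → List IntStep → Set
  MaxWℤ v []             = ⊤
  MaxWℤ v ((g , k) ∷ ws) = Blocked g (move v (g , k)) × MaxWℤ (move v (g , k)) ws

  maxWℤ? : ∀ v ws → Dec (MaxWℤ v ws)
  maxWℤ? v []             = yes tt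
  maxWℤ? v ((g , k) ∷ ws) = Finₚ.any? (λ l → (+ 0 ℤ.<? (Bℤ· g) l) ×-dec (d l ℤ.≤? (Bℤ· move v (g , k)) l)) ×-dec maxWℤ? (move v (g , k)) ws

  blocked-step : ∀ {y w α β g} → (y +[ α ] g) ≐ pt w → Blocked g w → α < β → ¬ InP (y +[ β ] g)
  blocked-step {y} {w} {α} {β} {g} p (l , 0<Bg , tight) α<β inP = ≤⇒≯ (InP-rows inP l)
    (≤-<-trans (fromℤ-mono-≤ tight) (subst₂ _<_ at-w at-β (0<⇒< (subst (0r <_)
      (solve 4 (λ y α β z → (β :+ :- α) :* z := (y :+ β :* z) :+ :- (y :+ α :* z)) refl
        (row (B l) y) α β (fromℤ ((Bℤ· g) l)))
      (*-pos (<⇒0< α<β) (fromℤ-pos 0<Bg))))))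
    where
    at-w : row (B l) y + α * fromℤ ((Bℤ· g) l) ≡ fromℤ ((Bℤ· w) l)
    at-w = trans (sym (row-step (B l) y α g)) (trans (row-cong (B l) p) (row-fromℤ (B l) w))
    at-β : row (B l) y + β * fromℤ ((Bℤ· g) l) ≡ row (B l) (y +[ β ] g)
    at-β = sym (row-step (B l) y β g)

  maxW : ∀ v ws → MaxWℤ v ws → MaxW (pt v) (real ws)
  maxW v ws = go v ws (λ _ → refl)
    where
    go : ∀ {y} v ws → y ≐ pt v → MaxWℤ v ws → MaxW y (real ws)
    go v []             p q           = tt
    go v ((g , k) ∷ ws) p (blk , h) = (λ β α<β → blocked-step (move-pt v g k p) blk α<β) , go (move v (g , k)) ws (move-pt v g k p) h

  nonRep? : ∀ ws → Dec (NonRep ws)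
  nonRep? = allPairs? (λ x y → ¬? (proj₁ x ≐ℤ? proj₁ y))

  nonBack? : ∀ ws → Dec (NonBack ws)
  nonBack? ws = All.all? (λ x → All.all? (λ y → ¬? (proj₁ y ≐ℤ? (λ i → ℤ.- proj₁ x i))) ws) ws

  positive-unit : ∀ z → ∣ z ∣ ≡ 1 → 0r < fromℤ z → z ≡ + 1
  positive-unit (+ 1)    _ _ = refl
  positive-unit -[1+ 0 ] _ p = ⊥-elim (<-irrefl _ (<-trans p (fromℤ-neg<0 0)))

  -- The coprimality of g makes the positive scale between g and p equal to 1.
  direction-unique : ∀ {g α τ} → IsCircuit g → 0r < α → 0r < τ → (p : IntVec) (j₀ : Fin n) → ∣ p j₀ ∣ ≡ 1 →
                     (∀ j → α * fromℤ (g j) ≡ fromℤ (p j) * τ) → g ≐ℤ p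
  direction-unique {g} {α} {τ} (_ , _ , _ , coprime) 0<α 0<τ p j₀ unit-p parallel′ j = trans (scaled j) (trans (cong (p j ℤ.*_) one) (ℤₚ.*-identityʳ (p j)))
    where
    parallel : ∀ j → α * fromℤ (g j) ≡ τ * fromℤ (p j)
    parallel j = trans (parallel′ j) (*-comm _ τ)
    cross : ∀ j → g j ℤ.* p j₀ ≡ p j ℤ.* g j₀
    cross j = ℤₚ.i-j≡0⇒i≡j _ _ (fromℤ-≡0 _ (*-zero-product (α * τ) _ (begin
      α * τ * fromℤ (g j ℤ.* p j₀ ℤ.- p j ℤ.* g j₀)
        ≡⟨ cong (α * τ *_) (trans (fromℤ-+ (g j ℤ.* p j₀) (ℤ.- (p j ℤ.* g j₀)))
             (cong₂ _+_ (fromℤ-* (g j) (p j₀)) (trans (fromℤ-neg (p j ℤ.* g j₀)) (cong -_ (fromℤ-* (p j) (g j₀)))))) ⟩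
      α * τ * (fromℤ (g j) * fromℤ (p j₀) + - (fromℤ (p j) * fromℤ (g j₀)))
        ≡⟨ solve 6 (λ α τ g p₀ p g₀ → α :* τ :* (g :* p₀ :+ :- (p :* g₀)) := (α :* g) :* (τ :* p₀) :+ :- ((τ :* p) :* (α :* g₀))) refl
             α τ (fromℤ (g j)) (fromℤ (p j₀)) (fromℤ (p j)) (fromℤ (g j₀)) ⟩
      (α * fromℤ (g j)) * (τ * fromℤ (p j₀)) + - ((τ * fromℤ (p j)) * (α * fromℤ (g j₀)))
        ≡⟨ cong₂ (λ u v → u * (τ * fromℤ (p j₀)) + - ((τ * fromℤ (p j)) * v)) (parallel j) (parallel j₀) ⟩
      (τ * fromℤ (p j)) * (τ * fromℤ (p j₀)) + - ((τ * fromℤ (p j)) * (τ * fromℤ (p j₀)))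
        ≡⟨ -‿inverseʳ _ ⟩
      0r ∎) (pos⇒≢0 (*-pos 0<α 0<τ))))
    p₀² : p j₀ ℤ.* p j₀ ≡ + 1
    p₀² = unit-square (p j₀) unit-p
    -- As `p j₀` is its own inverse, `g` is `scale` times `p`. Then `scale` divides every entry of
    -- `g`, so it is a unit, and positivity of `α` and `τ` excludes -1.
    scale = g j₀ ℤ.* p j₀
    scaled : ∀ j → g j ≡ p j ℤ.* scale
    scaled j = trans (sym (trans (ℤₚ.*-assoc (g j) (p j₀) (p j₀)) (trans (cong (g j ℤ.*_) p₀²) (ℤₚ.*-identityʳ (g j)))))
      (trans (cong (ℤ._* p j₀) (cross j)) (ℤₚ.*-assoc (p j) (g j₀) (p j₀)))
    ∣scale∣ : ∣ scale ∣ ≡ 1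
    ∣scale∣ = coprime ∣ scale ∣ (λ i → ∣.divides ∣ p i ∣ (trans (cong ∣_∣ (scaled i)) (ℤₚ.abs-* (p i) scale)))
    0<scale : 0r < fromℤ scale
    0<scale = *-cancelˡ-pos 0<α (subst (0r <_)
      (trans (trans (cong (λ u → τ * u) (fromℤ-* (p j₀) (p j₀))) (trans (sym (*-assoc τ _ _)) (trans (cong (_* fromℤ (p j₀)) (sym (parallel j₀))) (*-assoc α _ _))))
             (cong (α *_) (sym (fromℤ-* (g j₀) (p j₀)))))
      (*-pos 0<τ (subst (λ z → 0r < fromℤ z) (sym p₀²) (0<fromℕ 0))))
    one : scale ≡ + 1
    one = positive-unit scale ∣scale∣ 0<scale

  -- Two known integer points determine the circuit of a step between them, whatever real length it
  -- has. This identifies the first and last directions of an edge walk.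
  direction-between : ∀ {g α y} v w u j₀ k → IsCircuit g → 0r < α → y ≐ pt v → (y +[ α ] g) ≐ pt w → ∣ u j₀ ∣ ≡ 1 →
                      (∀ j → w j ≡ move v (u , suc k) j) → g ≐ℤ u
  direction-between {g} {α} {y} v w u j₀ k circ 0<α at-v at-w unit w≡ = direction-unique circ 0<α (0<fromℕ k) u j₀ unit λ j → begin
    α * fromℤ (g j)                                     ≡⟨ solve 2 (λ y a → a := (y :+ a) :+ :- y) refl (y j) (α * fromℤ (g j)) ⟩
    (y j + α * fromℤ (g j)) + - y j                     ≡⟨ cong₂ (λ p q → p + - q) (trans (at-w j) (cong fromℤ (w≡ j))) (at-v j) ⟩
    fromℤ (move v (u , suc k) j) + - fromℤ (v j)        ≡⟨ cong (_+ - fromℤ (v j)) (sym (move-pt v u (suc k) (λ _ → refl) j)) ⟩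
    (fromℤ (v j) + fromℕ (suc k) * fromℤ (u j)) + - fromℤ (v j)
      ≡⟨ solve 3 (λ v k u → (v :+ k :* u) :+ :- v := u :* k) refl (fromℤ (v j)) (fromℕ (suc k)) (fromℤ (u j)) ⟩
    fromℤ (u j) * fromℕ (suc k)                         ∎

-- Boxes [0,c]ⁿ; the additional rows E are redundant and only enlarge the set of circuits.

module BoxRows (n mE c : ℕ) (E : Fin mE → Fin n → ℤ) where
  Row : Set
  Row = Fin n ⊎ (Fin n ⊎ Fin mE)

  pattern lower i = inj₁ i
  pattern upper i = inj₂ (inj₁ i)
  pattern extra l = inj₂ (inj₂ l)

  coefficients : Row → Fin n → ℤ
  coefficients (lower i) j = ℤ.- δ i j
  coefficients (upper i)   = δ i
  coefficients (extra l)   = E l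

  bound : Row → ℤ
  bound (lower i) = + 0
  bound (upper i) = + c
  bound (extra l) = + (sumAbs (E l) ℕ.* c)

  toRow : Fin (n ℕ.+ (n ℕ.+ mE)) → Row
  toRow l with splitAt n l
  ... | inj₁ i = lower i
  ... | inj₂ k = inj₂ (splitAt n k)

  fromRow : Row → Fin (n ℕ.+ (n ℕ.+ mE))
  fromRow (lower i) = i ↑ˡ (n ℕ.+ mE)
  fromRow (upper i) = n ↑ʳ (i ↑ˡ mE)
  fromRow (extra l) = n ↑ʳ (n ↑ʳ l)

  toRow-fromRow : ∀ ρ → toRow (fromRow ρ) ≡ ρ
  toRow-fromRow (lower i) rewrite Finₚ.splitAt-↑ˡ n i (n ℕ.+ mE) = refl
  toRow-fromRow (upper i) rewrite Finₚ.splitAt-↑ʳ n (n ℕ.+ mE) (i ↑ˡ mE) | Finₚ.splitAt-↑ˡ n i mE = refl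
  toRow-fromRow (extra l) rewrite Finₚ.splitAt-↑ʳ n (n ℕ.+ mE) (n ↑ʳ l) | Finₚ.splitAt-↑ʳ n mE l = refl

module Box (ℝ : RealField) (n mE c : ℕ) (E : Fin mE → Fin n → ℤ) where
  open BoxRows n mE c E public
  open RealField ℝ hiding (_-_)
  open Integral ℝ n (n ℕ.+ (n ℕ.+ mE)) (λ l → coefficients (toRow l)) (λ l → bound (toRow l)) public
  open ≡-Reasoning

  InBox : Point → Set
  InBox y = ∀ j → 0r ≤ y j × y j ≤ fromℤ (+ c)

  at : ∀ {y} → InP y → ∀ ρ → row (coefficients ρ) y ≤ fromℤ (bound ρ)
  at {y} p ρ = subst (λ σ → row (coefficients σ) y ≤ fromℤ (bound σ)) (toRow-fromRow ρ) (InP-rows p (fromRow ρ))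

  InP⇒InBox : ∀ y → InP y → InBox y
  InP⇒InBox y p j =
    0≤⇒≤ (subst (0r ≤_) (solve 1 (λ y → con (+ 0) :+ :- (:- y) := y :+ :- con (+ 0)) refl (y j))
      (≤⇒0≤ (subst (_≤ 0r) (trans (row-neg (δ j) y) (cong -_ (Σr-δ j y))) (at p (lower j))))) ,
    subst (_≤ fromℤ (+ c)) (Σr-δ j y) (at p (upper j))

  InBox⇒InP : ∀ {y} → InBox y → InP y
  InBox⇒InP {y} p = rows-InP (λ l → at-row (toRow l))
    where
    at-row : ∀ ρ → row (coefficients ρ) y ≤ fromℤ (bound ρ)
    at-row (lower i) = subst (_≤ 0r) (sym (trans (row-neg (δ i) y) (cong -_ (Σr-δ i y))))
      (0≤⇒≤ (subst (0r ≤_) (solve 1 (λ y → y := con (+ 0) :+ :- (:- y)) refl (y i)) (proj₁ (p i))))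
    at-row (upper i) = subst (_≤ fromℤ (+ c)) (sym (Σr-δ i y)) (proj₂ (p i))
    at-row (extra l) = row-bound c (E l) y p

  -- Every coordinate sits at one of its two bounds, which pins it down separately in any convex
  -- combination.
  corner-IsVertex : ∀ v → (∀ j → v j ≡ + 0 ⊎ v j ≡ + c) → IsVertex (pt v)
  corner-IsVertex v corner = InBox⇒InP inBox , λ x y t x∈ y∈ 0<t t<1 v≐ →
      (λ j → proj₁ (extreme x y t x∈ y∈ 0<t t<1 v≐ j)) , (λ j → proj₂ (extreme x y t x∈ y∈ 0<t t<1 v≐ j))
    where
    inBox : InBox (pt v)
    inBox j with v j | corner j
    ... | _ | inj₁ refl = ≤-refl , 0≤fromℕ c
    ... | _ | inj₂ refl = 0≤fromℕ c , ≤-refl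
    extreme : ∀ x y t → InP x → InP y → 0r < t → t < 1r → pt v ≐ comb t x y → ∀ j → x j ≡ fromℤ (v j) × y j ≡ fromℤ (v j)
    extreme x y t x∈ y∈ 0<t t<1 v≐ j with v j | v≐ j | corner j
    ... | _ | q | inj₁ refl = weighted-zero 0<t t<1 (proj₁ (InP⇒InBox x x∈ j)) (proj₁ (InP⇒InBox y y∈ j)) (sym q)
    ... | _ | q | inj₂ refl = weighted-max 0<t t<1 (proj₂ (InP⇒InBox x x∈ j)) (proj₂ (InP⇒InBox y y∈ j)) (sym q)

  Eℤ : Fin mE → IntVec → ℤ
  Eℤ l g = Σℤ (λ j → E l j ℤ.* g j)

  form : Row → IntVec → ℤ
  form ρ g = Σℤ (λ j → coefficients ρ j ℤ.* g j)

  form-lower : ∀ i g → form (lower i) g ≡ ℤ.- g i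
  form-lower i g = trans (Σℤ-neg _ (λ j → δ i j ℤ.* g j) (λ j → sym (ℤₚ.neg-distribˡ-* (δ i j) (g j)))) (cong ℤ.-_ (Σℤ-δ i g))

  neg≡0 : ∀ z → ℤ.- z ≡ + 0 → z ≡ + 0
  neg≡0 (+ zero) _ = refl

  -- Satisfied by the positive multiples of circuits; reals suffice from here on.
  Elementary : Point → Set
  Elementary a = ∀ z → ¬ (∀ i → z i ≡ + 0) → (∀ j → z j ≡ + 0 ⊎ a j ≢ 0r) → (∀ l → Eℤ l z ≡ + 0 ⊎ row (E l) a ≢ 0r) →
                 (∀ j → z j ≡ + 0 → a j ≡ 0r) × (∀ l → Eℤ l z ≡ + 0 → row (E l) a ≡ 0r)

  scale≢0 : ∀ {α} g → α * fromℤ g ≢ 0r → g ≢ + 0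
  scale≢0 g p refl = p (zeroʳ _)

  -- The test vector `z` is fed to the minimality of `g`. The hypotheses on coordinates and extra
  -- rows say that the support of `z` is contained in that of `g`, lower and upper rows being
  -- coordinates up to sign; minimality returns the opposite inclusion.
  IsCircuit⇒Elementary : ∀ {g α} → IsCircuit g → 0r < α → Elementary (λ j → α * fromℤ (g j))
  IsCircuit⇒Elementary {g} {α} (_ , _ , minimal , _) 0<α z z≢0 coords extras =
      (λ j p → trans (cong (λ u → α * fromℤ u) (vanish j p)) (zeroʳ α)) ,
      (λ l p → trans (row-scaled (E l) α g) (trans (cong (λ u → α * fromℤ u) (vanishE l p)) (zeroʳ α)))
    where
    smaller : ∀ ρ → form ρ z ≢ + 0 → form ρ g ≢ + 0
    smaller (lower i) p q with coords i
    ... | inj₁ zi≡0 = p (trans (form-lower i z) (cong ℤ.-_ zi≡0))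
    ... | inj₂ ai≢0 = scale≢0 (g i) ai≢0 (neg≡0 (g i) (trans (sym (form-lower i g)) q))
    smaller (upper i) p q with coords i
    ... | inj₁ zi≡0 = p (trans (Σℤ-δ i z) zi≡0)
    ... | inj₂ ai≢0 = scale≢0 (g i) ai≢0 (trans (sym (Σℤ-δ i g)) q)
    smaller (extra l) p q with extras l
    ... | inj₁ Ez≡0 = p Ez≡0
    ... | inj₂ Ea≢0 = Ea≢0 (trans (row-scaled (E l) α g) (trans (cong (λ u → α * fromℤ u) q) (zeroʳ α)))
    larger : ∀ l → form (toRow l) g ≢ + 0 → row (coefficients (toRow l)) (pt z) ≢ 0r
    larger = minimal (pt z) (λ ()) (λ p → z≢0 (λ i → fromℤ-≡0 (z i) (p i)))
      (λ l p → smaller (toRow l) (λ q → p (trans (row-fromℤ (coefficients (toRow l)) z) (cong fromℤ q))))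
    zero-form : ∀ ρ → form ρ z ≡ + 0 → form ρ g ≡ + 0
    zero-form ρ p with form ρ g ℤ.≟ + 0
    ... | yes q = q
    ... | no  q = ⊥-elim (subst (λ σ → form σ g ≢ + 0 → row (coefficients σ) (pt z) ≢ 0r) (toRow-fromRow ρ) (larger (fromRow ρ)) q
                    (trans (row-fromℤ (coefficients ρ) z) (cong fromℤ p)))
    vanish : ∀ j → z j ≡ + 0 → g j ≡ + 0
    vanish j p = trans (sym (Σℤ-δ j g)) (zero-form (upper j) (trans (Σℤ-δ j z) p))
    vanishE : ∀ l → Eℤ l z ≡ + 0 → Eℤ l g ≡ + 0
    vanishE l = zero-form (extra l)

  -- If the rows vanishing on `u` leave only the line through `u`, a nonzero vector of no larger
  -- support is a nonzero multiple of `u` and has the same support. The entry ±1 gives coprimality.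
  isCircuit : ∀ u j₀ → ∣ u j₀ ∣ ≡ 1 →
    (∀ z → (∀ j → u j ≡ + 0 → z j ≡ 0r) → (∀ l → Eℤ l u ≡ + 0 → row (E l) z ≡ 0r) → ∃ λ τ → ∀ j → z j ≡ fromℤ (u j) * τ) →
    IsCircuit u
  isCircuit u j₀ unit-u line = (λ ()) , u≢0 , minimal , λ k k∣u → ∣.∣1⇒≡1 (subst (k ∣.∣_) unit-u (k∣u j₀))
    where
    u≢0 : ¬ (∀ i → u i ≡ + 0)
    u≢0 p = ℕₚ.1+n≢0 (trans (sym unit-u) (cong ∣_∣ (p j₀)))
    minimal : ∀ z → (∀ l → (A· z) l ≡ 0r) → ¬ (∀ i → z i ≡ 0r) →
       (∀ l → (B· z) l ≢ 0r → (Bℤ· u) l ≢ + 0) → (∀ l → (Bℤ· u) l ≢ + 0 → (B· z) l ≢ 0r)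
    minimal z _ z≢0 smaller l p q = p (fromℤ-≡0 _ (*-zero-product τ _ (trans (sym (multiple (coefficients (toRow l)))) q) τ≢0))
      where
      vanishing : ∀ ρ → form ρ u ≡ + 0 → row (coefficients ρ) z ≡ 0r
      vanishing ρ h with row (coefficients ρ) z ≟ 0r
      ... | yes k = k
      ... | no  k = ⊥-elim (subst (λ σ → row (coefficients σ) z ≢ 0r → form σ u ≢ + 0) (toRow-fromRow ρ) (smaller (fromRow ρ)) k h)
      onLine = line z (λ j h → trans (sym (Σr-δ j z)) (vanishing (upper j) (trans (Σℤ-δ j u) h))) (λ l → vanishing (extra l))
      τ = proj₁ onLine
      multiple : ∀ a → row a z ≡ τ * fromℤ (Σℤ (λ j → a j ℤ.* u j))
      multiple a = trans (row-cong a (λ j → trans (proj₂ onLine j) (*-comm _ τ))) (row-scaled a τ u)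
      τ≢0 : τ ≢ 0r
      τ≢0 h = z≢0 (λ i → trans (proj₂ onLine i) (trans (cong (fromℤ (u i) *_) h) (zeroʳ _)))

  displacement : Step → Point
  displacement (g , α) j = α * fromℤ (g j)

  scale-sign : ∀ {α κ} z → 0r < α → 0r < κ → 0r ≤ fromℤ z * κ → 0r ≤ α * fromℤ z
  scale-sign {α} {κ} z 0<α 0<κ p = 0≤-* (inj₁ 0<α) (≮⇒≥ λ q → ≤⇒≯ p (0<⇒< (subst (0r <_)
    (solve 2 (λ z κ → (con (+ 0) :+ :- z) :* κ := con (+ 0) :+ :- (z :* κ)) refl (fromℤ z) κ) (*-pos (<⇒0< q) 0<κ))))

  scale-sign-neg : ∀ {α κ} z → 0r < α → κ < 0r → 0r ≤ fromℤ z * κ → α * fromℤ z ≤ 0r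
  scale-sign-neg {α} {κ} z 0<α κ<0 p = 0≤⇒≤ (subst (0r ≤_)
    (trans (cong (α *_) (fromℤ-neg z)) (solve 2 (λ α z → α :* :- z := con (+ 0) :+ :- (α :* z)) refl α (fromℤ z)))
    (scale-sign (ℤ.- z) 0<α (<⇒0< κ<0) (subst (0r ≤_)
      (trans (solve 2 (λ z κ → z :* κ := :- z :* (con (+ 0) :+ :- κ)) refl (fromℤ z) κ) (cong (_* (0r + - κ)) (sym (fromℤ-neg z)))) p)))

  compatible : ∀ x y {ws} → SignW x y ws → All (λ st → ∀ ρ → 0r ≤ fromℤ (form ρ (proj₁ st)) * row (coefficients ρ) (λ i → y i + - x i)) ws
  compatible x y (_ , p) = All.map (λ {st} h ρ → subst
    (λ σ → 0r ≤ fromℤ (form σ (proj₁ st)) * row (coefficients σ) (λ i → y i + - x i)) (toRow-fromRow ρ) (h (fromRow ρ))) p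

  -- Moving along an axis leaves the other coordinates alone and the extra rows are redundant, so
  -- the step can be prolonged until coordinate `i` reaches `c`.
  maximal-axis : ∀ {y g α} i → InBox y → g ≐ℤ δ i → InP (y +[ α ] g) → (∀ β → α < β → ¬ InP (y +[ β ] g)) → y i + α ≡ fromℤ (+ c)
  maximal-axis {y} {g} {α} i inBox g≐δ inP maximal = ≤-antisym
      (subst (_≤ C) (at-i α) (proj₂ (InP⇒InBox _ inP i)))
      (≮⇒≥ λ p → maximal (C + - y i) (0<⇒< (subst (0r <_) (solve 3 (λ C y α → C :+ :- (y :+ α) := (C :+ :- y) :+ :- α) refl C (y i) α) (<⇒0< p)))
        (InBox⇒InP further))
    where
    C = fromℤ (+ c)
    at-i : ∀ β → (y +[ β ] g) i ≡ y i + β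
    at-i β = trans (cong (λ z → y i + β * fromℤ z) (trans (g≐δ i) (δ-diagonal i)))
                   (solve 2 (λ y β → y :+ β :* con (+ 1) := y :+ β) refl (y i) β)
    off-i : ∀ β j → i ≢ j → (y +[ β ] g) j ≡ y j
    off-i β j i≢j = trans (cong (λ z → y j + β * fromℤ z) (trans (g≐δ j) (δ-off-diagonal i j i≢j)))
                   (solve 2 (λ y β → y :+ β :* con (+ 0) := y) refl (y j) β)
    further : InBox (y +[ C + - y i ] g)
    further j = decide (i Finₚ.≟ j)
      where
      decide : Dec (i ≡ j) → 0r ≤ (y +[ C + - y i ] g) j × (y +[ C + - y i ] g) j ≤ C
      decide (yes refl) = subst (λ u → 0r ≤ u × u ≤ C)
        (sym (trans (at-i (C + - y i)) (solve 2 (λ C y → y :+ (C :+ :- y) := C) refl C (y i)))) (0≤fromℕ c , ≤-refl)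
      decide (no i≢j)   = subst (λ u → 0r ≤ u × u ≤ C) (sym (off-i (C + - y i) j i≢j)) (inBox j)

Gap : RealField → List WalkProp → List WalkProp → Set
Gap ℝ X Y = Σ (Polyhedron ℝ) λ P → let open Theory ℝ P in
  Σ Point λ v₁ → Σ Point λ v₂ → IsVertex v₁ × IsVertex v₂ ×
  Σ ℕ λ k → CD≤ Y v₁ v₂ k × ¬ CD≤ X v₁ v₂ k

matrix : ∀ {k n} → Vec (Vec ℤ n) k → Fin k → Fin n → ℤ
matrix M l j = lookup (lookup M l) j

-- The unit cube: steps that are not edges, and sign-compatible walks.

module Cube (ℝ : RealField) where
  open RealField ℝ hiding (_-_)

  -- The first row vanishes on `diag` and, together with z = 0, cuts out its line. The second is -2
  -- on the chord (1,1,1) but 1 on `diag`, so `diag` is not sign-compatible with the chord.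
  extraRows : Fin 2 → Fin 3 → ℤ
  extraRows = matrix ((+ 1 ∷ -[1+ 0 ] ∷ + 1 ∷ []) ∷ (+ 1 ∷ + 0 ∷ -[1+ 2 ] ∷ []) ∷ [])

  open Box ℝ 3 2 1 extraRows

  o p q up diag : IntVec
  o    = lookup (+ 0 ∷ + 0 ∷ + 0 ∷ [])
  p    = lookup (+ 1 ∷ + 1 ∷ + 0 ∷ [])
  q    = lookup (+ 1 ∷ + 1 ∷ + 1 ∷ [])
  diag = lookup (+ 1 ∷ + 1 ∷ + 0 ∷ [])
  up   = lookup (+ 0 ∷ + 0 ∷ + 1 ∷ [])

  o-vertex : IsVertex (pt o)
  o-vertex = corner-IsVertex o λ { 0F → inj₁ refl ; 1F → inj₁ refl ; 2F → inj₁ refl }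

  p-vertex : IsVertex (pt p)
  p-vertex = corner-IsVertex p λ { 0F → inj₂ refl ; 1F → inj₂ refl ; 2F → inj₁ refl }

  q-vertex : IsVertex (pt q)
  q-vertex = corner-IsVertex q λ { 0F → inj₂ refl ; 1F → inj₂ refl ; 2F → inj₂ refl }

  diag-circuit : IsCircuit diag
  diag-circuit = isCircuit diag 0F refl λ z coords extras →
    let facts = (form-of (extraRows 0F) var ≈ ‵ + 0 by extras 0F refl) ∷ (var 2F ≈ ‵ + 0 by coords 2F refl) ∷ [] in
    z 0F , λ
    { 0F → linear-≡ (tabulate z) (var 0F) (+ 1 ⊛ var 0F) facts
    ; 1F → linear-≡ (tabulate z) (var 1F) (+ 1 ⊛ var 0F) facts
    ; 2F → linear-≡ (tabulate z) (var 2F) (+ 0 ⊛ var 0F) facts }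

  up-circuit : IsCircuit up
  up-circuit = isCircuit up 2F refl λ z coords extras →
    let facts = (var 0F ≈ ‵ + 0 by coords 0F refl) ∷ (var 1F ≈ ‵ + 0 by coords 1F refl) ∷ [] in
    z 2F , λ
    { 0F → linear-≡ (tabulate z) (var 0F) (+ 0 ⊛ var 2F) facts
    ; 1F → linear-≡ (tabulate z) (var 1F) (+ 0 ⊛ var 2F) facts
    ; 2F → linear-≡ (tabulate z) (var 2F) (+ 1 ⊛ var 2F) facts }

  direct : List IntStep
  direct = (diag , 1) ∷ []

  direct-walk : IsWalk (pt o) (pt p) (real direct)
  direct-walk = Reaches⇒IsWalk o p direct (from-yes (reaches? o p direct)) (diag-circuit ∷ [])

  direct-f : FeasW (pt o) (real direct)
  direct-f = feasW o direct (from-yes (feasWℤ? o direct))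

  direct-m : MaxW (pt o) (real direct)
  direct-m = maxW o direct (from-yes (maxWℤ? o direct))

  direct-b : NonBack (real direct)
  direct-b = from-yes (nonBack? (real direct))

  direct-r : NonRep (real direct)
  direct-r = from-yes (nonRep? (real direct))

  no-edge-walk : ∀ ws → IsWalk (pt o) (pt p) ws → EdgeW (pt o) ws → ¬ (length ws ℕ.≤ 1)
  no-edge-walk [] (_ , end) _ _ = refute [] ((‵ + 0 ≈ ‵ + 1 by end 0F) ∷ [])
  no-edge-walk ((g , α) ∷ []) (_ , end) (adj , _) _ =
      -- The products with `t` are entered as variables of their own. On the segment from `o` to `p`
      -- the first two coordinates agree, but not at the corner `side₁`, although `side₁` and
      -- `side₂` have the same midpoint as `o` and `p`.
      refute (t ∷ y 0F ∷ y 1F ∷ 1r ∷ (1r + - t) * y 0F ∷ (1r + - t) * y 1F ∷ t * 0r ∷ [])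
        ( (‵ + 1 ≈ var 6F ⊕ var 4F by on 0F) ∷ (‵ + 0 ≈ var 6F ⊕ var 5F by on 1F)
        ∷ (var 4F ≈ var 5F by cong ((1r + - t) *_) (trans (end 0F) (sym (end 1F)))) ∷ [])
    where
    y = pt o +[ α ] g
    side₁ side₂ : IntVec
    side₁ = lookup (+ 1 ∷ + 0 ∷ + 0 ∷ [])
    side₂ = lookup (+ 0 ∷ + 1 ∷ + 0 ∷ [])
    middle : ∀ i → fromℤ (side₁ i) + fromℤ (side₂ i) ≡ pt o i + y i
    middle i = trans (sums i) (cong (λ u → pt o i + u) (sym (end i)))
      where
      sums : ∀ i → fromℤ (side₁ i) + fromℤ (side₂ i) ≡ fromℤ (o i) + fromℤ (p i)
      sums 0F = linear-≡ [] (‵ + 1 ⊕ ‵ + 0) (‵ + 0 ⊕ ‵ + 1) []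
      sums 1F = refl
      sums 2F = refl
    split = adjacent-midpoint adj (pt-InP side₁ (from-yes (feasibleℤ? side₁))) (pt-InP side₂ (from-yes (feasibleℤ? side₂))) middle
    t = proj₁ split
    on = proj₂ split
  no-edge-walk (_ ∷ _ ∷ _) _ _ (ℕ.s≤s ())

  bent : List IntStep
  bent = (diag , 1) ∷ (up , 1) ∷ []

  bent-walk : IsWalk (pt o) (pt q) (real bent)
  bent-walk = Reaches⇒IsWalk o q bent (from-yes (reaches? o q bent)) (diag-circuit ∷ up-circuit ∷ [])

  bent-f : FeasW (pt o) (real bent)
  bent-f = feasW o bent (from-yes (feasWℤ? o bent))

  bent-b : NonBack (real bent)
  bent-b = from-yes (nonBack? (real bent))

  bent-r : NonRep (real bent)
  bent-r = from-yes (nonRep? (real bent))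

  -- The signs are those of the chord from `o` to `q`: its coordinates are 1, its first extra row is
  -- 1 and its second is -2.
  record Compatible (a : Point) : Set where
    field
      elementary : Elementary a
      nonneg     : ∀ j → 0r ≤ a j
      e₁≥0       : 0r ≤ row (extraRows 0F) a
      e₂≤0       : row (extraRows 1F) a ≤ 0r

  rows : ∀ {k} → Fin 2 → (Fin 3 → Lin k) → Lin k
  rows l = form-of (extraRows l)

  -- From x ≤ 3z and x > 0 follows z > 0. The test vectors are two points of the plane x = 3z:
  -- (3,0,1) if the first extra row is positive, which also excludes y > 0, and (3,4,1), on which
  -- both extra rows vanish, otherwise.
  steep : ∀ {a} → Compatible a → 0r < a 0F → row (extraRows 1F) a ≡ 0r × (0r < a 1F → row (extraRows 0F) a ≡ 0r)
  steep {a} A 0<x with ≤-or-> (row (extraRows 0F) a) 0r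
  ... | inj₂ e₁>0 = proj₂ vanish 1F refl , λ 0<y → ⊥-elim (pos⇒≢0 0<y (proj₁ vanish 1F refl))
    where
    open Compatible A
    0<z : 0r < a 2F
    0<z = linear-< (tabulate a) (‵ + 0) (var 2F) ((‵ + 0 ≺ var 0F by 0<x) ∷ (rows 1F var ≼ ‵ + 0 by e₂≤0) ∷ [])
    vanish = elementary (lookup (+ 3 ∷ + 0 ∷ + 1 ∷ [])) (λ h → 1≢0 (h 2F))
      (λ { 0F → inj₂ (pos⇒≢0 0<x) ; 1F → inj₁ refl ; 2F → inj₂ (pos⇒≢0 0<z) })
      (λ { 0F → inj₂ (pos⇒≢0 e₁>0) ; 1F → inj₁ refl })
  ... | inj₁ e₁≤0 = proj₂ vanish 1F refl , λ _ → e₁≡0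
    where
    open Compatible A
    e₁≡0 = ≤-antisym e₁≤0 e₁≥0
    0<z : 0r < a 2F
    0<z = linear-< (tabulate a) (‵ + 0) (var 2F) ((‵ + 0 ≺ var 0F by 0<x) ∷ (rows 1F var ≼ ‵ + 0 by e₂≤0) ∷ [])
    0<y : 0r < a 1F
    0<y = linear-< (tabulate a) (‵ + 0) (var 1F) ((‵ + 0 ≺ var 0F by 0<x) ∷ (‵ + 0 ≺ var 2F by 0<z) ∷ (rows 0F var ≈ ‵ + 0 by e₁≡0) ∷ [])
    vanish = elementary (lookup (+ 3 ∷ + 4 ∷ + 1 ∷ [])) (λ h → 1≢0 (h 2F))
      (λ { 0F → inj₂ (pos⇒≢0 0<x) ; 1F → inj₂ (pos⇒≢0 0<y) ; 2F → inj₂ (pos⇒≢0 0<z) })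
      (λ { 0F → inj₁ refl ; 1F → inj₁ refl })

  SumToDiagonal : Point → Point → Set
  SumToDiagonal a c = ∀ j → a j + c j ≡ fromℤ (+ 1)

  no-mixed : ∀ {a c} → Compatible a → Compatible c → SumToDiagonal a c → 0r < a 0F → ¬ (c 0F ≤ 0r)
  -- Here `a` has x = 1 and z = 1/3, so `c` has z = 2/3 and, by its first row, y at most 2/3. Hence
  -- `a` moves y, `steep` gives it y = 4/3, and `c` would need y = -1/3.
  no-mixed {a} {c} A C sum 0<x c₀≤0 = refute ρ ((rows 0F var₁ ≈ ‵ + 0 by proj₂ (steep A 0<x) 0<y) ∷ known)
    where
    ρ = tabulate a ++ tabulate c
    var₁ var₂ : Fin 3 → Lin 6
    var₁ = lookup (var 0F ∷ var 1F ∷ var 2F ∷ [])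
    var₂ = lookup (var 3F ∷ var 4F ∷ var 5F ∷ [])
    known : List (Fact ρ)
    known = (var 0F ⊕ var 3F ≈ ‵ + 1 by sum 0F) ∷ (var 1F ⊕ var 4F ≈ ‵ + 1 by sum 1F) ∷ (var 2F ⊕ var 5F ≈ ‵ + 1 by sum 2F)
      ∷ (rows 1F var₁ ≈ ‵ + 0 by proj₁ (steep A 0<x)) ∷ (var 3F ≼ ‵ + 0 by c₀≤0) ∷ (‵ + 0 ≼ var 3F by Compatible.nonneg C 0F)
      ∷ (‵ + 0 ≼ var 4F by Compatible.nonneg C 1F) ∷ (‵ + 0 ≼ rows 0F var₂ by Compatible.e₁≥0 C) ∷ []
    0<y : 0r < a 1F
    0<y = linear-< ρ (‵ + 0) (var 1F) known

  no-pair : ∀ {a c} → Compatible a → Compatible c → ¬ SumToDiagonal a c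
  no-pair {a} {c} A C sum with ≤-or-> (a 0F) 0r | ≤-or-> (c 0F) 0r
  ... | inj₂ 0<a | inj₁ c≤0 = no-mixed A C sum 0<a c≤0
  ... | inj₁ a≤0 | inj₂ 0<c = no-mixed C A (λ j → trans (+-comm _ _) (sum j)) 0<c a≤0
  ... | inj₁ a≤0 | inj₁ c≤0 = refute (a 0F ∷ c 0F ∷ []) ((var 0F ⊕ var 1F ≈ ‵ + 1 by sum 0F) ∷ (var 0F ≼ ‵ + 0 by a≤0) ∷ (var 1F ≼ ‵ + 0 by c≤0) ∷ [])
  -- Both steps lie in the plane x = 3z, but their sum (1,1,1) does not.
  ... | inj₂ 0<a | inj₂ 0<c = refute (tabulate a ++ tabulate c)
    ( (var 0F ⊕ var 3F ≈ ‵ + 1 by sum 0F) ∷ (var 2F ⊕ var 5F ≈ ‵ + 1 by sum 2F)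
    ∷ (rows 1F (lookup (var 0F ∷ var 1F ∷ var 2F ∷ [])) ≈ ‵ + 0 by proj₁ (steep A 0<a))
    ∷ (rows 1F (lookup (var 3F ∷ var 4F ∷ var 5F ∷ [])) ≈ ‵ + 0 by proj₁ (steep C 0<c)) ∷ [])

  signs⇒Compatible : ∀ {g α} → IsCircuit g → 0r < α →
    (∀ ρ → 0r ≤ fromℤ (form ρ g) * row (coefficients ρ) (λ i → pt q i + - pt o i)) → Compatible (displacement (g , α))
  signs⇒Compatible {g} {α} circ 0<α signs = record
    { elementary = IsCircuit⇒Elementary circ 0<α
    ; nonneg = λ j → subst (λ z → 0r ≤ α * fromℤ z) (Σℤ-δ j g) (scale-sign (form (upper j) g) 0<α (one j) (signs (upper j)))
    ; e₁≥0 = subst (0r ≤_) (sym (row-scaled (extraRows 0F) α g)) (scale-sign (Eℤ 0F g) 0<α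
        (linear-< [] (‵ + 0) (rows 0F chord) []) (signs (extra 0F)))
    ; e₂≤0 = subst (_≤ 0r) (sym (row-scaled (extraRows 1F) α g)) (scale-sign-neg (Eℤ 1F g) 0<α
        (linear-< [] (rows 1F chord) (‵ + 0) []) (signs (extra 1F))) }
    where
    chord : Fin 3 → Lin 0
    chord _ = ‵ + 1 ⊝ ‵ + 0
    one : ∀ j → 0r < row (δ j) (λ i → pt q i + - pt o i)
    one 0F = linear-< [] (‵ + 0) (form-of (δ 0F) chord) []
    one 1F = linear-< [] (‵ + 0) (form-of (δ 1F) chord) []
    one 2F = linear-< [] (‵ + 0) (form-of (δ 2F) chord) []

  no-compatible-walk : ∀ ws → IsWalk (pt o) (pt q) ws → SignW (pt o) (pt q) ws → ¬ (length ws ℕ.≤ 2)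
  no-compatible-walk [] (_ , end) _ _ = refute [] ((‵ + 0 ≈ ‵ + 1 by end 0F) ∷ [])
  no-compatible-walk ((g , α) ∷ []) ((circ , 0<α) ∷ [] , end) signs _ with compatible (pt o) (pt q) signs
  ... | sg ∷ [] = refute (tabulate a)
      ( (‵ + 0 ⊕ var 0F ≈ ‵ + 1 by end 0F) ∷ (‵ + 0 ⊕ var 2F ≈ ‵ + 1 by end 2F) ∷ (rows 1F var ≈ ‵ + 0 by proj₁ (steep A 0<x)) ∷ [])
    where
    a = displacement (g , α)
    A = signs⇒Compatible circ 0<α sg
    0<x : 0r < a 0F
    0<x = linear-< (tabulate a) (‵ + 0) (var 0F) ((‵ + 0 ⊕ var 0F ≈ ‵ + 1 by end 0F) ∷ [])
  no-compatible-walk ((g , α) ∷ (h , β) ∷ []) ((circ , 0<α) ∷ (circ′ , 0<β) ∷ [] , end) signs _ with compatible (pt o) (pt q) signs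
  ... | sg ∷ sh ∷ [] = no-pair (signs⇒Compatible circ 0<α sg) (signs⇒Compatible circ′ 0<β sh) sum
    where
    sum : SumToDiagonal (displacement (g , α)) (displacement (h , β))
    sum 0F = trans (cong (_+ β * fromℤ (h 0F)) (sym (+-identityˡ _))) (end 0F)
    sum 1F = trans (cong (_+ β * fromℤ (h 1F)) (sym (+-identityˡ _))) (end 1F)
    sum 2F = trans (cong (_+ β * fromℤ (h 2F)) (sym (+-identityˡ _))) (end 2F)
  no-compatible-walk (_ ∷ _ ∷ _ ∷ _) _ _ (ℕ.s≤s (ℕ.s≤s ()))

  -- The single step `diag` is feasible, maximal, non-repetitive and non-backwards, while no edge
  -- walk has length 1. The same pair of vertices therefore settles all of (ii).
  efmb>fmb : Gap ℝ (e ∷ f ∷ m ∷ b ∷ []) (f ∷ m ∷ b ∷ [])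
  efmb>fmb = P , pt o , pt p , o-vertex , p-vertex , 1 , (real direct , (direct-walk , direct-f ∷ direct-m ∷ direct-b ∷ []) , ℕₚ.≤-refl) ,
    λ { (ws , (walk , edges ∷ _) , len) → no-edge-walk ws walk edges len }

  efm>fm : Gap ℝ (e ∷ f ∷ m ∷ []) (f ∷ m ∷ [])
  efm>fm = P , pt o , pt p , o-vertex , p-vertex , 1 , (real direct , (direct-walk , direct-f ∷ direct-m ∷ []) , ℕₚ.≤-refl) ,
    λ { (ws , (walk , edges ∷ _) , len) → no-edge-walk ws walk edges len }

  efmr>fmr : Gap ℝ (e ∷ f ∷ m ∷ r ∷ []) (f ∷ m ∷ r ∷ [])
  efmr>fmr = P , pt o , pt p , o-vertex , p-vertex , 1 , (real direct , (direct-walk , direct-f ∷ direct-m ∷ direct-r ∷ []) , ℕₚ.≤-refl) ,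
    λ { (ws , (walk , edges ∷ _) , len) → no-edge-walk ws walk edges len }

  fs>fbr : Gap ℝ (f ∷ s ∷ []) (f ∷ b ∷ r ∷ [])
  fs>fbr = P , pt o , pt q , o-vertex , q-vertex , 2 , (real bent , (bent-walk , bent-f ∷ bent-b ∷ bent-r ∷ []) , ℕₚ.≤-refl) ,
    λ { (ws , (walk , _ ∷ signs ∷ []) , len) → no-compatible-walk ws walk signs len }

-- The box of dimension four: repeated directions, and feasibility.

module Tesseract (ℝ : RealField) where
  open RealField ℝ hiding (_-_)

  -- The first row vanishes on `climb`, the other two on `slide`; with the vanishing coordinates
  -- they cut out the two lines.
  extraRows : Fin 3 → Fin 4 → ℤ
  extraRows = matrix ( (+ 0 ∷ + 0 ∷ + 2 ∷ -[1+ 0 ] ∷ [])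
                     ∷ (+ 1 ∷ + 0 ∷ + 0 ∷ + 1 ∷ [])
                     ∷ (+ 0 ∷ + 1 ∷ + 0 ∷ + 1 ∷ []) ∷ [])

  open Box ℝ 4 3 2 extraRows

  o q climb slide axis₁ axis₂ axis₄ : IntVec
  o _   = + 0
  q _   = + 2
  climb = lookup (+ 0 ∷ + 0 ∷ + 1 ∷ + 2 ∷ [])
  slide = lookup (+ 1 ∷ + 1 ∷ + 0 ∷ -[1+ 0 ] ∷ [])
  axis₁ = lookup (+ 1 ∷ + 0 ∷ + 0 ∷ + 0 ∷ [])
  axis₂ = lookup (+ 0 ∷ + 1 ∷ + 0 ∷ + 0 ∷ [])
  axis₄ = lookup (+ 0 ∷ + 0 ∷ + 0 ∷ + 1 ∷ [])

  o-vertex : IsVertex (pt o)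
  o-vertex = corner-IsVertex o λ _ → inj₁ refl

  q-vertex : IsVertex (pt q)
  q-vertex = corner-IsVertex q λ _ → inj₂ refl

  rows : ∀ {k} → Fin 3 → (Fin 4 → Lin k) → Lin k
  rows l = form-of (extraRows l)

  climb-circuit : IsCircuit climb
  climb-circuit = isCircuit climb 2F refl λ z coords extras →
    let facts = (rows 0F var ≈ ‵ + 0 by extras 0F refl) ∷ (var 0F ≈ ‵ + 0 by coords 0F refl) ∷ (var 1F ≈ ‵ + 0 by coords 1F refl) ∷ [] in
    z 2F , λ
    { 0F → linear-≡ (tabulate z) (var 0F) (+ 0 ⊛ var 2F) facts
    ; 1F → linear-≡ (tabulate z) (var 1F) (+ 0 ⊛ var 2F) facts
    ; 2F → linear-≡ (tabulate z) (var 2F) (+ 1 ⊛ var 2F) facts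
    ; 3F → linear-≡ (tabulate z) (var 3F) (+ 2 ⊛ var 2F) facts }

  slide-circuit : IsCircuit slide
  slide-circuit = isCircuit slide 0F refl λ z coords extras →
    let facts = (rows 1F var ≈ ‵ + 0 by extras 1F refl) ∷ (rows 2F var ≈ ‵ + 0 by extras 2F refl) ∷ (var 2F ≈ ‵ + 0 by coords 2F refl) ∷ [] in
    z 0F , λ
    { 0F → linear-≡ (tabulate z) (var 0F) (+ 1 ⊛ var 0F) facts
    ; 1F → linear-≡ (tabulate z) (var 1F) (+ 1 ⊛ var 0F) facts
    ; 2F → linear-≡ (tabulate z) (var 2F) (+ 0 ⊛ var 0F) facts
    ; 3F → linear-≡ (tabulate z) (var 3F) (-[1+ 0 ] ⊛ var 0F) facts }

  zigzag : List IntStep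
  zigzag = (climb , 1) ∷ (slide , 2) ∷ (climb , 1) ∷ []

  zigzag-walk : IsWalk (pt o) (pt q) (real zigzag)
  zigzag-walk = Reaches⇒IsWalk o q zigzag (from-yes (reaches? o q zigzag)) (climb-circuit ∷ slide-circuit ∷ climb-circuit ∷ [])

  zigzag-f : FeasW (pt o) (real zigzag)
  zigzag-f = feasW o zigzag (from-yes (feasWℤ? o zigzag))

  zigzag-m : MaxW (pt o) (real zigzag)
  zigzag-m = maxW o zigzag (from-yes (maxWℤ? o zigzag))

  zigzag-b : NonBack (real zigzag)
  zigzag-b = from-yes (nonBack? (real zigzag))

  -- Passes through (0,0,2,4), outside the box; it serves the comparison with the unrestricted
  -- distance.
  shortcut : List IntStep
  shortcut = (climb , 2) ∷ (slide , 2) ∷ []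

  shortcut-walk : IsWalk (pt o) (pt q) (real shortcut)
  shortcut-walk = Reaches⇒IsWalk o q shortcut (from-yes (reaches? o q shortcut)) (climb-circuit ∷ slide-circuit ∷ [])

  -- This and the next four lemmas evaluate `Elementary` on the test vectors e₁, e₂, e₄, `climb` and
  -- `slide`. The hypotheses list the coordinates and extra rows on which the test vector is
  -- nonzero.
  on-axis₁ : ∀ {a} → Elementary a → a 0F ≢ 0r → row (extraRows 1F) a ≢ 0r → a 1F ≡ 0r × a 2F ≡ 0r × a 3F ≡ 0r
  on-axis₁ el x≢0 row≢0 = let (v , _) = el axis₁ (λ h → 1≢0 (h 0F))
                               (λ { 0F → inj₂ x≢0 ; 1F → inj₁ refl ; 2F → inj₁ refl ; 3F → inj₁ refl })
                               (λ { 0F → inj₁ refl ; 1F → inj₂ row≢0 ; 2F → inj₁ refl }) in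
                           v 1F refl , v 2F refl , v 3F refl

  on-axis₂ : ∀ {a} → Elementary a → a 1F ≢ 0r → row (extraRows 2F) a ≢ 0r → a 0F ≡ 0r × a 2F ≡ 0r × a 3F ≡ 0r
  on-axis₂ el x≢0 row≢0 = let (v , _) = el axis₂ (λ h → 1≢0 (h 1F))
                               (λ { 0F → inj₁ refl ; 1F → inj₂ x≢0 ; 2F → inj₁ refl ; 3F → inj₁ refl })
                               (λ { 0F → inj₁ refl ; 1F → inj₁ refl ; 2F → inj₂ row≢0 }) in
                           v 0F refl , v 2F refl , v 3F refl

  on-axis₄ : ∀ {a} → Elementary a → a 3F ≢ 0r → (∀ l → row (extraRows l) a ≢ 0r) → a 2F ≡ 0r
  on-axis₄ el x≢0 row≢0 = proj₁ (el axis₄ (λ h → 1≢0 (h 3F))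
    (λ { 0F → inj₁ refl ; 1F → inj₁ refl ; 2F → inj₁ refl ; 3F → inj₂ x≢0 }) (λ l → inj₂ (row≢0 l))) 2F refl

  on-climb : ∀ {a} → Elementary a → a 2F ≢ 0r → a 3F ≢ 0r → row (extraRows 1F) a ≢ 0r → row (extraRows 2F) a ≢ 0r →
             row (extraRows 0F) a ≡ 0r
  on-climb el z≢0 t≢0 row₁ row₂ = proj₂ (el climb (λ h → 1≢0 (h 2F))
    (λ { 0F → inj₁ refl ; 1F → inj₁ refl ; 2F → inj₂ z≢0 ; 3F → inj₂ t≢0 })
    (λ { 0F → inj₁ refl ; 1F → inj₂ row₁ ; 2F → inj₂ row₂ })) 0F refl

  on-slide : ∀ {a} → Elementary a → a 0F ≢ 0r → a 1F ≢ 0r → a 3F ≢ 0r → row (extraRows 0F) a ≢ 0r → a 2F ≡ 0r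
  on-slide el x≢0 y≢0 t≢0 row₀ = proj₁ (el slide (λ h → 1≢0 (h 0F))
    (λ { 0F → inj₂ x≢0 ; 1F → inj₂ y≢0 ; 2F → inj₁ refl ; 3F → inj₂ t≢0 })
    (λ { 0F → inj₂ row₀ ; 1F → inj₁ refl ; 2F → inj₁ refl })) 2F refl

  NonNegative : Point → Set
  NonNegative a = ∀ j → 0r ≤ a j

  -- On a nonnegative vector x₁ + x₄ cannot cancel, so moving x₁ already admits e₁ as a test vector.
  pos-axis₁ : ∀ {a} → Elementary a → NonNegative a → 0r < a 0F → a 1F ≡ 0r × a 2F ≡ 0r × a 3F ≡ 0r
  pos-axis₁ {a} el nn 0<x = on-axis₁ el (pos⇒≢0 0<x) (pos⇒≢0 (linear-< (tabulate a) (‵ + 0) (rows 1F var)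
    ((‵ + 0 ≺ var 0F by 0<x) ∷ (‵ + 0 ≼ var 3F by nn 3F) ∷ [])))

  pos-axis₂ : ∀ {a} → Elementary a → NonNegative a → 0r < a 1F → a 0F ≡ 0r × a 2F ≡ 0r × a 3F ≡ 0r
  pos-axis₂ {a} el nn 0<y = on-axis₂ el (pos⇒≢0 0<y) (pos⇒≢0 (linear-< (tabulate a) (‵ + 0) (rows 2F var)
    ((‵ + 0 ≺ var 1F by 0<y) ∷ (‵ + 0 ≼ var 3F by nn 3F) ∷ [])))

  pos-climb : ∀ {a} → Elementary a → NonNegative a → 0r < a 2F → 0r < a 3F → row (extraRows 0F) a ≡ 0r
  pos-climb {a} el nn 0<z 0<t = on-climb el (pos⇒≢0 0<z) (pos⇒≢0 0<t)
    (pos⇒≢0 (linear-< (tabulate a) (‵ + 0) (rows 1F var) ((‵ + 0 ≼ var 0F by nn 0F) ∷ (‵ + 0 ≺ var 3F by 0<t) ∷ [])))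
    (pos⇒≢0 (linear-< (tabulate a) (‵ + 0) (rows 2F var) ((‵ + 0 ≼ var 1F by nn 1F) ∷ (‵ + 0 ≺ var 3F by 0<t) ∷ [])))

  -- Some step moves x₁ and hence lies on the first axis. The other one has to move x₂ and lies on
  -- the second axis, so nothing moves x₃.
  no-two-steps : ∀ {a c} → Elementary a → NonNegative a → Elementary c → NonNegative c → ¬ (∀ j → a j + c j ≡ fromℤ (+ 2))
  no-two-steps {a} {c} el-a nn-a el-c nn-c sum with zero-or-pos (nn-a 0F) | zero-or-pos (nn-c 0F)
  ... | inj₁ a₀ | inj₁ c₀ = refute (a 0F ∷ c 0F ∷ []) ((var 0F ⊕ var 1F ≈ ‵ + 2 by sum 0F) ∷ (var 0F ≈ ‵ + 0 by a₀) ∷ (var 1F ≈ ‵ + 0 by c₀) ∷ [])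
  ... | inj₂ 0<a | _ = ordered el-a nn-a el-c nn-c sum 0<a
    where
    ordered : ∀ {a c} → Elementary a → NonNegative a → Elementary c → NonNegative c → (∀ j → a j + c j ≡ fromℤ (+ 2)) → ¬ (0r < a 0F)
    ordered {a} {c} el-a nn-a el-c nn-c sum 0<a =
      let (a₁ , a₂ , _) = pos-axis₁ el-a nn-a 0<a
          known = (var 0F ⊕ var 2F ≈ ‵ + 2 by sum 1F) ∷ (var 1F ⊕ var 3F ≈ ‵ + 2 by sum 2F) ∷ (var 0F ≈ ‵ + 0 by a₁) ∷ (var 1F ≈ ‵ + 0 by a₂) ∷ []
          (_ , c₂ , _) = pos-axis₂ el-c nn-c (linear-< (a 1F ∷ a 2F ∷ c 1F ∷ c 2F ∷ []) (‵ + 0) (var 2F) known) in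
      refute (a 1F ∷ a 2F ∷ c 1F ∷ c 2F ∷ []) ((var 3F ≈ ‵ + 0 by c₂) ∷ known)
  ... | inj₁ a₀ | inj₂ 0<c = ordered
    where
    ordered : ⊥
    ordered =
      let (c₁ , c₂ , _) = pos-axis₁ el-c nn-c 0<c
          known = (var 0F ⊕ var 2F ≈ ‵ + 2 by sum 1F) ∷ (var 1F ⊕ var 3F ≈ ‵ + 2 by sum 2F) ∷ (var 2F ≈ ‵ + 0 by c₁) ∷ (var 3F ≈ ‵ + 0 by c₂) ∷ []
          (_ , a₂ , _) = pos-axis₂ el-a nn-a (linear-< (a 1F ∷ a 2F ∷ c 1F ∷ c 2F ∷ []) (‵ + 0) (var 0F) known) in
      refute (a 1F ∷ a 2F ∷ c 1F ∷ c 2F ∷ []) ((var 1F ≈ ‵ + 0 by a₂) ∷ known)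

  Multiple : Point → IntVec → Set
  Multiple a u = ∃ λ τ → 0r < τ × (∀ j → a j ≡ fromℤ (u j) * τ)

  -- First, middle and last displacement of a walk between opposite corners. Starting at the lower
  -- and ending at the upper corner makes `a` and `c` nonnegative; `d` may have any signs.
  -- Non-repetition enters as `apart`.
  record ThreeSteps (a d c : Point) : Set where
    field
      elₐ   : Elementary a
      el    : Elementary d
      elᶜ   : Elementary c
      nnₐ   : NonNegative a
      nnᶜ   : NonNegative c
      leₐ   : ∀ j → a j ≤ fromℤ (+ 2)
      leᶜ   : ∀ j → c j ≤ fromℤ (+ 2)
      sum   : ∀ j → a j + d j + c j ≡ fromℤ (+ 2)
      apart : ∀ u j₀ → ∣ u j₀ ∣ ≡ 1 → Multiple a u → ¬ Multiple c u

  -- Reversing the order of the steps preserves the hypotheses and halves the case analysis.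
  swap : ∀ {a d c} → ThreeSteps a d c → ThreeSteps c d a
  swap {a} {d} {c} S = record
    { elₐ = elᶜ ; el = el ; elᶜ = elₐ ; nnₐ = nnᶜ ; nnᶜ = nnₐ ; leₐ = leᶜ ; leᶜ = leₐ
    ; sum = λ j → trans (solve 3 (λ a d c → c :+ d :+ a := a :+ d :+ c) refl (a j) (d j) (c j)) (sum j)
    ; apart = λ u j₀ unit p q → apart u j₀ unit q p }
    where open ThreeSteps S

  vars : ∀ {k} → Fin k → Fin k → Fin k → Fin k → Fin 4 → Lin k
  vars i j k l = lookup (var i ∷ var j ∷ var k ∷ var l ∷ [])

  not-2-2 : ∀ {c} → Elementary c → NonNegative c → c 2F ≡ fromℤ (+ 2) → ¬ (c 3F ≡ fromℤ (+ 2))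
  not-2-2 {c} el nn c₂ c₃ = refute (tabulate c) ((rows 0F var ≈ ‵ + 0 by pos-climb el nn 0<c₂ 0<c₃) ∷ (var 2F ≈ ‵ + 2 by c₂) ∷ (var 3F ≈ ‵ + 2 by c₃) ∷ [])
    where
    0<c₂ = subst (0r <_) (sym c₂) (0<fromℕ 1)
    0<c₃ = subst (0r <_) (sym c₃) (0<fromℕ 1)

  two-axes : ∀ {a d c} → ThreeSteps a d c → 0r < a 0F → ¬ (0r < c 1F)
  -- The last two entries of `d` equal 2 and the first two are nonnegative, so all extra rows are
  -- positive on `d`; the test vector e₄ then gives `d 2F ≡ 0r`.
  two-axes {a} {d} {c} S 0<a 0<c = refute ρ ((var 10F ≈ ‵ + 0 by on-axis₄ el d₃≢0 rows≢0) ∷ known)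
    where
    open ThreeSteps S
    10F 11F : Fin 12
    10F = suc 9F
    11F = suc (suc 9F)
    ρ = tabulate a ++ tabulate c ++ tabulate d
    pa = pos-axis₁ elₐ nnₐ 0<a
    pc = pos-axis₂ elᶜ nnᶜ 0<c
    known : List (Fact ρ)
    known = (var 0F ⊕ var 8F ⊕ var 4F ≈ ‵ + 2 by sum 0F) ∷ (var 1F ⊕ var 9F ⊕ var 5F ≈ ‵ + 2 by sum 1F)
      ∷ (var 2F ⊕ var 10F ⊕ var 6F ≈ ‵ + 2 by sum 2F) ∷ (var 3F ⊕ var 11F ⊕ var 7F ≈ ‵ + 2 by sum 3F)
      ∷ (var 1F ≈ ‵ + 0 by proj₁ pa) ∷ (var 2F ≈ ‵ + 0 by proj₁ (proj₂ pa)) ∷ (var 3F ≈ ‵ + 0 by proj₂ (proj₂ pa))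
      ∷ (var 4F ≈ ‵ + 0 by proj₁ pc) ∷ (var 6F ≈ ‵ + 0 by proj₁ (proj₂ pc)) ∷ (var 7F ≈ ‵ + 0 by proj₂ (proj₂ pc))
      ∷ (var 0F ≼ ‵ + 2 by leₐ 0F) ∷ (var 5F ≼ ‵ + 2 by leᶜ 1F) ∷ []
    d₃≢0 : d 3F ≢ 0r
    d₃≢0 = nonzero ρ (var 11F) known
    rows≢0 : ∀ l → row (extraRows l) d ≢ 0r
    rows≢0 0F = nonzero ρ (rows 0F (vars 8F 9F 10F 11F)) known
    rows≢0 1F = nonzero ρ (rows 1F (vars 8F 9F 10F 11F)) known
    rows≢0 2F = nonzero ρ (rows 2F (vars 8F 9F 10F 11F)) known

  -- The whole second coordinate is left to `d`, whose fourth is nonnegative, so `d` lies on the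
  -- second axis. Then `c` alone supplies 2 in both last coordinates, against `not-2-2`.
  only-axis₁ : ∀ {a d c} → ThreeSteps a d c → 0r < a 0F → ¬ (c 1F ≡ 0r)
  only-axis₁ {a} {d} {c} S 0<a c₁ = not-2-2 elᶜ nnᶜ
      (linear-≡ ρ (var 3F) (‵ + 2) ((var 6F ≈ ‵ + 0 by proj₁ (proj₂ pd)) ∷ known))
      (linear-≡ ρ (var 4F) (‵ + 2) ((var 7F ≈ ‵ + 0 by proj₂ (proj₂ pd)) ∷ known))
    where
    open ThreeSteps S
    ρ = a 1F ∷ a 2F ∷ a 3F ∷ c 2F ∷ c 3F ∷ d 1F ∷ d 2F ∷ d 3F ∷ c 1F ∷ d 0F ∷ []
    pa = pos-axis₁ elₐ nnₐ 0<a
    known : List (Fact ρ)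
    known = (var 0F ⊕ var 5F ⊕ var 8F ≈ ‵ + 2 by sum 1F) ∷ (var 1F ⊕ var 6F ⊕ var 3F ≈ ‵ + 2 by sum 2F) ∷ (var 2F ⊕ var 7F ⊕ var 4F ≈ ‵ + 2 by sum 3F)
      ∷ (var 0F ≈ ‵ + 0 by proj₁ pa) ∷ (var 1F ≈ ‵ + 0 by proj₁ (proj₂ pa)) ∷ (var 2F ≈ ‵ + 0 by proj₂ (proj₂ pa))
      ∷ (var 8F ≈ ‵ + 0 by c₁) ∷ (var 4F ≼ ‵ + 2 by leᶜ 3F) ∷ []
    d₁≢0 : d 1F ≢ 0r
    d₁≢0 = nonzero ρ (var 5F) known
    row≢0 : row (extraRows 2F) d ≢ 0r
    row≢0 = nonzero ρ (rows 2F (vars 9F 5F 6F 7F)) known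
    pd = on-axis₂ el d₁≢0 row≢0

  only-axis₂ : ∀ {a d c} → ThreeSteps a d c → 0r < a 1F → ¬ (c 0F ≡ 0r)
  only-axis₂ {a} {d} {c} S 0<a c₀ = not-2-2 elᶜ nnᶜ
      (linear-≡ ρ (var 3F) (‵ + 2) ((var 6F ≈ ‵ + 0 by proj₁ (proj₂ pd)) ∷ known))
      (linear-≡ ρ (var 4F) (‵ + 2) ((var 7F ≈ ‵ + 0 by proj₂ (proj₂ pd)) ∷ known))
    where
    open ThreeSteps S
    ρ = a 0F ∷ a 2F ∷ a 3F ∷ c 2F ∷ c 3F ∷ d 0F ∷ d 2F ∷ d 3F ∷ c 0F ∷ d 1F ∷ []
    pa = pos-axis₂ elₐ nnₐ 0<a
    known : List (Fact ρ)
    known = (var 0F ⊕ var 5F ⊕ var 8F ≈ ‵ + 2 by sum 0F) ∷ (var 1F ⊕ var 6F ⊕ var 3F ≈ ‵ + 2 by sum 2F) ∷ (var 2F ⊕ var 7F ⊕ var 4F ≈ ‵ + 2 by sum 3F)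
      ∷ (var 0F ≈ ‵ + 0 by proj₁ pa) ∷ (var 1F ≈ ‵ + 0 by proj₁ (proj₂ pa)) ∷ (var 2F ≈ ‵ + 0 by proj₂ (proj₂ pa))
      ∷ (var 8F ≈ ‵ + 0 by c₀) ∷ (var 4F ≼ ‵ + 2 by leᶜ 3F) ∷ []
    d₀≢0 : d 0F ≢ 0r
    d₀≢0 = nonzero ρ (var 5F) known
    row≢0 : row (extraRows 1F) d ≢ 0r
    row≢0 = nonzero ρ (rows 1F (vars 5F 9F 6F 7F)) known
    pd = on-axis₁ el d₀≢0 row≢0

  Vertical : Point → Set
  Vertical a = a 0F ≡ 0r × a 1F ≡ 0r

  vertical-2 : ∀ {a} → Elementary a → NonNegative a → Vertical a → a 3F ≡ fromℤ (+ 2) →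
               (a 2F ≡ 0r × Multiple a axis₄) ⊎ (a 2F ≡ fromℤ (+ 1) × Multiple a climb)
  vertical-2 {a} el nn (a₀ , a₁) a₃ with zero-or-pos (nn 2F)
  ... | inj₁ a₂ = inj₁ (a₂ , a 3F , subst (0r <_) (sym a₃) (0<fromℕ 1) , λ
    { 0F → linear-≡ (tabulate a) (var 0F) (+ 0 ⊛ var 3F) facts
    ; 1F → linear-≡ (tabulate a) (var 1F) (+ 0 ⊛ var 3F) facts
    ; 2F → linear-≡ (tabulate a) (var 2F) (+ 0 ⊛ var 3F) facts
    ; 3F → linear-≡ (tabulate a) (var 3F) (+ 1 ⊛ var 3F) facts })
    where
    facts : List (Fact (tabulate a))
    facts = (var 0F ≈ ‵ + 0 by a₀) ∷ (var 1F ≈ ‵ + 0 by a₁) ∷ (var 2F ≈ ‵ + 0 by a₂) ∷ []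
  ... | inj₂ 0<a₂ = inj₂ (linear-≡ (tabulate a) (var 2F) (‵ + 1) facts , a 2F , 0<a₂ , λ
    { 0F → linear-≡ (tabulate a) (var 0F) (+ 0 ⊛ var 2F) facts
    ; 1F → linear-≡ (tabulate a) (var 1F) (+ 0 ⊛ var 2F) facts
    ; 2F → linear-≡ (tabulate a) (var 2F) (+ 1 ⊛ var 2F) facts
    ; 3F → linear-≡ (tabulate a) (var 3F) (+ 2 ⊛ var 2F) facts })
    where
    facts : List (Fact (tabulate a))
    facts = (var 0F ≈ ‵ + 0 by a₀) ∷ (var 1F ≈ ‵ + 0 by a₁) ∷ (var 3F ≈ ‵ + 2 by a₃)
          ∷ (rows 0F var ≈ ‵ + 0 by pos-climb el nn 0<a₂ (subst (0r <_) (sym a₃) (0<fromℕ 1))) ∷ []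

  -- Now `d` has first entries 2, 2, and x₁ + x₄ must vanish on it, since otherwise it would lie on
  -- the first axis. So `d 3F` is -2 and `a`, `c` both have last entry 2: each is 2e₄ or `climb`.
  -- Equal ones repeat a direction; different ones leave `d 2F` = 1, which the test vector `slide`
  -- forbids.
  module BothVertical {a d c} (S : ThreeSteps a d c) (va : Vertical a) (vc : Vertical c) where
    open ThreeSteps S
    ρ : Vec Carrier 8
    ρ = a 2F ∷ a 3F ∷ c 2F ∷ c 3F ∷ d 0F ∷ d 1F ∷ d 2F ∷ d 3F ∷ []
    known : List (Fact ρ)
    known = (‵ + 0 ⊕ var 4F ⊕ ‵ + 0 ≈ ‵ + 2 by subst₂ (λ x y → x + d 0F + y ≡ fromℤ (+ 2)) (proj₁ va) (proj₁ vc) (sum 0F))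
      ∷ (‵ + 0 ⊕ var 5F ⊕ ‵ + 0 ≈ ‵ + 2 by subst₂ (λ x y → x + d 1F + y ≡ fromℤ (+ 2)) (proj₂ va) (proj₂ vc) (sum 1F))
      ∷ (var 0F ⊕ var 6F ⊕ var 2F ≈ ‵ + 2 by sum 2F) ∷ (var 1F ⊕ var 7F ⊕ var 3F ≈ ‵ + 2 by sum 3F)
      ∷ (var 1F ≼ ‵ + 2 by leₐ 3F) ∷ (var 3F ≼ ‵ + 2 by leᶜ 3F) ∷ []
    d₀≢0 : d 0F ≢ 0r
    d₀≢0 = nonzero ρ (var 4F) known
    d₁≢0 : d 1F ≢ 0r
    d₁≢0 = nonzero ρ (var 5F) known
    row≡0 : row (extraRows 1F) d ≡ 0r
    row≡0 = decidable-stable (row (extraRows 1F) d ≟ 0r) (λ p → d₁≢0 (proj₁ (on-axis₁ el d₀≢0 p)))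
    all : List (Fact ρ)
    all = (rows 1F (vars 4F 5F 6F 7F) ≈ ‵ + 0 by row≡0) ∷ known
    crossed : a 2F + c 2F ≢ fromℤ (+ 1)
    crossed p = refute ρ ((var 6F ≈ ‵ + 0 by on-slide el d₀≢0 d₁≢0
        (nonzero ρ (var 7F) all)
        (λ h → refute ρ ((rows 0F (vars 4F 5F 6F 7F) ≈ ‵ + 0 by h) ∷ (var 0F ⊕ var 2F ≈ ‵ + 1 by p) ∷ all)))
      ∷ (var 0F ⊕ var 2F ≈ ‵ + 1 by p) ∷ all)
    impossible : ⊥
    impossible = compare (vertical-2 elₐ nnₐ va (linear-≡ ρ (var 1F) (‵ + 2) all))
                         (vertical-2 elᶜ nnᶜ vc (linear-≡ ρ (var 3F) (‵ + 2) all))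
      where
      compare : (a 2F ≡ 0r × Multiple a axis₄) ⊎ (a 2F ≡ fromℤ (+ 1) × Multiple a climb) →
                (c 2F ≡ 0r × Multiple c axis₄) ⊎ (c 2F ≡ fromℤ (+ 1) × Multiple c climb) → ⊥
      compare (inj₁ (_ , p))  (inj₁ (_ , q))  = apart axis₄ 3F refl p q
      compare (inj₂ (_ , p))  (inj₂ (_ , q))  = apart climb 2F refl p q
      compare (inj₁ (a₂ , _)) (inj₂ (c₂ , _)) = crossed (trans (cong₂ _+_ a₂ c₂) (+-identityˡ _))
      compare (inj₂ (a₂ , _)) (inj₁ (c₂ , _)) = crossed (trans (cong₂ _+_ a₂ c₂) (+-identityʳ _))

  no-three-steps : ∀ {a d c} → ¬ ThreeSteps a d c
  no-three-steps {a} {d} {c} S = decide (zero-or-pos (nnₐ 0F)) (zero-or-pos (nnₐ 1F)) (zero-or-pos (nnᶜ 0F)) (zero-or-pos (nnᶜ 1F))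
    where
    open ThreeSteps S
    Sign : Carrier → Set
    Sign x = (x ≡ 0r) ⊎ (0r < x)
    decide : Sign (a 0F) → Sign (a 1F) → Sign (c 0F) → Sign (c 1F) → ⊥
    decide (inj₂ p) _ _ (inj₂ q)               = two-axes S p q
    decide (inj₂ p) _ _ (inj₁ q)               = only-axis₁ S p q
    decide _ (inj₂ p) (inj₂ q) _               = two-axes (swap S) q p
    decide _ (inj₂ p) (inj₁ q) _               = only-axis₂ S p q
    decide _ (inj₁ p) (inj₂ q) _               = only-axis₁ (swap S) q p
    decide (inj₁ p) _ _ (inj₂ q)               = only-axis₂ (swap S) q p
    decide (inj₁ p) (inj₁ q) (inj₁ u) (inj₁ v) = BothVertical.impossible S (p , q) (u , v)

  no-short-feasible-walk : ∀ ws → IsWalk (pt o) (pt q) ws → FeasW (pt o) ws → ¬ (length ws ℕ.≤ 2)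
  no-short-feasible-walk [] (_ , end) _ _ = refute [] ((‵ + 0 ≈ ‵ + 2 by end 0F) ∷ [])
  no-short-feasible-walk (st ∷ []) ((circ , 0<α) ∷ [] , end) _ _ =
      refute (a 0F ∷ a 1F ∷ []) ((var 1F ≈ ‵ + 0 by proj₁ (pos-axis₁ (IsCircuit⇒Elementary circ 0<α) (λ j → inj₁ (pos j)) (pos 0F))) ∷ (‵ + 0 ⊕ var 1F ≈ ‵ + 2 by end 1F) ∷ [])
    where
    a = displacement st
    pos : ∀ j → 0r < a j
    pos j = linear-< (a j ∷ []) (‵ + 0) (var 0F) ((‵ + 0 ⊕ var 0F ≈ ‵ + 2 by end j) ∷ [])
  no-short-feasible-walk (st ∷ st′ ∷ []) ((circ , 0<α) ∷ (circ′ , 0<β) ∷ [] , end) (_ , in₁ , in₂) _ =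
      no-two-steps (IsCircuit⇒Elementary circ 0<α)
        (λ j → linear-≤ (a j ∷ []) (‵ + 0) (var 0F) ((‵ + 0 ≼ ‵ + 0 ⊕ var 0F by proj₁ (box₁ j)) ∷ []))
        (IsCircuit⇒Elementary circ′ 0<β)
        (λ j → linear-≤ (a j ∷ c j ∷ []) (‵ + 0) (var 1F) ((‵ + 0 ⊕ var 0F ≼ ‵ + 2 by proj₂ (box₁ j)) ∷ (‵ + 0 ⊕ var 0F ⊕ var 1F ≈ ‵ + 2 by end j) ∷ []))
        (λ j → linear-≡ (a j ∷ c j ∷ []) (var 0F ⊕ var 1F) (‵ + 2) ((‵ + 0 ⊕ var 0F ⊕ var 1F ≈ ‵ + 2 by end j) ∷ []))
    where
    a = displacement st
    c = displacement st′
    box₁ = InP⇒InBox (λ j → 0r + a j) in₁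
  no-short-feasible-walk (_ ∷ _ ∷ _ ∷ _) _ _ (ℕ.s≤s (ℕ.s≤s ()))

  no-nonrepetitive-walk : ∀ ws → IsWalk (pt o) (pt q) ws → FeasW (pt o) ws → NonRep ws → ¬ (length ws ℕ.≤ 3)
  no-nonrepetitive-walk ws@[] walk feas _ _ = no-short-feasible-walk ws walk feas ℕ.z≤n
  no-nonrepetitive-walk ws@(_ ∷ []) walk feas _ _ = no-short-feasible-walk ws walk feas (ℕ.s≤s ℕ.z≤n)
  no-nonrepetitive-walk ws@(_ ∷ _ ∷ []) walk feas _ _ = no-short-feasible-walk ws walk feas (ℕ.s≤s (ℕ.s≤s ℕ.z≤n))
  no-nonrepetitive-walk (s₁ ∷ s₂ ∷ s₃ ∷ []) ((circ₁ , 0<α₁) ∷ (circ₂ , 0<α₂) ∷ (circ₃ , 0<α₃) ∷ [] , end) (_ , in₁ , in₂ , _) ((_ ∷ s₁≢s₃ ∷ []) ∷ _) _ =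
      no-three-steps (record
        { elₐ = IsCircuit⇒Elementary circ₁ 0<α₁
        ; el  = IsCircuit⇒Elementary circ₂ 0<α₂
        ; elᶜ = IsCircuit⇒Elementary circ₃ 0<α₃
        ; nnₐ = λ j → linear-≤ (ρ j) (‵ + 0) (var 0F) (facts j)
        ; nnᶜ = λ j → linear-≤ (ρ j) (‵ + 0) (var 2F) (facts j)
        ; leₐ = λ j → linear-≤ (ρ j) (var 0F) (‵ + 2) (facts j)
        ; leᶜ = λ j → linear-≤ (ρ j) (var 2F) (‵ + 2) (facts j)
        ; sum = λ j → linear-≡ (ρ j) (var 0F ⊕ var 1F ⊕ var 2F) (‵ + 2) (facts j)
        ; apart = λ u j₀ unit (τ , 0<τ , p) (σ , 0<σ , p′) →
            s₁≢s₃ (λ i → trans (direction-unique circ₁ 0<α₁ 0<τ u j₀ unit p i) (sym (direction-unique circ₃ 0<α₃ 0<σ u j₀ unit p′ i))) })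
    where
    ρ : Fin 4 → Vec Carrier 3
    ρ j = displacement s₁ j ∷ displacement s₂ j ∷ displacement s₃ j ∷ []
    facts : ∀ j → List (Fact (ρ j))
    facts j = (‵ + 0 ≼ ‵ + 0 ⊕ var 0F by proj₁ (InP⇒InBox (λ j → 0r + displacement s₁ j) in₁ j)) ∷ (‵ + 0 ⊕ var 0F ≼ ‵ + 2 by proj₂ (InP⇒InBox (λ j → 0r + displacement s₁ j) in₁ j))
            ∷ (‵ + 0 ≼ ‵ + 0 ⊕ var 0F ⊕ var 1F by proj₁ (InP⇒InBox (λ j → 0r + displacement s₁ j + displacement s₂ j) in₂ j)) ∷ (‵ + 0 ⊕ var 0F ⊕ var 1F ≼ ‵ + 2 by proj₂ (InP⇒InBox (λ j → 0r + displacement s₁ j + displacement s₂ j) in₂ j))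
            ∷ (‵ + 0 ⊕ var 0F ⊕ var 1F ⊕ var 2F ≈ ‵ + 2 by end j) ∷ []
  no-nonrepetitive-walk (_ ∷ _ ∷ _ ∷ _ ∷ _) _ _ _ (ℕ.s≤s (ℕ.s≤s (ℕ.s≤s ())))

  -- `zigzag` is maximal and non-backwards, and the lower bound rests on feasibility and
  -- non-repetition, so one walk gives the strictness of adding r in (iii), (v) and (vi).
  fmr>fm : Gap ℝ (f ∷ m ∷ r ∷ []) (f ∷ m ∷ [])
  fmr>fm = P , pt o , pt q , o-vertex , q-vertex , 3 , (real zigzag , (zigzag-walk , zigzag-f ∷ zigzag-m ∷ []) , ℕₚ.≤-refl) ,
    λ { (ws , (walk , feas ∷ _ ∷ nr ∷ []) , len) → no-nonrepetitive-walk ws walk feas nr len }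

  fr>f : Gap ℝ (f ∷ r ∷ []) (f ∷ [])
  fr>f = P , pt o , pt q , o-vertex , q-vertex , 3 , (real zigzag , (zigzag-walk , zigzag-f ∷ []) , ℕₚ.≤-refl) ,
    λ { (ws , (walk , feas ∷ nr ∷ []) , len) → no-nonrepetitive-walk ws walk feas nr len }

  fbr>fb : Gap ℝ (f ∷ b ∷ r ∷ []) (f ∷ b ∷ [])
  fbr>fb = P , pt o , pt q , o-vertex , q-vertex , 3 , (real zigzag , (zigzag-walk , zigzag-f ∷ zigzag-b ∷ []) , ℕₚ.≤-refl) ,
    λ { (ws , (walk , feas ∷ _ ∷ nr ∷ []) , len) → no-nonrepetitive-walk ws walk feas nr len }

  f>∅ : Gap ℝ (f ∷ []) []
  f>∅ = P , pt o , pt q , o-vertex , q-vertex , 2 , (real shortcut , (shortcut-walk , []) , ℕₚ.≤-refl) ,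
    λ { (ws , (walk , feas ∷ []) , len) → no-short-feasible-walk ws walk feas len }

-- The box of dimension five: maximal steps, and backward steps.

module Penteract (ℝ : RealField) where
  open RealField ℝ hiding (_-_)

  extraRows : Fin 4 → Fin 5 → ℤ
  extraRows = matrix ( (+ 0 ∷ + 1 ∷ + 1 ∷ + 1 ∷ + 6 ∷ [])
                     ∷ (+ 1 ∷ + 0 ∷ + 1 ∷ + 1 ∷ + 6 ∷ [])
                     ∷ (+ 1 ∷ + 1 ∷ + 0 ∷ + 1 ∷ + 6 ∷ [])
                     ∷ (+ 1 ∷ + 1 ∷ + 1 ∷ + 0 ∷ + 6 ∷ []) ∷ [])

  open Box ℝ 5 4 2 extraRows

  o q lift sweep fall : IntVec
  o _   = + 0
  q     = lookup (+ 2 ∷ + 2 ∷ + 2 ∷ + 2 ∷ + 0 ∷ [])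
  lift  = lookup (+ 0 ∷ + 0 ∷ + 0 ∷ + 0 ∷ + 1 ∷ [])
  sweep = lookup (+ 2 ∷ + 2 ∷ + 2 ∷ + 2 ∷ -[1+ 0 ] ∷ [])
  fall  = lookup (+ 0 ∷ + 0 ∷ + 0 ∷ + 0 ∷ -[1+ 0 ] ∷ [])

  o-vertex : IsVertex (pt o)
  o-vertex = corner-IsVertex o λ _ → inj₁ refl

  q-vertex : IsVertex (pt q)
  q-vertex = corner-IsVertex q λ { 0F → inj₂ refl ; 1F → inj₂ refl ; 2F → inj₂ refl ; 3F → inj₂ refl ; 4F → inj₁ refl }

  rows : ∀ {k} → Fin 4 → (Fin 5 → Lin k) → Lin k
  rows l = form-of (extraRows l)

  vertical-circuit : ∀ u → ∣ u 4F ∣ ≡ 1 → u 0F ≡ + 0 → u 1F ≡ + 0 → u 2F ≡ + 0 → u 3F ≡ + 0 → IsCircuit u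
  vertical-circuit u unit u₀ u₁ u₂ u₃ = isCircuit u 4F unit λ z coords _ →
      fromℤ (u 4F) * z 4F , λ
      { 0F → off (coords 0F u₀) u₀ ; 1F → off (coords 1F u₁) u₁ ; 2F → off (coords 2F u₂) u₂ ; 3F → off (coords 3F u₃) u₃
      ; 4F → trans (sym (trans (cong (λ w → fromℤ w * z 4F) (unit-square (u 4F) unit)) (solve 1 (λ z → con (+ 1) :* z := z) refl (z 4F))))
               (trans (cong (_* z 4F) (fromℤ-* (u 4F) (u 4F))) (*-assoc _ _ _)) }
    where
    off : ∀ {x w y} → x ≡ 0r → y ≡ + 0 → x ≡ fromℤ y * w
    off p refl = trans p (sym (zeroˡ _))

  lift-circuit : IsCircuit lift
  lift-circuit = vertical-circuit lift refl refl refl refl refl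

  fall-circuit : IsCircuit fall
  fall-circuit = vertical-circuit fall refl refl refl refl refl

  -- Vanishing of all four rows makes every xⱼ equal to w; then w = 4w + 6t, so each xⱼ is -2t and
  -- the scale is -t.
  sweep-circuit : IsCircuit sweep
  sweep-circuit = isCircuit sweep 4F refl λ z coords extras →
    let ρ = z 0F ∷ z 1F ∷ z 2F ∷ z 3F ∷ z 4F ∷ fromℤ -[1+ 0 ] * z 4F ∷ [] in
    fromℤ -[1+ 0 ] * z 4F , λ
    { 0F → linear-≡ ρ (var 0F) (+ 2 ⊛ var 5F) (widen z extras)
    ; 1F → linear-≡ ρ (var 1F) (+ 2 ⊛ var 5F) (widen z extras)
    ; 2F → linear-≡ ρ (var 2F) (+ 2 ⊛ var 5F) (widen z extras)
    ; 3F → linear-≡ ρ (var 3F) (+ 2 ⊛ var 5F) (widen z extras)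
    ; 4F → linear-≡ ρ (var 4F) (-[1+ 0 ] ⊛ var 5F) (widen z extras) }
    where
    five : Fin 5 → Lin 6
    five = lookup (var 0F ∷ var 1F ∷ var 2F ∷ var 3F ∷ var 4F ∷ [])
    widen : ∀ z → (∀ l → Eℤ l sweep ≡ + 0 → row (extraRows l) z ≡ 0r) →
            List (Fact (z 0F ∷ z 1F ∷ z 2F ∷ z 3F ∷ z 4F ∷ fromℤ -[1+ 0 ] * z 4F ∷ []))
    widen z extras = (rows 0F five ≈ ‵ + 0 by extras 0F refl) ∷ (rows 1F five ≈ ‵ + 0 by extras 1F refl)
              ∷ (rows 2F five ≈ ‵ + 0 by extras 2F refl) ∷ (rows 3F five ≈ ‵ + 0 by extras 3F refl)
              ∷ (var 5F ≈ -[1+ 0 ] ⊛ var 4F by refl) ∷ []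

  detour : List IntStep
  detour = (lift , 2) ∷ (sweep , 1) ∷ (fall , 1) ∷ []

  detour-walk : IsWalk (pt o) (pt q) (real detour)
  detour-walk = Reaches⇒IsWalk o q detour (from-yes (reaches? o q detour)) (lift-circuit ∷ sweep-circuit ∷ fall-circuit ∷ [])

  detour-f : FeasW (pt o) (real detour)
  detour-f = feasW o detour (from-yes (feasWℤ? o detour))

  detour-m : MaxW (pt o) (real detour)
  detour-m = maxW o detour (from-yes (maxWℤ? o detour))

  hop : List IntStep
  hop = (lift , 1) ∷ (sweep , 1) ∷ []

  hop-walk : IsWalk (pt o) (pt q) (real hop)
  hop-walk = Reaches⇒IsWalk o q hop (from-yes (reaches? o q hop)) (lift-circuit ∷ sweep-circuit ∷ [])

  hop-f : FeasW (pt o) (real hop)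
  hop-f = feasW o hop (from-yes (feasWℤ? o hop))

  hop-b : NonBack (real hop)
  hop-b = from-yes (nonBack? (real hop))

  hop-r : NonRep (real hop)
  hop-r = from-yes (nonRep? (real hop))

  horizontal : Fin 4 → Fin 5
  horizontal = inject₁

  -- The test vector is the axis itself: w - xᵢ is the one extra row that vanishes on it, so the
  -- others have to be nonzero on `a`.
  along-axis : ∀ i {a} → Elementary a → a (horizontal i) ≢ 0r → (∀ l → i ≢ l → row (extraRows l) a ≢ 0r) → ∀ j → horizontal i ≢ j → a j ≡ 0r
  along-axis i {a} el x≢0 rows≢0 j i≢j = proj₁ (el (δ (horizontal i)) (λ h → 1≢0 (trans (sym (δ-diagonal (horizontal i))) (h (horizontal i)))) coords extras)
      j (δ-off-diagonal (horizontal i) j i≢j)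
    where
    coords : ∀ j → δ (horizontal i) j ≡ + 0 ⊎ a j ≢ 0r
    coords j = decide (horizontal i Finₚ.≟ j)
      where
      decide : Dec (horizontal i ≡ j) → δ (horizontal i) j ≡ + 0 ⊎ a j ≢ 0r
      decide (yes refl) = inj₂ x≢0
      decide (no p)     = inj₁ (δ-off-diagonal (horizontal i) j p)
    on-diagonal : ∀ i → Eℤ i (δ (horizontal i)) ≡ + 0
    on-diagonal = from-yes (Finₚ.all? (λ i → Eℤ i (δ (horizontal i)) ℤ.≟ + 0))
    extras : ∀ l → Eℤ l (δ (horizontal i)) ≡ + 0 ⊎ row (extraRows l) a ≢ 0r
    extras l = decide (i Finₚ.≟ l)
      where
      decide : Dec (i ≡ l) → Eℤ l (δ (horizontal i)) ≡ + 0 ⊎ row (extraRows l) a ≢ 0r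
      decide (yes refl) = inj₁ (on-diagonal i)
      decide (no p)     = inj₂ (rows≢0 l p)

  vertical : ∀ {a} → Elementary a → a 4F ≢ 0r → (∀ l → row (extraRows l) a ≢ 0r) → ∀ j → a (horizontal j) ≡ 0r
  vertical el t≢0 rows≢0 = λ { 0F → v 0F refl ; 1F → v 1F refl ; 2F → v 2F refl ; 3F → v 3F refl }
    where
    v = proj₁ (el lift (λ h → 1≢0 (h 4F)) (λ { 0F → inj₁ refl ; 1F → inj₁ refl ; 2F → inj₁ refl ; 3F → inj₁ refl ; 4F → inj₂ t≢0 }) (λ l → inj₂ (rows≢0 l)))

  -- On the test vector (-6,0,0,0,1) the sum w is 0, so of the extra rows only w - x₁ = 6 is
  -- nonzero.
  oblique : ∀ {a} → Elementary a → a 0F ≢ 0r → a 4F ≢ 0r → row (extraRows 0F) a ≢ 0r →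
            a 1F ≡ 0r × a 2F ≡ 0r × a 3F ≡ 0r × row (extraRows 1F) a ≡ 0r
  oblique el x≢0 t≢0 row≢0 = proj₁ v 1F refl , proj₁ v 2F refl , proj₁ v 3F refl , proj₂ v 1F refl
    where
    v = el (lookup (-[1+ 5 ] ∷ + 0 ∷ + 0 ∷ + 0 ∷ + 1 ∷ [])) (λ h → 1≢0 (h 4F))
      (λ { 0F → inj₂ x≢0 ; 1F → inj₁ refl ; 2F → inj₁ refl ; 3F → inj₁ refl ; 4F → inj₂ t≢0 })
      (λ { 0F → inj₂ row≢0 ; 1F → inj₁ refl ; 2F → inj₁ refl ; 3F → inj₁ refl })

  -- All coefficients of the extra rows are nonnegative, so a vanishing row of a nonnegative vector
  -- vanishes term by term. Hence nonnegative circuits point along axes.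
  row-vanish : ∀ {a} l → (∀ j → 0r ≤ a j) → row (extraRows l) a ≡ 0r → ∀ j → + 0 ℤ.< extraRows l j → a j ≡ 0r
  row-vanish {a} l nn p j 0<E = *-zero-product _ (a j)
      (Σr-≥0-vanish (λ j → fromℤ (extraRows l j) * a j) (λ j → 0≤-* (fromℤ-mono-≤ (E≥0 l j)) (nn j)) p j) (pos⇒≢0 (fromℤ-pos 0<E))
    where
    E≥0 : ∀ l j → + 0 ℤ.≤ extraRows l j
    E≥0 = from-yes (Finₚ.all? λ l → Finₚ.all? λ j → + 0 ℤ.≤? extraRows l j)

  nonneg-rows : ∀ {a} → (∀ j → 0r ≤ a j) → ∀ i → 0r < a (horizontal i) → ∀ l → i ≢ l → row (extraRows l) a ≢ 0r
  nonneg-rows nn i 0<x l i≢l p = pos⇒≢0 0<x (row-vanish l nn p (horizontal i) (off-diagonal i l i≢l))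
    where
    off-diagonal : ∀ i l → i ≢ l → + 0 ℤ.< extraRows l (horizontal i)
    off-diagonal = from-yes (Finₚ.all? λ i → Finₚ.all? λ l → ¬? (i Finₚ.≟ l) →-dec (+ 0 ℤ.<? extraRows l (horizontal i)))

  nonneg-axis : ∀ {a} → Elementary a → (∀ j → 0r ≤ a j) → ∀ i → 0r < a (horizontal i) → ∀ j → horizontal i ≢ j → a j ≡ 0r
  nonneg-axis el nn i 0<x = along-axis i el (pos⇒≢0 0<x) (nonneg-rows nn i 0<x)

  nonneg-vertical : ∀ {a} → Elementary a → (∀ j → 0r ≤ a j) → 0r < a 4F → ∀ j → a (horizontal j) ≡ 0r
  nonneg-vertical el nn 0<t = vertical el (pos⇒≢0 0<t) λ l p → pos⇒≢0 0<t (row-vanish l nn p 4F (above-zero l))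
    where
    above-zero : ∀ l → + 0 ℤ.< extraRows l 4F
    above-zero = from-yes (Finₚ.all? λ l → + 0 ℤ.<? extraRows l 4F)

  -- The second and third step after a first step along the first coordinate axis.
  record Turned (a c : Point) : Set where
    field
      elₐ  : Elementary a
      elᶜ  : Elementary c
      sum₀ : a 0F + c 0F ≡ fromℤ (+ 0)
      sum₁ : a 1F + c 1F ≡ fromℤ (+ 2)
      sum₂ : a 2F + c 2F ≡ fromℤ (+ 2)
      sum₃ : a 3F + c 3F ≡ fromℤ (+ 2)
      sum₄ : a 4F + c 4F ≡ fromℤ (+ 0)
      a₀≤0 : a 0F ≤ fromℤ (+ 0)
      a₀≥  : fromℤ -[1+ 1 ] ≤ a 0F
      a≥0  : ∀ j → j ≢ 0F → 0r ≤ a j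
      a≤2  : ∀ j → j ≢ 0F → a j ≤ fromℤ (+ 2)
      -- Maximality of the second step enters in this form: going straight up from t = 0 it must
      -- reach t = 2.
      maxₐ : (∀ i → a (horizontal i) ≡ 0r) → 0r < a 4F → a 4F ≡ fromℤ (+ 2)

  -- If `a` does not move t, the third step is nonnegative and lies on an axis, which leaves too
  -- much for `a`. If `a` raises t, it is vertical or leans back along (-6,0,0,0,1); then the third
  -- step descends with every extra row nonzero and would have to be vertical.
  module TurnedImpossible {a c} (S : Turned a c) where
    open Turned S
    ρ : Vec Carrier 10
    ρ = a 0F ∷ a 1F ∷ a 2F ∷ a 3F ∷ a 4F ∷ c 0F ∷ c 1F ∷ c 2F ∷ c 3F ∷ c 4F ∷ []
    A C : Fin 5 → Lin 10
    A = lookup (var 0F ∷ var 1F ∷ var 2F ∷ var 3F ∷ var 4F ∷ [])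
    C = lookup (var 5F ∷ var 6F ∷ var 7F ∷ var 8F ∷ var 9F ∷ [])
    known : List (Fact ρ)
    known = (var 0F ⊕ var 5F ≈ ‵ + 0 by sum₀) ∷ (var 1F ⊕ var 6F ≈ ‵ + 2 by sum₁) ∷ (var 2F ⊕ var 7F ≈ ‵ + 2 by sum₂)
          ∷ (var 3F ⊕ var 8F ≈ ‵ + 2 by sum₃) ∷ (var 4F ⊕ var 9F ≈ ‵ + 0 by sum₄)
          ∷ (var 0F ≼ ‵ + 0 by a₀≤0) ∷ (‵ -[1+ 1 ] ≼ var 0F by a₀≥)
          ∷ (‵ + 0 ≼ var 1F by a≥0 1F λ ()) ∷ (var 1F ≼ ‵ + 2 by a≤2 1F λ ())
          ∷ (‵ + 0 ≼ var 2F by a≥0 2F λ ()) ∷ (var 2F ≼ ‵ + 2 by a≤2 2F λ ())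
          ∷ (‵ + 0 ≼ var 3F by a≥0 3F λ ()) ∷ (var 3F ≼ ‵ + 2 by a≤2 3F λ ())
          ∷ (‵ + 0 ≼ var 4F by a≥0 4F λ ()) ∷ []

    module Flat (a₄ : a 4F ≡ 0r) where
      flat : List (Fact ρ)
      flat = (var 4F ≈ ‵ + 0 by a₄) ∷ known
      c≥0 : ∀ j → 0r ≤ c j
      c≥0 0F = linear-≤ ρ (‵ + 0) (var 5F) flat
      c≥0 1F = linear-≤ ρ (‵ + 0) (var 6F) flat
      c≥0 2F = linear-≤ ρ (‵ + 0) (var 7F) flat
      c≥0 3F = linear-≤ ρ (‵ + 0) (var 8F) flat
      c≥0 4F = linear-≤ ρ (‵ + 0) (var 9F) flat

      first : ¬ (0r < c 1F)
      first p = refute ρ ((var 3F ≈ ‵ + 0 by along-axis 2F elₐ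
          (nonzero ρ (var 2F) more)
          (λ { 0F _ → nonzero ρ (rows 0F A) more
             ; 1F _ → nonzero ρ (rows 1F A) more
             ; 2F n → ⊥-elim (n refl)
             ; 3F _ → nonzero ρ (rows 3F A) more }) 3F (λ ())) ∷ more)
        where
        z = nonneg-axis elᶜ c≥0 1F p
        more : List (Fact ρ)
        more = (var 5F ≈ ‵ + 0 by z 0F (λ ())) ∷ (var 7F ≈ ‵ + 0 by z 2F (λ ())) ∷ (var 8F ≈ ‵ + 0 by z 3F (λ ())) ∷ flat

      second : ¬ (0r < c 2F)
      second p = refute ρ ((var 3F ≈ ‵ + 0 by along-axis 1F elₐ
          (nonzero ρ (var 1F) more)
          (λ { 0F _ → nonzero ρ (rows 0F A) more
             ; 1F n → ⊥-elim (n refl)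
             ; 2F _ → nonzero ρ (rows 2F A) more
             ; 3F _ → nonzero ρ (rows 3F A) more }) 3F (λ ())) ∷ more)
        where
        z = nonneg-axis elᶜ c≥0 2F p
        more : List (Fact ρ)
        more = (var 5F ≈ ‵ + 0 by z 0F (λ ())) ∷ (var 6F ≈ ‵ + 0 by z 1F (λ ())) ∷ (var 8F ≈ ‵ + 0 by z 3F (λ ())) ∷ flat

      -- Here x₂ and x₃ of `a` are 2, and w - x₃ vanishes on `a` only if its x₁ is -2 and its x₄ is
      -- 0. That would need `c` to move both x₁ and x₄, but `c` lies on one axis.
      third : c 1F ≡ 0r → c 2F ≡ 0r → (c 0F ≡ 0r) ⊎ (c 3F ≡ 0r) → ⊥
      third c₁ c₂ either = refute ρ ((var 2F ≈ ‵ + 0 by along-axis 1F elₐ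
          (nonzero ρ (var 1F) more)
          (λ { 0F _ → nonzero ρ (rows 0F A) more
             ; 1F n → ⊥-elim (n refl)
             ; 2F _ → row₂ either
             ; 3F _ → nonzero ρ (rows 3F A) more }) 2F (λ ())) ∷ more)
        where
        more : List (Fact ρ)
        more = (var 6F ≈ ‵ + 0 by c₁) ∷ (var 7F ≈ ‵ + 0 by c₂) ∷ flat
        row₂ : (c 0F ≡ 0r) ⊎ (c 3F ≡ 0r) → row (extraRows 2F) a ≢ 0r
        row₂ (inj₁ c₀) h = refute ρ ((rows 2F A ≈ ‵ + 0 by h) ∷ (var 5F ≈ ‵ + 0 by c₀) ∷ more)
        row₂ (inj₂ c₃) h = refute ρ ((rows 2F A ≈ ‵ + 0 by h) ∷ (var 8F ≈ ‵ + 0 by c₃) ∷ more)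

      impossible : ⊥
      impossible = decide (zero-or-pos (c≥0 1F)) (zero-or-pos (c≥0 2F)) (zero-or-pos (c≥0 0F))
        where
        Sign : Carrier → Set
        Sign x = (x ≡ 0r) ⊎ (0r < x)
        decide : Sign (c 1F) → Sign (c 2F) → Sign (c 0F) → ⊥
        decide (inj₂ p) _ _               = first p
        decide _ (inj₂ p) _               = second p
        decide (inj₁ p) (inj₁ q) (inj₁ u) = third p q (inj₁ u)
        decide (inj₁ p) (inj₁ q) (inj₂ u) = third p q (inj₂ (nonneg-axis elᶜ c≥0 0F u 3F (λ ())))

    upright : 0r < a 4F → 0r ≤ a 0F → ⊥
    upright 0<a₄ 0≤a₀ = refute ρ ((var 6F ≈ ‵ + 0 by vertical elᶜ (nonzero ρ (var 9F) more)
        (λ { 0F → nonzero ρ (rows 0F C) more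
           ; 1F → nonzero ρ (rows 1F C) more
           ; 2F → nonzero ρ (rows 2F C) more
           ; 3F → nonzero ρ (rows 3F C) more }) 1F) ∷ more)
      where
      nn : ∀ j → 0r ≤ a j
      nn 0F = 0≤a₀
      nn 1F = a≥0 1F λ ()
      nn 2F = a≥0 2F λ ()
      nn 3F = a≥0 3F λ ()
      nn 4F = a≥0 4F λ ()
      z = nonneg-vertical elₐ nn 0<a₄
      more : List (Fact ρ)
      more = (var 0F ≈ ‵ + 0 by z 0F) ∷ (var 1F ≈ ‵ + 0 by z 1F) ∷ (var 2F ≈ ‵ + 0 by z 2F) ∷ (var 3F ≈ ‵ + 0 by z 3F)
           ∷ (var 4F ≈ ‵ + 2 by maxₐ z 0<a₄) ∷ known

    -- By `oblique`, `a` is a multiple s of (-6,0,0,0,1), and s is at most 1/3 because x₁ starts at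
    -- 2. So the third step is (6s,2,2,2,-s), and no extra row cancels on it.
    slanted : 0r < a 4F → a 0F < 0r → ⊥
    slanted 0<a₄ a₀<0 = refute ρ ((var 6F ≈ ‵ + 0 by vertical elᶜ (nonzero ρ (var 9F) more)
        (λ { 0F → nonzero ρ (rows 0F C) more
           ; 1F → nonzero ρ (rows 1F C) more
           ; 2F → nonzero ρ (rows 2F C) more
           ; 3F → nonzero ρ (rows 3F C) more }) 1F) ∷ more)
      where
      signs : List (Fact ρ)
      signs = (‵ + 0 ≺ var 4F by 0<a₄) ∷ (var 0F ≺ ‵ + 0 by a₀<0) ∷ known
      z = oblique elₐ (nonzero ρ (var 0F) signs) (pos⇒≢0 0<a₄)
            (nonzero ρ (rows 0F A) signs)
      more : List (Fact ρ)
      more = (var 1F ≈ ‵ + 0 by proj₁ z) ∷ (var 2F ≈ ‵ + 0 by proj₁ (proj₂ z)) ∷ (var 3F ≈ ‵ + 0 by proj₁ (proj₂ (proj₂ z)))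
           ∷ (rows 1F A ≈ ‵ + 0 by proj₂ (proj₂ (proj₂ z))) ∷ signs

    impossible : ⊥
    impossible = decide (zero-or-pos (a≥0 4F λ ())) (≤-or-> 0r (a 0F))
      where
      decide : (a 4F ≡ 0r) ⊎ (0r < a 4F) → (0r ≤ a 0F) ⊎ (a 0F < 0r) → ⊥
      decide (inj₁ p) _        = Flat.impossible p
      decide (inj₂ p) (inj₁ q) = upright p q
      decide (inj₂ p) (inj₂ q) = slanted p q

  turned-once : ∀ {c} → Elementary c → c 0F ≡ fromℤ (+ 0) → c 1F ≡ fromℤ (+ 2) → c 2F ≡ fromℤ (+ 2) → c 3F ≡ fromℤ (+ 2) → c 4F ≡ fromℤ (+ 0) → ⊥
  turned-once {c} el c₀ c₁ c₂ c₃ c₄ = refute (tabulate c) ((var 2F ≈ ‵ + 0 by along-axis 1F el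
          (nonzero (tabulate c) (var 1F) facts)
          (λ { 0F _ → nonzero (tabulate c) (rows 0F var) facts
             ; 1F n → ⊥-elim (n refl)
             ; 2F _ → nonzero (tabulate c) (rows 2F var) facts
             ; 3F _ → nonzero (tabulate c) (rows 3F var) facts }) 2F (λ ())) ∷ facts)
    where
    facts : List (Fact (tabulate c))
    facts = (var 0F ≈ ‵ + 0 by c₀) ∷ (var 1F ≈ ‵ + 2 by c₁) ∷ (var 2F ≈ ‵ + 2 by c₂) ∷ (var 3F ≈ ‵ + 2 by c₃) ∷ (var 4F ≈ ‵ + 0 by c₄) ∷ []

  -- With nonnegative xⱼ, w < 0 makes every w - xⱼ negative, so the vertical axis is an admissible
  -- test vector.
  falling : ∀ {c} → Elementary c → (∀ i → 0r ≤ c (horizontal i)) → c 0F + c 1F + c 2F + c 3F + fromℤ (+ 6) * c 4F < 0r →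
            c 4F < 0r × (∀ i → c (horizontal i) ≡ 0r)
  falling {c} el nn neg = c₄<0 , vertical el (nonzero ρ (var 4F) known)
      (λ { 0F → nonzero ρ (rows 0F var) known
         ; 1F → nonzero ρ (rows 1F var) known
         ; 2F → nonzero ρ (rows 2F var) known
         ; 3F → nonzero ρ (rows 3F var) known })
    where
    ρ = tabulate c
    known : List (Fact ρ)
    known = (‵ + 0 ≼ var 0F by nn 0F) ∷ (‵ + 0 ≼ var 1F by nn 1F) ∷ (‵ + 0 ≼ var 2F by nn 2F) ∷ (‵ + 0 ≼ var 3F by nn 3F)
          ∷ (var 0F ⊕ var 1F ⊕ var 2F ⊕ var 3F ⊕ + 6 ⊛ var 4F ≺ ‵ + 0 by neg) ∷ []
    c₄<0 = linear-< ρ (var 4F) (‵ + 0) known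
  -- The transposition of the first and the `i`-th coordinate, as a table so that its laws are
  -- decided by evaluation. Together with the matching permutation of the rows it reduces a first
  -- step along any xᵢ to one along x₁.
  exchange : Fin 4 → Fin 5 → Fin 5
  exchange i = lookup (lookup ((0F ∷ 1F ∷ 2F ∷ 3F ∷ 4F ∷ [])
    ∷ (1F ∷ 0F ∷ 2F ∷ 3F ∷ 4F ∷ [])
    ∷ (2F ∷ 1F ∷ 0F ∷ 3F ∷ 4F ∷ [])
    ∷ (3F ∷ 1F ∷ 2F ∷ 0F ∷ 4F ∷ []) ∷ []) i)

  exchangeRow : Fin 4 → Fin 4 → Fin 4
  exchangeRow i = lookup (lookup ((0F ∷ 1F ∷ 2F ∷ 3F ∷ [])
    ∷ (1F ∷ 0F ∷ 2F ∷ 3F ∷ [])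
    ∷ (2F ∷ 1F ∷ 0F ∷ 3F ∷ [])
    ∷ (3F ∷ 1F ∷ 2F ∷ 0F ∷ []) ∷ []) i)

  exchange-involutive : ∀ i j → exchange i (exchange i j) ≡ j
  exchange-involutive = from-yes (Finₚ.all? λ i → Finₚ.all? λ j → exchange i (exchange i j) Finₚ.≟ j)

  exchangeRow-involutive : ∀ i l → exchangeRow i (exchangeRow i l) ≡ l
  exchangeRow-involutive = from-yes (Finₚ.all? λ i → Finₚ.all? λ l → exchangeRow i (exchangeRow i l) Finₚ.≟ l)

  exchanged : ∀ i → Fin 5 → Lin 5
  exchanged i j = var (exchange i j)

  row-exchange : ∀ i l (x : Point) → row (extraRows (exchangeRow i l)) (λ j → x (exchange i j)) ≡ row (extraRows l) x
  row-exchange 0F 0F x = linear-≡ (tabulate x) (rows 0F (exchanged 0F)) (rows 0F var) []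
  row-exchange 0F 1F x = linear-≡ (tabulate x) (rows 1F (exchanged 0F)) (rows 1F var) []
  row-exchange 0F 2F x = linear-≡ (tabulate x) (rows 2F (exchanged 0F)) (rows 2F var) []
  row-exchange 0F 3F x = linear-≡ (tabulate x) (rows 3F (exchanged 0F)) (rows 3F var) []
  row-exchange 1F 0F x = linear-≡ (tabulate x) (rows 1F (exchanged 1F)) (rows 0F var) []
  row-exchange 1F 1F x = linear-≡ (tabulate x) (rows 0F (exchanged 1F)) (rows 1F var) []
  row-exchange 1F 2F x = linear-≡ (tabulate x) (rows 2F (exchanged 1F)) (rows 2F var) []
  row-exchange 1F 3F x = linear-≡ (tabulate x) (rows 3F (exchanged 1F)) (rows 3F var) []
  row-exchange 2F 0F x = linear-≡ (tabulate x) (rows 2F (exchanged 2F)) (rows 0F var) []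
  row-exchange 2F 1F x = linear-≡ (tabulate x) (rows 1F (exchanged 2F)) (rows 1F var) []
  row-exchange 2F 2F x = linear-≡ (tabulate x) (rows 0F (exchanged 2F)) (rows 2F var) []
  row-exchange 2F 3F x = linear-≡ (tabulate x) (rows 3F (exchanged 2F)) (rows 3F var) []
  row-exchange 3F 0F x = linear-≡ (tabulate x) (rows 3F (exchanged 3F)) (rows 0F var) []
  row-exchange 3F 1F x = linear-≡ (tabulate x) (rows 1F (exchanged 3F)) (rows 1F var) []
  row-exchange 3F 2F x = linear-≡ (tabulate x) (rows 2F (exchanged 3F)) (rows 2F var) []
  row-exchange 3F 3F x = linear-≡ (tabulate x) (rows 0F (exchanged 3F)) (rows 3F var) []

  -- The test vector is permuted by the same transposition, which is an involution, so supports on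
  -- coordinates and on extra rows correspond.
  Elementary-exchange : ∀ i {a} → Elementary a → Elementary (λ j → a (exchange i j))
  Elementary-exchange i {a} el z z≢0 coords extras =
      (λ j p → proj₁ vanish (π j) (trans (cong z (ππ j)) p)) ,
      (λ l p → trans (sym (cong (λ k → row (extraRows k) (λ j → a (π j))) (exchangeRow-involutive i l)))
        (trans (row-exchange i (exchangeRow i l) a) (proj₂ vanish (exchangeRow i l)
          (form-exchange (exchangeRow i l) (trans (cong (λ k → Eℤ k z) (exchangeRow-involutive i l)) p)))))
    where
    π  = exchange i
    ππ = exchange-involutive i
    form-exchange : ∀ l → Eℤ (exchangeRow i l) z ≡ + 0 → Eℤ l (λ j → z (π j)) ≡ + 0
    form-exchange l p = fromℤ-≡0 _ (trans (sym (row-fromℤ (extraRows l) (λ j → z (π j))))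
      (trans (sym (row-exchange i l (λ j → fromℤ (z (π j)))))
        (trans (row-cong (extraRows (exchangeRow i l)) (λ j → cong (λ k → fromℤ (z k)) (ππ j)))
          (trans (row-fromℤ (extraRows (exchangeRow i l)) z) (cong fromℤ p)))))
    coords′ : ∀ j → z (π j) ≡ + 0 ⊎ a j ≢ 0r
    coords′ j = [ inj₁ , (λ q → inj₂ (λ h → q (trans (cong a (ππ j)) h))) ]′ (coords (π j))
    extras′ : ∀ l → Eℤ l (λ j → z (π j)) ≡ + 0 ⊎ row (extraRows l) a ≢ 0r
    extras′ l = [ (λ p → inj₁ (form-exchange l p)) , (λ q → inj₂ (λ h → q (trans (row-exchange i l a) h))) ]′ (extras (exchangeRow i l))
    vanish = el (λ j → z (π j)) (λ h → z≢0 (λ j → trans (cong z (sym (ππ j))) (h (π j)))) coords′ extras′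

  axis-multiple : ∀ k {a : Point} → (∀ j → k ≢ j → a j ≡ 0r) → ∀ j → a j ≡ fromℤ (δ k j) * a k
  axis-multiple k {a} off j = decide (k Finₚ.≟ j)
    where
    decide : Dec (k ≡ j) → a j ≡ fromℤ (δ k j) * a k
    decide (yes refl) = sym (trans (cong (λ z → fromℤ z * a k) (δ-diagonal k)) (solve 1 (λ x → con (+ 1) :* x := x) refl (a k)))
    decide (no p)     = trans (off j p) (sym (trans (cong (λ z → fromℤ z * a k) (δ-off-diagonal k j p)) (zeroˡ _)))

  off-vertical : ∀ {a : Point} → (∀ i → a (horizontal i) ≡ 0r) → ∀ j → 4F ≢ j → a j ≡ 0r
  off-vertical p 0F _ = p 0F
  off-vertical p 1F _ = p 1F
  off-vertical p 2F _ = p 2F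
  off-vertical p 3F _ = p 3F
  off-vertical p 4F n = ⊥-elim (n refl)

  on-axis : ∀ {g α} → IsCircuit g → 0r < α → ∀ k → 0r < α * fromℤ (g k) → (∀ j → k ≢ j → α * fromℤ (g j) ≡ 0r) → g ≐ℤ δ k
  on-axis circ 0<α k 0<gk off = direction-unique circ 0<α 0<gk (δ k) k (cong ∣_∣ (δ-diagonal k)) (axis-multiple k off)

  -- Leaving the corner 0 requires a nonnegative circuit, hence an axis; maximality then fixes the
  -- length.
  first-step : ∀ {g α} → IsCircuit g → 0r < α → InP (pt o +[ α ] g) → (∀ β → α < β → ¬ InP (pt o +[ β ] g)) →
               ∃ λ k → g ≐ℤ δ k × α ≡ fromℤ (+ 2)
  first-step {g} {α} circ@(_ , g≢0 , _) 0<α inP maximal = conclude (search (zero-or-pos (nn 0F)) (zero-or-pos (nn 1F)) (zero-or-pos (nn 2F)) (zero-or-pos (nn 3F)) (zero-or-pos (nn 4F)))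
    where
    a = displacement (g , α)
    el = IsCircuit⇒Elementary circ 0<α
    nn : ∀ j → 0r ≤ a j
    nn j = subst (0r ≤_) (+-identityˡ _) (proj₁ (InP⇒InBox (pt o +[ α ] g) inP j))
    Sign : Carrier → Set
    Sign x = (x ≡ 0r) ⊎ (0r < x)
    Axis = ∃ λ k → 0r < a k × (∀ j → k ≢ j → a j ≡ 0r)
    search : Sign (a 0F) → Sign (a 1F) → Sign (a 2F) → Sign (a 3F) → Sign (a 4F) → Axis
    search (inj₂ p) _ _ _ _ = 0F , p , nonneg-axis el nn 0F p
    search _ (inj₂ p) _ _ _ = 1F , p , nonneg-axis el nn 1F p
    search _ _ (inj₂ p) _ _ = 2F , p , nonneg-axis el nn 2F p
    search _ _ _ (inj₂ p) _ = 3F , p , nonneg-axis el nn 3F p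
    search _ _ _ _ (inj₂ p) = 4F , p , off-vertical (nonneg-vertical el nn p)
    search (inj₁ p₀) (inj₁ p₁) (inj₁ p₂) (inj₁ p₃) (inj₁ p₄) = ⊥-elim (g≢0 λ
      { 0F → scaled-zero _ 0<α p₀ ; 1F → scaled-zero _ 0<α p₁ ; 2F → scaled-zero _ 0<α p₂ ; 3F → scaled-zero _ 0<α p₃ ; 4F → scaled-zero _ 0<α p₄ })
    conclude : Axis → ∃ λ k → g ≐ℤ δ k × α ≡ fromℤ (+ 2)
    conclude (k , 0<ak , off) = k , g≐δ , trans (sym (+-identityˡ α)) (maximal-axis {pt o} k (λ _ → ≤-refl , 0≤fromℕ 2) g≐δ inP maximal)
      where g≐δ = on-axis circ 0<α k 0<ak off

  first-displacement : ∀ {g α} k → g ≐ℤ δ k → α ≡ fromℤ (+ 2) → ∀ j → displacement (g , α) j ≡ fromℤ (δ k j) * fromℤ (+ 2)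
  first-displacement k g≐δ refl j = trans (cong (λ z → fromℤ (+ 2) * fromℤ z) (g≐δ j)) (*-comm _ _)

  δ-exchange : ∀ i j → δ (horizontal i) (exchange i j) ≡ δ 0F j
  δ-exchange = from-yes (Finₚ.all? λ i → Finₚ.all? λ j → δ (horizontal i) (exchange i j) ℤ.≟ δ 0F j)

  q-exchange : ∀ i j → q (exchange i j) ≡ q j
  q-exchange = from-yes (Finₚ.all? λ i → Finₚ.all? λ j → q (exchange i j) ℤ.≟ q j)

  exchange-last : ∀ i → exchange i 4F ≡ 4F
  exchange-last = from-yes (Finₚ.all? λ i → exchange i 4F Finₚ.≟ 4F)

  exchange-horizontal : ∀ i k → ∃ λ l → exchange i (horizontal l) ≡ horizontal k
  exchange-horizontal = from-yes (Finₚ.all? λ i → Finₚ.all? λ k → Finₚ.any? λ l → exchange i (horizontal l) Finₚ.≟ horizontal k)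

  module AfterAxis (i : Fin 4) {s₁ : Step} (a₁≡ : ∀ j → displacement s₁ j ≡ fromℤ (δ (horizontal i) j) * fromℤ (+ 2)) where
    π = exchange i

    turned : Step → Point
    turned st j = displacement st (π j)

    a₁-turned : ∀ j → turned s₁ j ≡ fromℤ (δ 0F j) * fromℤ (+ 2)
    a₁-turned j = trans (a₁≡ (π j)) (cong (λ z → fromℤ z * fromℤ (+ 2)) (δ-exchange i j))

    one-more : ∀ {s₂} → Elementary (displacement s₂) → (∀ j → 0r + displacement s₁ j + displacement s₂ j ≡ pt q j) → ⊥
    one-more {s₂} el end = turned-once (Elementary-exchange i el)
        (linear-≡ (ρ 0F) (var 1F) (‵ + 0) ((var 0F ≈ + 1 ⊛ ‵ + 2 by a₁-turned 0F) ∷ (‵ + 0 ⊕ var 0F ⊕ var 1F ≈ ‵ + 2 by end′ 0F) ∷ []))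
        (linear-≡ (ρ 1F) (var 1F) (‵ + 2) ((var 0F ≈ + 0 ⊛ ‵ + 2 by a₁-turned 1F) ∷ (‵ + 0 ⊕ var 0F ⊕ var 1F ≈ ‵ + 2 by end′ 1F) ∷ []))
        (linear-≡ (ρ 2F) (var 1F) (‵ + 2) ((var 0F ≈ + 0 ⊛ ‵ + 2 by a₁-turned 2F) ∷ (‵ + 0 ⊕ var 0F ⊕ var 1F ≈ ‵ + 2 by end′ 2F) ∷ []))
        (linear-≡ (ρ 3F) (var 1F) (‵ + 2) ((var 0F ≈ + 0 ⊛ ‵ + 2 by a₁-turned 3F) ∷ (‵ + 0 ⊕ var 0F ⊕ var 1F ≈ ‵ + 2 by end′ 3F) ∷ []))
        (linear-≡ (ρ 4F) (var 1F) (‵ + 0) ((var 0F ≈ + 0 ⊛ ‵ + 2 by a₁-turned 4F) ∷ (‵ + 0 ⊕ var 0F ⊕ var 1F ≈ ‵ + 0 by end′ 4F) ∷ []))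
      where
      ρ : Fin 5 → Vec Carrier 2
      ρ j = turned s₁ j ∷ turned s₂ j ∷ []
      end′ : ∀ j → 0r + turned s₁ j + turned s₂ j ≡ fromℤ (q j)
      end′ j = trans (end (π j)) (cong fromℤ (q-exchange i j))

    two-more : ∀ {s₂ s₃} → IsCircuit (proj₁ s₂) → 0r < proj₂ s₂ → Elementary (displacement s₃) →
      InP (λ j → 0r + displacement s₁ j) → InP (λ j → 0r + displacement s₁ j + displacement s₂ j) →
      (∀ β → proj₂ s₂ < β → ¬ InP ((λ j → 0r + displacement s₁ j) +[ β ] proj₁ s₂)) →
      (∀ j → 0r + displacement s₁ j + displacement s₂ j + displacement s₃ j ≡ pt q j) → ⊥
    two-more {s₂} {s₃} circ 0<α el₃ in₁ in₂ maximal end = TurnedImpossible.impossible (record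
        { elₐ  = Elementary-exchange i (IsCircuit⇒Elementary circ 0<α)
        ; elᶜ  = Elementary-exchange i el₃
        ; sum₀ = linear-≡ (ρ 0F) (var 1F ⊕ var 2F) (‵ + 0) known₀
        ; sum₁ = linear-≡ (ρ 1F) (var 1F ⊕ var 2F) (‵ + 2) ((var 0F ≈ + 0 ⊛ ‵ + 2 by a₁-turned 1F) ∷ (total ≈ ‵ + 2 by end′ 1F) ∷ [])
        ; sum₂ = linear-≡ (ρ 2F) (var 1F ⊕ var 2F) (‵ + 2) ((var 0F ≈ + 0 ⊛ ‵ + 2 by a₁-turned 2F) ∷ (total ≈ ‵ + 2 by end′ 2F) ∷ [])
        ; sum₃ = linear-≡ (ρ 3F) (var 1F ⊕ var 2F) (‵ + 2) ((var 0F ≈ + 0 ⊛ ‵ + 2 by a₁-turned 3F) ∷ (total ≈ ‵ + 2 by end′ 3F) ∷ [])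
        ; sum₄ = linear-≡ (ρ 4F) (var 1F ⊕ var 2F) (‵ + 0) ((var 0F ≈ + 0 ⊛ ‵ + 2 by a₁-turned 4F) ∷ (total ≈ ‵ + 0 by end′ 4F) ∷ [])
        ; a₀≤0 = linear-≤ (ρ 0F) (var 1F) (‵ + 0) known₀
        ; a₀≥  = linear-≤ (ρ 0F) (‵ -[1+ 1 ]) (var 1F) known₀
        ; a≥0  = λ j j≢0 → linear-≤ (ρ j) (‵ + 0) (var 1F) ((var 0F ≈ + 0 ⊛ ‵ + 2 by off j j≢0) ∷ (‵ + 0 ≼ ‵ + 0 ⊕ var 0F ⊕ var 1F by proj₁ (box j)) ∷ [])
        ; a≤2  = λ j j≢0 → linear-≤ (ρ j) (var 1F) (‵ + 2) ((var 0F ≈ + 0 ⊛ ‵ + 2 by off j j≢0) ∷ (‵ + 0 ⊕ var 0F ⊕ var 1F ≼ ‵ + 2 by proj₂ (box j)) ∷ [])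
        ; maxₐ = vertical-max })
      where
      ρ : Fin 5 → Vec Carrier 3
      ρ j = turned s₁ j ∷ turned s₂ j ∷ turned s₃ j ∷ []
      total : Lin 3
      total = ‵ + 0 ⊕ var 0F ⊕ var 1F ⊕ var 2F
      end′ : ∀ j → 0r + turned s₁ j + turned s₂ j + turned s₃ j ≡ fromℤ (q j)
      end′ j = trans (end (π j)) (cong fromℤ (q-exchange i j))
      box : ∀ j → 0r ≤ 0r + turned s₁ j + turned s₂ j × 0r + turned s₁ j + turned s₂ j ≤ fromℤ (+ 2)
      box j = InP⇒InBox (λ j → 0r + displacement s₁ j + displacement s₂ j) in₂ (π j)
      off : ∀ j → j ≢ 0F → turned s₁ j ≡ fromℤ (+ 0) * fromℤ (+ 2)
      off j j≢0 = trans (a₁-turned j) (cong (λ z → fromℤ z * fromℤ (+ 2)) (δ-off-diagonal 0F j (λ p → j≢0 (sym p))))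
      known₀ : List (Fact (ρ 0F))
      known₀ = (var 0F ≈ + 1 ⊛ ‵ + 2 by a₁-turned 0F) ∷ (total ≈ ‵ + 2 by end′ 0F)
             ∷ (‵ + 0 ≼ ‵ + 0 ⊕ var 0F ⊕ var 1F by proj₁ (box 0F)) ∷ (‵ + 0 ⊕ var 0F ⊕ var 1F ≼ ‵ + 2 by proj₂ (box 0F)) ∷ []
      vertical-max : (∀ k → turned s₂ (horizontal k) ≡ 0r) → 0r < turned s₂ 4F → turned s₂ 4F ≡ fromℤ (+ 2)
      vertical-max zeros 0<t = trans (cong (displacement s₂) (exchange-last i)) (trans
          (cong (λ z → proj₂ s₂ * fromℤ z) (g≐δ 4F))
          (linear-≡ (displacement s₁ 4F ∷ proj₂ s₂ ∷ proj₂ s₂ * fromℤ (+ 1) ∷ []) (var 2F) (‵ + 2)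
            ( (‵ + 0 ⊕ var 0F ⊕ var 1F ≈ ‵ + 2 by maximal-axis {λ j → 0r + displacement s₁ j} {proj₁ s₂} 4F (InP⇒InBox (λ j → 0r + displacement s₁ j) in₁) g≐δ in₂ maximal)
            ∷ (var 0F ≈ + 0 ⊛ ‵ + 2 by trans (a₁≡ 4F) (cong (λ z → fromℤ z * fromℤ (+ 2)) (δ-off-diagonal (horizontal i) 4F horizontal≢4)))
            ∷ (var 2F ≈ var 1F by solve 1 (λ x → x :* con (+ 1) := x) refl (proj₂ s₂)) ∷ [])))
        where
        horizontal≢4 : horizontal i ≢ 4F
        horizontal≢4 = from-yes (Finₚ.all? λ i → ¬? (horizontal i Finₚ.≟ 4F)) i
        horizontal-zero : ∀ k → displacement s₂ (horizontal k) ≡ 0r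
        horizontal-zero k = let (l , p) = exchange-horizontal i k in trans (cong (displacement s₂) (sym p)) (zeros l)
        g≐δ : proj₁ s₂ ≐ℤ δ 4F
        g≐δ = on-axis circ 0<α 4F (subst (λ k → 0r < displacement s₂ k) (exchange-last i) 0<t) (off-vertical horizontal-zero)

  module AfterLift {s₁ : Step} (a₁≡ : ∀ j → displacement s₁ j ≡ fromℤ (δ 4F j) * fromℤ (+ 2)) where
    one-more : ∀ {s₂} → Elementary (displacement s₂) → (∀ j → 0r + displacement s₁ j + displacement s₂ j ≡ pt q j) → ⊥
    one-more {s₂} el end = refute (tabulate c) ((var 0F ≈ ‵ + 0 by proj₂ (falling el nn
          (linear-< (tabulate c) (var 0F ⊕ var 1F ⊕ var 2F ⊕ var 3F ⊕ + 6 ⊛ var 4F) (‵ + 0) facts)) 0F) ∷ facts)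
      where
      c = displacement s₂
      value : ∀ j z w → δ 4F j ≡ z → q j ≡ w → c j ≡ fromℤ w + - (fromℤ z * fromℤ (+ 2))
      value j z w refl refl = trans (solve 2 (λ a c → c := con (+ 0) :+ a :+ c :+ :- a) refl (displacement s₁ j) (c j)) (cong₂ (λ x y → x + - y) (end j) (a₁≡ j))
      facts : List (Fact (tabulate c))
      facts = (var 0F ≈ ‵ + 2 ⊝ + 0 ⊛ ‵ + 2 by value 0F _ _ refl refl) ∷ (var 1F ≈ ‵ + 2 ⊝ + 0 ⊛ ‵ + 2 by value 1F _ _ refl refl)
            ∷ (var 2F ≈ ‵ + 2 ⊝ + 0 ⊛ ‵ + 2 by value 2F _ _ refl refl) ∷ (var 3F ≈ ‵ + 2 ⊝ + 0 ⊛ ‵ + 2 by value 3F _ _ refl refl)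
            ∷ (var 4F ≈ ‵ + 0 ⊝ + 1 ⊛ ‵ + 2 by value 4F _ _ refl refl) ∷ []
      nn : ∀ i → 0r ≤ c (horizontal i)
      nn 0F = linear-≤ (tabulate c) (‵ + 0) (var 0F) facts
      nn 1F = linear-≤ (tabulate c) (‵ + 0) (var 1F) facts
      nn 2F = linear-≤ (tabulate c) (‵ + 0) (var 2F) facts
      nn 3F = linear-≤ (tabulate c) (‵ + 0) (var 3F) facts

    -- In the first four coordinates both remaining steps are nonnegative: the second because the
    -- lift leaves them at 0, the third because they end at the upper bound. So `falling` applies to
    -- whichever step has negative `weight`.
    two-more : ∀ {s₂ s₃} → IsCircuit (proj₁ s₂) → 0r < proj₂ s₂ → IsCircuit (proj₁ s₃) → 0r < proj₂ s₃ →
      InP (λ j → 0r + displacement s₁ j + displacement s₂ j) →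
      (∀ j → 0r + displacement s₁ j + displacement s₂ j + displacement s₃ j ≡ pt q j) →
      proj₁ s₂ ≐ℤ (λ j → ℤ.- δ 4F j) ⊎ proj₁ s₃ ≐ℤ (λ j → ℤ.- δ 4F j)
    two-more {s₂} {s₃} circ₂ 0<α₂ circ₃ 0<α₃ in₂ end = decide (≤-or-> 0r (weight a)) (≤-or-> 0r (weight c))
      where
      a = displacement s₂
      c = displacement s₃
      weight : Point → Carrier
      weight x = x 0F + x 1F + x 2F + x 3F + fromℤ (+ 6) * x 4F
      box = InP⇒InBox (λ j → 0r + displacement s₁ j + displacement s₂ j) in₂
      known : ∀ j → List (Fact (displacement s₁ j ∷ a j ∷ c j ∷ []))
      known j = (‵ + 0 ≼ ‵ + 0 ⊕ var 0F ⊕ var 1F by proj₁ (box j)) ∷ (‵ + 0 ⊕ var 0F ⊕ var 1F ≼ ‵ + 2 by proj₂ (box j)) ∷ []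
      off : ∀ i → displacement s₁ (horizontal i) ≡ fromℤ (+ 0) * fromℤ (+ 2)
      off 0F = a₁≡ 0F
      off 1F = a₁≡ 1F
      off 2F = a₁≡ 2F
      off 3F = a₁≡ 3F
      end-horizontal : ∀ i → 0r + displacement s₁ (horizontal i) + a (horizontal i) + c (horizontal i) ≡ fromℤ (+ 2)
      end-horizontal 0F = end 0F
      end-horizontal 1F = end 1F
      end-horizontal 2F = end 2F
      end-horizontal 3F = end 3F
      nn-a : ∀ i → 0r ≤ a (horizontal i)
      nn-a i = linear-≤ _ (‵ + 0) (var 1F) ((var 0F ≈ + 0 ⊛ ‵ + 2 by off i) ∷ known (horizontal i))
      nn-c : ∀ i → 0r ≤ c (horizontal i)
      nn-c i = linear-≤ _ (‵ + 0) (var 2F) ((‵ + 0 ⊕ var 0F ⊕ var 1F ⊕ var 2F ≈ ‵ + 2 by end-horizontal i) ∷ known (horizontal i))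
      downward : ∀ {st} → IsCircuit (proj₁ st) → 0r < proj₂ st → (∀ i → 0r ≤ displacement st (horizontal i)) → weight (displacement st) < 0r → proj₁ st ≐ℤ (λ j → ℤ.- δ 4F j)
      downward {st} circ 0<α nn neg = direction-unique circ 0<α (<⇒0< d₄<0) (λ j → ℤ.- δ 4F j) 4F refl λ
          { 0F → linear-≡ (x 0F ∷ x 4F ∷ []) (var 0F) (+ 0 ⊛ (‵ + 0 ⊝ var 1F)) ((var 0F ≈ ‵ + 0 by zs 0F) ∷ [])
          ; 1F → linear-≡ (x 1F ∷ x 4F ∷ []) (var 0F) (+ 0 ⊛ (‵ + 0 ⊝ var 1F)) ((var 0F ≈ ‵ + 0 by zs 1F) ∷ [])
          ; 2F → linear-≡ (x 2F ∷ x 4F ∷ []) (var 0F) (+ 0 ⊛ (‵ + 0 ⊝ var 1F)) ((var 0F ≈ ‵ + 0 by zs 2F) ∷ [])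
          ; 3F → linear-≡ (x 3F ∷ x 4F ∷ []) (var 0F) (+ 0 ⊛ (‵ + 0 ⊝ var 1F)) ((var 0F ≈ ‵ + 0 by zs 3F) ∷ [])
          ; 4F → linear-≡ (x 4F ∷ []) (var 0F) (-[1+ 0 ] ⊛ (‵ + 0 ⊝ var 0F)) [] }
        where
        x = displacement st
        down = falling (IsCircuit⇒Elementary circ 0<α) nn neg
        d₄<0 = proj₁ down
        zs = proj₂ down
      balanced : ∀ {x y z w u} → 0r + x + y + z ≡ w → x ≡ u → y + z ≡ w + - u
      balanced {x} {y} {z} p refl = trans (solve 3 (λ x y z → y :+ z := con (+ 0) :+ x :+ y :+ z :+ :- x) refl x y z) (cong (_+ - x) p)
      light : 0r ≤ weight a → 0r ≤ weight c → ⊥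
      light p p′ = refute (tabulate a ++ tabulate c)
        ( (‵ + 0 ≼ var 0F ⊕ var 1F ⊕ var 2F ⊕ var 3F ⊕ + 6 ⊛ var 4F by p) ∷ (‵ + 0 ≼ var 5F ⊕ var 6F ⊕ var 7F ⊕ var 8F ⊕ + 6 ⊛ var 9F by p′)
        ∷ (var 0F ⊕ var 5F ≈ ‵ + 2 ⊝ + 0 ⊛ ‵ + 2 by balanced (end 0F) (a₁≡ 0F)) ∷ (var 1F ⊕ var 6F ≈ ‵ + 2 ⊝ + 0 ⊛ ‵ + 2 by balanced (end 1F) (a₁≡ 1F))
        ∷ (var 2F ⊕ var 7F ≈ ‵ + 2 ⊝ + 0 ⊛ ‵ + 2 by balanced (end 2F) (a₁≡ 2F)) ∷ (var 3F ⊕ var 8F ≈ ‵ + 2 ⊝ + 0 ⊛ ‵ + 2 by balanced (end 3F) (a₁≡ 3F))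
        ∷ (var 4F ⊕ var 9F ≈ ‵ + 0 ⊝ + 1 ⊛ ‵ + 2 by balanced (end 4F) (a₁≡ 4F)) ∷ [])
      decide : (0r ≤ weight a) ⊎ (weight a < 0r) → (0r ≤ weight c) ⊎ (weight c < 0r) →
               proj₁ s₂ ≐ℤ (λ j → ℤ.- δ 4F j) ⊎ proj₁ s₃ ≐ℤ (λ j → ℤ.- δ 4F j)
      decide (inj₂ p) _        = inj₁ (downward circ₂ 0<α₂ nn-a p)
      decide _        (inj₂ p) = inj₂ (downward circ₃ 0<α₃ nn-c p)
      decide (inj₁ p) (inj₁ h) = ⊥-elim (light p h)

  no-maximal-walk : ∀ ws → IsWalk (pt o) (pt q) ws → FeasW (pt o) ws → MaxW (pt o) ws → ¬ (length ws ℕ.≤ 2)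
  no-maximal-walk [] (_ , end) _ _ _ = refute [] ((‵ + 0 ≈ ‵ + 2 by end 0F) ∷ [])
  no-maximal-walk (st ∷ []) ((circ , 0<α) ∷ [] , end) (_ , in₁) (max₁ , _) _ = stuck (first-step circ 0<α in₁ max₁)
    where
    short : ∀ {k} j → displacement st j ≡ fromℤ (δ k j) * fromℤ (+ 2) → δ k j ≡ + 0 → q j ≡ + 2 → ⊥
    short j p k≢j qj = refute (displacement st j ∷ []) ((var 0F ≈ + 0 ⊛ ‵ + 2 by trans p (cong (λ z → fromℤ z * fromℤ (+ 2)) k≢j))
                                          ∷ (‵ + 0 ⊕ var 0F ≈ ‵ + 2 by trans (end j) (cong fromℤ qj)) ∷ [])
    stuck : (∃ λ k → proj₁ st ≐ℤ δ k × proj₂ st ≡ fromℤ (+ 2)) → ⊥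
    stuck (0F , g≐δ , α≡2)    = short {0F} 1F (first-displacement 0F g≐δ α≡2 1F) refl refl
    stuck (suc k , g≐δ , α≡2) = short {suc k} 0F (first-displacement (suc k) g≐δ α≡2 0F) refl refl
  no-maximal-walk (st ∷ st′ ∷ []) ((circ , 0<α) ∷ (circ′ , 0<α′) ∷ [] , end) (_ , in₁ , _) (max₁ , _) _ = stuck (first-step circ 0<α in₁ max₁)
    where
    el′ = IsCircuit⇒Elementary circ′ 0<α′
    stuck : (∃ λ k → proj₁ st ≐ℤ δ k × proj₂ st ≡ fromℤ (+ 2)) → ⊥
    stuck (0F , g≐δ , α≡2) = AfterAxis.one-more 0F {st} (first-displacement 0F g≐δ α≡2) {st′} el′ end
    stuck (1F , g≐δ , α≡2) = AfterAxis.one-more 1F {st} (first-displacement 1F g≐δ α≡2) {st′} el′ end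
    stuck (2F , g≐δ , α≡2) = AfterAxis.one-more 2F {st} (first-displacement 2F g≐δ α≡2) {st′} el′ end
    stuck (3F , g≐δ , α≡2) = AfterAxis.one-more 3F {st} (first-displacement 3F g≐δ α≡2) {st′} el′ end
    stuck (4F , g≐δ , α≡2) = AfterLift.one-more {st} (first-displacement 4F g≐δ α≡2) {st′} el′ end
  no-maximal-walk (_ ∷ _ ∷ _ ∷ _) _ _ _ (ℕ.s≤s (ℕ.s≤s ()))

  no-nonbackward-walk : ∀ ws → IsWalk (pt o) (pt q) ws → FeasW (pt o) ws → MaxW (pt o) ws → NonBack ws → ¬ (length ws ℕ.≤ 3)
  no-nonbackward-walk ws@[] walk feas max _ _ = no-maximal-walk ws walk feas max ℕ.z≤n
  no-nonbackward-walk ws@(_ ∷ []) walk feas max _ _ = no-maximal-walk ws walk feas max (ℕ.s≤s ℕ.z≤n)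
  no-nonbackward-walk ws@(_ ∷ _ ∷ []) walk feas max _ _ = no-maximal-walk ws walk feas max (ℕ.s≤s (ℕ.s≤s ℕ.z≤n))
  no-nonbackward-walk (s₁ ∷ s₂ ∷ s₃ ∷ []) ((circ₁ , 0<α₁) ∷ (circ₂ , 0<α₂) ∷ (circ₃ , 0<α₃) ∷ [] , end) (_ , in₁ , in₂ , _) (max₁ , max₂ , _)
      ((_ ∷ s₂≢ ∷ s₃≢ ∷ []) ∷ _) _ = stuck (first-step circ₁ 0<α₁ in₁ max₁)
    where
    el₃ = IsCircuit⇒Elementary circ₃ 0<α₃
    axis : ∀ i → proj₁ s₁ ≐ℤ δ (horizontal i) → proj₂ s₁ ≡ fromℤ (+ 2) → ⊥
    axis i g≐δ α≡2 = AfterAxis.two-more i {s₁} (first-displacement (horizontal i) g≐δ α≡2) {s₂} {s₃} circ₂ 0<α₂ el₃ in₁ in₂ max₂ end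
    stuck : (∃ λ k → proj₁ s₁ ≐ℤ δ k × proj₂ s₁ ≡ fromℤ (+ 2)) → ⊥
    stuck (0F , g≐δ , α≡2) = axis 0F g≐δ α≡2
    stuck (1F , g≐δ , α≡2) = axis 1F g≐δ α≡2
    stuck (2F , g≐δ , α≡2) = axis 2F g≐δ α≡2
    stuck (3F , g≐δ , α≡2) = axis 3F g≐δ α≡2
    stuck (4F , g≐δ , α≡2) = [ (λ p → s₂≢ (λ j → trans (p j) (cong ℤ.-_ (sym (g≐δ j)))))
                              , (λ p → s₃≢ (λ j → trans (p j) (cong ℤ.-_ (sym (g≐δ j))))) ]′
      (AfterLift.two-more {s₁} (first-displacement 4F g≐δ α≡2) {s₂} {s₃} circ₂ 0<α₂ circ₃ 0<α₃ in₂ end)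
  no-nonbackward-walk (_ ∷ _ ∷ _ ∷ _ ∷ _) _ _ _ _ (ℕ.s≤s (ℕ.s≤s (ℕ.s≤s ())))

  fmb>fm : Gap ℝ (f ∷ m ∷ b ∷ []) (f ∷ m ∷ [])
  fmb>fm = P , pt o , pt q , o-vertex , q-vertex , 3 , (real detour , (detour-walk , detour-f ∷ detour-m ∷ []) , ℕₚ.≤-refl) ,
    λ { (ws , (walk , feas ∷ max ∷ nb ∷ []) , len) → no-nonbackward-walk ws walk feas max nb len }

  -- `hop` neither repeats nor reverses a direction, and no feasible maximal walk is as short, so it
  -- settles all of (iv).
  fmb>fb : Gap ℝ (f ∷ m ∷ b ∷ []) (f ∷ b ∷ [])
  fmb>fb = P , pt o , pt q , o-vertex , q-vertex , 2 , (real hop , (hop-walk , hop-f ∷ hop-b ∷ []) , ℕₚ.≤-refl) ,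
    λ { (ws , (walk , feas ∷ max ∷ _) , len) → no-maximal-walk ws walk feas max len }

  fm>f : Gap ℝ (f ∷ m ∷ []) (f ∷ [])
  fm>f = P , pt o , pt q , o-vertex , q-vertex , 2 , (real hop , (hop-walk , hop-f ∷ []) , ℕₚ.≤-refl) ,
    λ { (ws , (walk , feas ∷ max ∷ _) , len) → no-maximal-walk ws walk feas max len }

  fmr>fr : Gap ℝ (f ∷ m ∷ r ∷ []) (f ∷ r ∷ [])
  fmr>fr = P , pt o , pt q , o-vertex , q-vertex , 2 , (real hop , (hop-walk , hop-f ∷ hop-r ∷ []) , ℕₚ.≤-refl) ,
    λ { (ws , (walk , feas ∷ max ∷ _) , len) → no-maximal-walk ws walk feas max len }

-- Vertices with unimodular tight rows: edges, neighbours and edge walks.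

module Frames (ℝ : RealField) (n mB : ℕ) (B : Fin mB → Fin n → ℤ) (d : Fin mB → ℤ) where
  open RealField ℝ hiding (_-_)
  open Integral ℝ n mB B d public
  open ≡-Reasoning

  fromℤ-injective : ∀ {y z} → fromℤ y ≡ fromℤ z → y ≡ z
  fromℤ-injective {y} {z} p = ℤₚ.i-j≡0⇒i≡j y z (fromℤ-≡0 _ (trans (fromℤ-+ y (ℤ.- z))
    (trans (cong₂ _+_ p (fromℤ-neg z)) (-‿inverseʳ _))))

  Near : Point → List IntVec → Set
  Near y = Any (λ w → y ≐ pt w)

  Apart : List IntVec → List IntVec → Set
  Apart L L′ = All (λ v → All (λ w → ¬ (v ≐ℤ w)) L′) L

  apart? : ∀ L L′ → Dec (Apart L L′)
  apart? L L′ = All.all? (λ v → All.all? (λ w → ¬? (v ≐ℤ? w)) L′) L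

  pt-clash : ∀ {y v L} → y ≐ pt v → All (λ w → ¬ (v ≐ℤ w)) L → ¬ Near y L
  pt-clash p (ap ∷ _)  (here q)  = ap (λ j → fromℤ-injective (trans (sym (p j)) (q j)))
  pt-clash p (_ ∷ aps) (there q) = pt-clash p aps q

  clash : ∀ {y L L′} → Apart L L′ → Near y L → ¬ Near y L′
  clash (aps ∷ _) (here p)  near′ = pt-clash p aps near′
  clash (_ ∷ aps) (there q) near′ = clash aps q near′

  -- Each intermediate vertex is named, so that adjacency is proved between fixed integer vectors
  -- and then moved to the computed points.
  EdgeChain : IntVec → List IntStep → Set
  EdgeChain v []             = ⊤
  EdgeChain v ((g , k) ∷ ws) = Σ IntVec λ w → (∀ j → move v (g , k) j ≡ w j) × Adjacent (pt v) (pt w) × EdgeChain w ws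

  edgeW : ∀ v ws → EdgeChain v ws → EdgeW (pt v) (real ws)
  edgeW v ws = go v ws (λ _ → refl)
    where
    go : ∀ {y} v ws → y ≐ pt v → EdgeChain v ws → EdgeW y (real ws)
    go v []             p _                     = tt
    go v ((g , k) ∷ ws) p (w , next , adj , rest) = Adjacent-resp (≐-sym p) (≐-sym reached) adj , go w ws reached rest
      where reached = ≐-trans (move-pt v g k p) (λ j → cong fromℤ (next j))

  -- A certificate against adjacency: `x` and `y` complete a feasible parallelogram with diagonal
  -- from `v` to `w`, and the form `a`, equal at `v` and `w`, shows that `x` is off their line.
  Crossing : IntVec → IntVec → IntVec → IntVec → (Fin n → ℤ) → Set
  Crossing v w x y a = Feasibleℤ x × Feasibleℤ y × (∀ j → x j ℤ.+ y j ≡ v j ℤ.+ w j) ×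
    Σℤ (λ j → a j ℤ.* v j) ≡ Σℤ (λ j → a j ℤ.* w j) × Σℤ (λ j → a j ℤ.* x j) ≢ Σℤ (λ j → a j ℤ.* v j)

  crossing? : ∀ v w x y a → Dec (Crossing v w x y a)
  crossing? v w x y a = feasibleℤ? x ×-dec feasibleℤ? y ×-dec Finₚ.all? (λ j → x j ℤ.+ y j ℤ.≟ v j ℤ.+ w j) ×-dec
    (Σℤ (λ j → a j ℤ.* v j) ℤ.≟ Σℤ (λ j → a j ℤ.* w j)) ×-dec ¬? (Σℤ (λ j → a j ℤ.* x j) ℤ.≟ Σℤ (λ j → a j ℤ.* v j))

  not-adjacent : ∀ v w x y a → Crossing v w x y a → ¬ Adjacent (pt v) (pt w)
  not-adjacent v w x y a (x∈ , y∈ , mid , av≡aw , ax≢av) adj = ax≢av (fromℤ-injective (begin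
      fromℤ (form x) ≡⟨ row-fromℤ a x ⟨
      row a (pt x) ≡⟨ row-cong a (proj₂ on) ⟩
      row a (comb t (pt v) (pt w)) ≡⟨ row-lin a t (1r + - t) (pt v) (pt w) ⟩
      t * row a (pt v) + (1r + - t) * row a (pt w) ≡⟨ cong₂ (λ p q → t * p + (1r + - t) * q) (row-fromℤ a v) (trans (row-fromℤ a w) (cong fromℤ (sym av≡aw))) ⟩
      t * fromℤ (form v) + (1r + - t) * fromℤ (form v) ≡⟨ solve 3 (λ o t v → t :* v :+ (o :+ :- t) :* v := o :* v) refl 1r t (fromℤ (form v)) ⟩
      1r * fromℤ (form v) ≡⟨ *-identityˡ _ ⟩
      fromℤ (form v) ∎))
    where
    form : IntVec → ℤ
    form z = Σℤ (λ j → a j ℤ.* z j)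
    on = adjacent-midpoint adj (pt-InP x x∈) (pt-InP y y∈) (λ j → trans (sym (fromℤ-+ (x j) (y j))) (trans (cong fromℤ (mid j)) (fromℤ-+ (v j) (w j))))
    t = proj₁ on

  -- Every point is v plus the combination of the directions weighted by its slacks in the tight rows.
  record Frame (v : IntVec) : Set where
    constructor frame
    field
      tightRow  : Fin n → Fin mB
      direction : Fin n → IntVec

    -- The last two clauses say that the directions form minus the inverse of the tight submatrix,
    -- once for each order of multiplication.
    IsFrame : Set
    IsFrame = Feasibleℤ v × (∀ i → (Bℤ· v) (tightRow i) ≡ d (tightRow i)) ×
      (∀ j k → Σℤ (λ i → direction i j ℤ.* B (tightRow i) k) ≡ ℤ.- δ j k) ×
      (∀ i k → (Bℤ· direction i) (tightRow k) ≡ ℤ.- δ i k)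

    isFrame? : Dec IsFrame
    isFrame? = feasibleℤ? v ×-dec Finₚ.all? (λ i → (Bℤ· v) (tightRow i) ℤ.≟ d (tightRow i)) ×-dec
      Finₚ.all? (λ j → Finₚ.all? λ k → Σℤ (λ i → direction i j ℤ.* B (tightRow i) k) ℤ.≟ ℤ.- δ j k) ×-dec
      Finₚ.all? (λ i → Finₚ.all? λ k → (Bℤ· direction i) (tightRow k) ℤ.≟ ℤ.- δ i k)

  module At {v : IntVec} (F : Frame v) (ok : Frame.IsFrame F) where
    open Frame F
    feasible = proj₁ ok
    tight    = proj₁ (proj₂ ok)
    inverse  = proj₁ (proj₂ (proj₂ ok))
    dual     = proj₂ (proj₂ (proj₂ ok))

    rowAt : Fin n → Point → Carrier
    rowAt i = row (B (tightRow i))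

    rowAt-v : ∀ i → rowAt i (pt v) ≡ fromℤ (d (tightRow i))
    rowAt-v i = trans (row-fromℤ (B (tightRow i)) v) (cong fromℤ (tight i))

    coordinate : ∀ z j → z j ≡ Σr (λ i → fromℤ (direction i j) * - rowAt i z)
    coordinate z j = sym (begin
      Σr (λ i → fromℤ (direction i j) * - rowAt i z)
        ≡⟨ Σr-cong (λ i → trans (solve 2 (λ x y → x :* :- y := :- x :* y) refl (fromℤ (direction i j)) (rowAt i z))
             (sym (Σr-* {n} (- fromℤ (direction i j)) (λ k → fromℤ (B (tightRow i) k) * z k)))) ⟩
      Σr (λ i → Σr (λ k → - fromℤ (direction i j) * (fromℤ (B (tightRow i) k) * z k)))
        ≡⟨ Σr-swap (λ i k → - fromℤ (direction i j) * (fromℤ (B (tightRow i) k) * z k)) ⟩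
      Σr (λ k → Σr (λ i → - fromℤ (direction i j) * (fromℤ (B (tightRow i) k) * z k)))
        ≡⟨ Σr-cong column ⟩
      Σr (λ k → fromℤ (δ j k) * z k)
        ≡⟨ Σr-δ j z ⟩
      z j ∎)
      where
      column : ∀ k → Σr (λ i → - fromℤ (direction i j) * (fromℤ (B (tightRow i) k) * z k)) ≡ fromℤ (δ j k) * z k
      column k = begin
        Σr (λ i → - fromℤ (direction i j) * (fromℤ (B (tightRow i) k) * z k))
          ≡⟨ Σr-cong (λ i → trans (solve 3 (λ x y z → :- x :* (y :* z) := :- z :* (x :* y)) refl (fromℤ (direction i j)) (fromℤ (B (tightRow i) k)) (z k))
               (cong (- z k *_) (sym (fromℤ-* (direction i j) (B (tightRow i) k))))) ⟩
        Σr (λ i → - z k * fromℤ (direction i j ℤ.* B (tightRow i) k)) ≡⟨ Σr-* {n} (- z k) _ ⟩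
        - z k * Σr (λ i → fromℤ (direction i j ℤ.* B (tightRow i) k)) ≡⟨ cong (- z k *_) (trans (Σr-fromℤ {n} _) (trans (cong fromℤ (inverse j k)) (fromℤ-neg (δ j k)))) ⟩
        - z k * - fromℤ (δ j k) ≡⟨ solve 2 (λ z x → :- z :* :- x := x :* z) refl (z k) (fromℤ (δ j k)) ⟩
        fromℤ (δ j k) * z k ∎

    slack : Fin n → Point → Carrier
    slack i z = fromℤ (d (tightRow i)) + - rowAt i z

    slack-≥0 : ∀ {z} → InP z → ∀ i → 0r ≤ slack i z
    slack-≥0 z∈ i = ≤⇒0≤ (InP-rows z∈ (tightRow i))

    expand : ∀ z j → z j ≡ fromℤ (v j) + Σr (λ i → fromℤ (direction i j) * slack i z)
    expand z j = begin
      z j ≡⟨ solve 2 (λ z v → z := v :+ (z :+ :- v)) refl (z j) (fromℤ (v j)) ⟩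
      fromℤ (v j) + (z j + - fromℤ (v j)) ≡⟨ cong (λ u → fromℤ (v j) + u) (coordinate (λ i → z i + - pt v i) j) ⟩
      fromℤ (v j) + Σr (λ i → fromℤ (direction i j) * - rowAt i (λ k → z k + - pt v k))
        ≡⟨ cong (λ u → fromℤ (v j) + u) (Σr-cong (λ i → cong (fromℤ (direction i j) *_) (begin
             - rowAt i (λ k → z k + - pt v k) ≡⟨ cong -_ (row-sub (B (tightRow i)) z (pt v)) ⟩
             - (rowAt i z + - rowAt i (pt v)) ≡⟨ solve 2 (λ x y → :- (x :+ :- y) := y :+ :- x) refl (rowAt i z) (rowAt i (pt v)) ⟩
             rowAt i (pt v) + - rowAt i z     ≡⟨ cong (_+ - rowAt i z) (rowAt-v i) ⟩
             slack i z ∎))) ⟩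
      fromℤ (v j) + Σr (λ i → fromℤ (direction i j) * slack i z) ∎

    no-slack : ∀ {z} → (∀ i → slack i z ≡ 0r) → z ≐ pt v
    no-slack {z} p j = trans (expand z j) (trans (cong (λ u → fromℤ (v j) + u)
      (Σr-zeros {n} (λ i → trans (cong (fromℤ (direction i j) *_) (p i)) (zeroʳ _)))) (+-identityʳ _))

    vertex : IsVertex (pt v)
    vertex = pt-InP v feasible , λ x y t x∈ y∈ 0<t t<1 v≐ →
      no-slack (λ i → gap (proj₁ (weighted-max 0<t t<1 (InP-rows x∈ (tightRow i)) (InP-rows y∈ (tightRow i)) (level x y t v≐ i)))) ,
      no-slack (λ i → gap (proj₂ (weighted-max 0<t t<1 (InP-rows x∈ (tightRow i)) (InP-rows y∈ (tightRow i)) (level x y t v≐ i))))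
      where
      gap : ∀ {i z} → rowAt i z ≡ fromℤ (d (tightRow i)) → slack i z ≡ 0r
      gap {i} p = trans (cong (λ u → fromℤ (d (tightRow i)) + - u) p) (-‿inverseʳ _)
      level : ∀ x y t → pt v ≐ comb t x y → ∀ i → t * rowAt i x + (1r + - t) * rowAt i y ≡ fromℤ (d (tightRow i))
      level x y t v≐ i = trans (sym (row-lin (B (tightRow i)) t (1r + - t) x y)) (trans (sym (row-cong (B (tightRow i)) v≐)) (rowAt-v i))

    isolate : ∀ i₀ (x : Fin n → Carrier) → (∀ i → i₀ ≢ i → x i ≡ 0r) → Σr x ≡ x i₀
    isolate i₀ x off = trans (Σr-cong (λ i → keep i (i₀ Finₚ.≟ i))) (Σr-δ i₀ x)
      where
      keep : ∀ i → Dec (i₀ ≡ i) → x i ≡ fromℤ (δ i₀ i) * x i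
      keep i (yes refl) = sym (trans (cong (λ z → fromℤ z * x i) (δ-diagonal i)) (solve 1 (λ x → con (+ 1) :* x := x) refl (x i)))
      keep i (no p)     = trans (off i p) (sym (trans (cong (fromℤ (δ i₀ i) *_) (off i p)) (zeroʳ _)))

    -- All tight rows except `i₀` vanish on the direction, hence on any vector of no larger support;
    -- such a vector is then a multiple of the direction, by `coordinate`.
    circuit : ∀ i j₀ → ∣ direction i j₀ ∣ ≡ 1 → IsCircuit (direction i)
    circuit i₀ j₀ unit = (λ ()) , (λ p → ℕₚ.1+n≢0 (trans (sym unit) (cong ∣_∣ (p j₀)))) , minimal ,
        λ k k∣u → ∣.∣1⇒≡1 (subst (k ∣.∣_) unit (k∣u j₀))
      where
      minimal : ∀ z → (∀ l → (A· z) l ≡ 0r) → ¬ (∀ i → z i ≡ 0r) → (∀ l → (B· z) l ≢ 0r → (Bℤ· direction i₀) l ≢ + 0) →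
                (∀ l → (Bℤ· direction i₀) l ≢ + 0 → (B· z) l ≢ 0r)
      minimal z _ z≢0 smaller l p q = p (fromℤ-≡0 _ (*-zero-product τ _ (trans (sym multiple) q) τ≢0))
        where
        τ = - rowAt i₀ z
        rows-vanish : ∀ i → i₀ ≢ i → rowAt i z ≡ 0r
        rows-vanish i i₀≢i = decidable-stable (rowAt i z ≟ 0r) (λ h → smaller (tightRow i) h
          (trans (dual i₀ i) (cong ℤ.-_ (δ-off-diagonal i₀ i i₀≢i))))
        on-line : ∀ j → z j ≡ τ * fromℤ (direction i₀ j)
        on-line j = trans (coordinate z j) (trans (isolate i₀ (λ i → fromℤ (direction i j) * - rowAt i z)
          (λ i i₀≢i → trans (cong (λ u → fromℤ (direction i j) * - u) (rows-vanish i i₀≢i)) (trans (cong (fromℤ (direction i j) *_) -0≡0) (zeroʳ _))))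
          (*-comm _ _))
        multiple : (B· z) l ≡ τ * fromℤ ((Bℤ· direction i₀) l)
        multiple = trans (row-cong (B l) on-line) (row-scaled (B l) τ (direction i₀))
        τ≢0 : τ ≢ 0r
        τ≢0 h = z≢0 (λ j → trans (on-line j) (trans (cong (_* fromℤ (direction i₀ j)) h) (zeroˡ _)))

    along : ∀ i₀ {z} → (∀ i → i₀ ≢ i → slack i z ≡ 0r) → z ≐ (pt v +[ slack i₀ z ] direction i₀)
    along i₀ {z} off j = trans (expand z j) (cong (λ u → fromℤ (v j) + u)
      (trans (isolate i₀ (λ i → fromℤ (direction i j) * slack i z) (λ i i₀≢i → trans (cong (fromℤ (direction i j) *_) (off i i₀≢i)) (zeroʳ _))) (*-comm _ _)))

    tip : Fin n → ℕ → IntVec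
    tip i k = move v (direction i , k)

    tip-pt : ∀ i k → (pt v +[ fromℕ k ] direction i) ≐ pt (tip i k)
    tip-pt i k = move-pt v (direction i) k (λ _ → refl)

    Stop : Fin n → ℕ → Set
    Stop i k = 1 ℕ.≤ k × Feasibleℤ (tip i k) × Blocked (direction i) (tip i k)

    stop? : ∀ i k → Dec (Stop i k)
    stop? i k = (1 ℕ.≤? k) ×-dec feasibleℤ? (tip i k) ×-dec Finₚ.any? (λ l → (+ 0 ℤ.<? (Bℤ· direction i) l) ×-dec (d l ℤ.≤? (Bℤ· tip i k) l))

    not-beyond : ∀ i k → Stop i k → ∀ {z} → InP z → (∀ i′ → i ≢ i′ → slack i′ z ≡ 0r) → slack i z ≤ fromℕ k
    not-beyond i k (_ , _ , blocked) z∈ off = ≮⇒≥ λ p → blocked-step (tip-pt i k) blocked p (InP-resp (along i off) z∈)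

    step-InP : ∀ i {t} → (∀ l → (Bℤ· direction i) l ℤ.≤ + 0) → 0r < t → InP (pt v +[ t ] direction i)
    step-InP i {t} ray 0<t = rows-InP (λ l → ≤-trans (row-≥-step (direction i) l 0<t (ray l)) (InP-rows (pt-InP v feasible) l))

    -- The exposing functional is the sum of the tight rows other than `i₀`. Its maximisers have
    -- slack only in row `i₀`, so they lie on the ray from `v`, which `Stop` cuts off at the tip.
    edge : ∀ i k → Stop i k → IsVertex (pt (tip i k)) → ∃ (λ j → v j ≢ tip i k j) → Adjacent (pt v) (pt (tip i k))
    edge i₀ k@(suc k′) stop vertex-tip (j₀ , v≢tip) = vertex , vertex-tip , (λ p → v≢tip (fromℤ-injective (p j₀))) , c , c-max , c-eq , face
      where
      weight : Fin n → ℤ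
      weight i = + 1 ℤ.+ ℤ.- δ i₀ i
      weight-0 : weight i₀ ≡ + 0
      weight-0 = cong (λ z → + 1 ℤ.+ ℤ.- z) (δ-diagonal i₀)
      weight-1 : ∀ i → i₀ ≢ i → weight i ≡ + 1
      weight-1 i p = cong (λ z → + 1 ℤ.+ ℤ.- z) (δ-off-diagonal i₀ i p)
      0≤weight : ∀ i → 0r ≤ fromℤ (weight i)
      0≤weight i = decide (i₀ Finₚ.≟ i)
        where
        decide : Dec (i₀ ≡ i) → 0r ≤ fromℤ (weight i)
        decide (yes refl) = subst (λ z → 0r ≤ fromℤ z) (sym weight-0) ≤-refl
        decide (no p)     = subst (λ z → 0r ≤ fromℤ z) (sym (weight-1 i p)) (0≤fromℕ 1)
      c : Point
      c j = Σr (λ i → fromℤ (weight i) * fromℤ (B (tightRow i) j))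
      value : ∀ z → ⟨ c , z ⟩ ≡ Σr (λ i → fromℤ (weight i) * rowAt i z)
      value z = begin
        Σr (λ j → Σr (λ i → fromℤ (weight i) * fromℤ (B (tightRow i) j)) * z j)
          ≡⟨ Σr-cong (λ j → trans (*-comm _ (z j)) (sym (Σr-* {n} (z j) _))) ⟩
        Σr (λ j → Σr (λ i → z j * (fromℤ (weight i) * fromℤ (B (tightRow i) j))))
          ≡⟨ Σr-swap (λ j i → z j * (fromℤ (weight i) * fromℤ (B (tightRow i) j))) ⟩
        Σr (λ i → Σr (λ j → z j * (fromℤ (weight i) * fromℤ (B (tightRow i) j))))
          ≡⟨ Σr-cong (λ i → trans (Σr-cong (λ j → solve 3 (λ z w b → z :* (w :* b) := w :* (b :* z)) refl (z j) (fromℤ (weight i)) (fromℤ (B (tightRow i) j))))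
               (Σr-* {n} (fromℤ (weight i)) _)) ⟩
        Σr (λ i → fromℤ (weight i) * rowAt i z) ∎
      deficit : ∀ z → ⟨ c , pt v ⟩ + - ⟨ c , z ⟩ ≡ Σr (λ i → fromℤ (weight i) * slack i z)
      deficit z = begin
        ⟨ c , pt v ⟩ + - ⟨ c , z ⟩ ≡⟨ ⟨⟩-sub c (pt v) z ⟨
        ⟨ c , (λ j → pt v j + - z j) ⟩ ≡⟨ value (λ j → pt v j + - z j) ⟩
        Σr (λ i → fromℤ (weight i) * rowAt i (λ j → pt v j + - z j))
          ≡⟨ Σr-cong (λ i → cong (fromℤ (weight i) *_) (trans (row-sub (B (tightRow i)) (pt v) z) (cong (_+ - rowAt i z) (rowAt-v i)))) ⟩
        Σr (λ i → fromℤ (weight i) * slack i z) ∎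
      terms-≥0 : ∀ {z} → InP z → ∀ i → 0r ≤ fromℤ (weight i) * slack i z
      terms-≥0 z∈ i = 0≤-* (0≤weight i) (slack-≥0 z∈ i)
      c-max : ∀ z → InP z → ⟨ c , z ⟩ ≤ ⟨ c , pt v ⟩
      c-max z z∈ = 0≤⇒≤ (subst (0r ≤_) (sym (deficit z)) (Σr-≥0 {n} _ (terms-≥0 z∈)))
      slack-tip : ∀ i → i₀ ≢ i → slack i (pt (tip i₀ k)) ≡ 0r
      slack-tip i p = begin
        fromℤ (d (tightRow i)) + - rowAt i (pt (tip i₀ k))
          ≡⟨ cong (λ u → fromℤ (d (tightRow i)) + - u) (trans (sym (row-cong (B (tightRow i)) (tip-pt i₀ k))) (row-step (B (tightRow i)) (pt v) (fromℕ k) (direction i₀))) ⟩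
        fromℤ (d (tightRow i)) + - (rowAt i (pt v) + fromℕ k * fromℤ ((Bℤ· direction i₀) (tightRow i)))
          ≡⟨ cong₂ (λ x y → fromℤ (d (tightRow i)) + - (x + fromℕ k * fromℤ y)) (rowAt-v i) (trans (dual i₀ i) (cong ℤ.-_ (δ-off-diagonal i₀ i p))) ⟩
        fromℤ (d (tightRow i)) + - (fromℤ (d (tightRow i)) + fromℕ k * 0r)
          ≡⟨ solve 2 (λ x y → x :+ :- (x :+ y :* con (+ 0)) := con (+ 0)) refl (fromℤ (d (tightRow i))) (fromℕ k) ⟩
        0r ∎
      c-eq : ⟨ c , pt (tip i₀ k) ⟩ ≡ ⟨ c , pt v ⟩
      c-eq = trans (solve 2 (λ x y → y := x :+ :- (x :+ :- y)) refl ⟨ c , pt v ⟩ ⟨ c , pt (tip i₀ k) ⟩)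
        (trans (cong (λ u → ⟨ c , pt v ⟩ + - u) (trans (deficit (pt (tip i₀ k))) (Σr-zeros {n} (λ i → vanish i (i₀ Finₚ.≟ i)))))
          (solve 1 (λ x → x :+ :- con (+ 0) := x) refl ⟨ c , pt v ⟩))
        where
        vanish : ∀ i → Dec (i₀ ≡ i) → fromℤ (weight i) * slack i (pt (tip i₀ k)) ≡ 0r
        vanish i (yes refl) = trans (cong (λ z → fromℤ z * slack i (pt (tip i₀ k))) weight-0) (zeroˡ _)
        vanish i (no p)     = trans (cong (fromℤ (weight i) *_) (slack-tip i p)) (zeroʳ _)
      face : ∀ z → InP z → ⟨ c , z ⟩ ≡ ⟨ c , pt v ⟩ → Σ Carrier λ t → 0r ≤ t × t ≤ 1r × z ≐ comb t (pt v) (pt (tip i₀ k))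
      -- `σ` is the slack in row `i₀`, which is `k` at the tip; with `u` the inverse of `k`, the
      -- product `u * σ` is the fraction of the edge covered, and the rest is the weight of `v`.
      face z z∈ h = 1r + - (u * σ) , ≤⇒0≤ uσ≤1 ,
          0≤⇒≤ (subst (0r ≤_) (solve 2 (λ o x → x := o :+ :- (o :+ :- x)) refl 1r (u * σ)) (0≤-* (inj₁ 0<u) (slack-≥0 z∈ i₀))) , on-segment
        where
        off : ∀ i → i₀ ≢ i → slack i z ≡ 0r
        off i p = *-zero-product (fromℤ (weight i)) (slack i z)
          (Σr-≥0-vanish {n} _ (terms-≥0 z∈) (trans (sym (deficit z)) (trans (cong (λ u → ⟨ c , pt v ⟩ + - u) h) (-‿inverseʳ _))) i)
          (subst (λ w → fromℤ w ≢ 0r) (sym (weight-1 i p)) (pos⇒≢0 (0<fromℕ 0)))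
        σ = slack i₀ z
        reciprocal = *-inverse (fromℕ k) (pos⇒≢0 (0<fromℕ k′))
        u = proj₁ reciprocal
        0<u : 0r < u
        0<u = *-cancelˡ-pos (0<fromℕ k′) (subst (0r <_) (trans (sym (proj₂ reciprocal)) (*-comm _ _)) 0<1)
        uσ≤1 : u * σ ≤ 1r
        uσ≤1 = 0≤⇒≤ (subst (0r ≤_) (trans (solve 3 (λ u k σ → u :* (k :+ :- σ) := u :* k :+ :- (u :* σ)) refl u (fromℕ k) σ) (cong (_+ - (u * σ)) (proj₂ reciprocal)))
          (0≤-* (inj₁ 0<u) (≤⇒0≤ (not-beyond i₀ k stop z∈ off))))
        on-segment : z ≐ comb (1r + - (u * σ)) (pt v) (pt (tip i₀ k))
        on-segment j = begin
          z j ≡⟨ along i₀ off j ⟩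
          V + σ * D ≡⟨ trans (cong (λ x → V + x) (sym (*-identityˡ (σ * D)))) (cong₂ (λ x y → x + y * (σ * D)) (sym (*-identityˡ V)) (sym (proj₂ reciprocal))) ⟩
          1r * V + (u * fromℕ k) * (σ * D)
            ≡⟨ solve 6 (λ o V u K σ D → o :* V :+ (u :* K) :* (σ :* D) := (o :+ :- (u :* σ)) :* V :+ (u :* σ) :* (V :+ K :* D)) refl 1r V u (fromℕ k) σ D ⟩
          (1r + - (u * σ)) * V + (u * σ) * (V + fromℕ k * D)
            ≡⟨ cong₂ (λ x y → (1r + - (u * σ)) * V + x * y) (solve 2 (λ o x → x := o :+ :- (o :+ :- x)) refl 1r (u * σ)) (tip-pt i₀ k j) ⟩
          (1r + - (u * σ)) * V + (1r + - (1r + - (u * σ))) * fromℤ (tip i₀ k j) ∎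
          where
          V = fromℤ (v j)
          D = fromℤ (direction i₀ j)

    -- `nothing` marks an unbounded ray, `just k` an edge that ends after `k` steps.
    EndOK : Fin n → Maybe ℕ → Set
    EndOK i nothing  = ∀ l → (Bℤ· direction i) l ℤ.≤ + 0
    EndOK i (just k) = Stop i k

    endOK? : ∀ i end → Dec (EndOK i end)
    endOK? i nothing  = Finₚ.all? (λ l → (Bℤ· direction i) l ℤ.≤? + 0)
    endOK? i (just k) = stop? i k

    slack-step : ∀ i t k → slack k (pt v +[ t ] direction i) ≡ t * fromℤ (δ i k)
    slack-step i t k = begin
      fromℤ (d (tightRow k)) + - rowAt k (pt v +[ t ] direction i)
        ≡⟨ cong (λ u → fromℤ (d (tightRow k)) + - u) (trans (row-step (B (tightRow k)) (pt v) t (direction i))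
             (cong₂ (λ x y → x + t * y) (rowAt-v k) (trans (cong fromℤ (dual i k)) (fromℤ-neg (δ i k))))) ⟩
      fromℤ (d (tightRow k)) + - (fromℤ (d (tightRow k)) + t * - fromℤ (δ i k))
        ≡⟨ solve 3 (λ x t y → x :+ :- (x :+ t :* :- y) := t :* y) refl (fromℤ (d (tightRow k))) t (fromℤ (δ i k)) ⟩
      t * fromℤ (δ i k) ∎

    slack-comb : ∀ t w k → slack k (comb t (pt v) w) ≡ (1r + - t) * slack k w
    slack-comb t w k = begin
      D + - rowAt k (comb t (pt v) w) ≡⟨ cong (λ u → D + - u) (trans (row-lin (B (tightRow k)) t (1r + - t) (pt v) w) (cong (λ u → t * u + (1r + - t) * rowAt k w) (rowAt-v k))) ⟩
      D + - (t * D + (1r + - t) * rowAt k w) ≡⟨ cong (_+ - (t * D + (1r + - t) * rowAt k w)) (sym (*-identityˡ D)) ⟩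
      1r * D + - (t * D + (1r + - t) * rowAt k w) ≡⟨ solve 4 (λ o t D w → o :* D :+ :- (t :* D :+ (o :+ :- t) :* w) := (o :+ :- t) :* (D :+ :- w)) refl 1r t D (rowAt k w) ⟩
      (1r + - t) * (D + - rowAt k w) ∎
      where D = fromℤ (d (tightRow k))

    slack-cong : ∀ k {x y} → x ≐ y → slack k x ≡ slack k y
    slack-cong k p = cong (λ u → fromℤ (d (tightRow k)) + - u) (row-cong (B (tightRow k)) p)

    -- The exposing functional of the edge does not increase in any frame direction, yet it is equal
    -- at `v` and `w`; so it is constant along every direction in which `w` has slack. A step in
    -- such a direction stays on the segment, and comparing slacks leaves one direction.
    module Neighbours (ends : Fin n → Maybe ℕ) (ends-ok : ∀ i → EndOK i (ends i)) {w : Point} (adj : Adjacent (pt v) w) where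
      w∈    = proj₁ (proj₁ (proj₂ adj))
      v≢w   = proj₁ (proj₂ (proj₂ adj))
      c     = proj₁ (proj₂ (proj₂ (proj₂ adj)))
      c-max = proj₁ (proj₂ (proj₂ (proj₂ (proj₂ adj))))
      c-eq  = proj₁ (proj₂ (proj₂ (proj₂ (proj₂ (proj₂ adj)))))
      face  = proj₂ (proj₂ (proj₂ (proj₂ (proj₂ (proj₂ adj)))))

      γ : Fin n → Carrier
      γ i = ⟨ c , pt (direction i) ⟩

      γ≤0 : ∀ i {t} → 0r < t → InP (pt v +[ t ] direction i) → γ i ≤ 0r
      γ≤0 i {t} 0<t inP = ≮⇒≥ λ 0<γ → ≤⇒≯ (c-max _ inP) (subst₂ _<_ (+-identityˡ _)
        (trans (+-comm _ _) (sym (⟨⟩-step c (pt v) t (pt (direction i))))) (+-mono-< ⟨ c , pt v ⟩ (*-pos 0<t 0<γ)))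

      stop-InP : ∀ i k → Stop i k → InP (pt v +[ fromℕ k ] direction i)
      stop-InP i k (_ , tip∈ , _) = InP-resp (≐-sym (tip-pt i k)) (pt-InP (tip i k) tip∈)

      γ≤0′ : ∀ i end → EndOK i end → γ i ≤ 0r
      γ≤0′ i nothing       ray  = γ≤0 i 0<1 (step-InP i ray 0<1)
      γ≤0′ i (just (suc k)) stop = γ≤0 i (0<fromℕ k) (stop-InP i (suc k) stop)
      γ≤0′ i (just zero)    (() , _)

      balance : Σr (λ i → slack i w * γ i) ≡ 0r
      balance = begin
        Σr (λ i → slack i w * γ i)
          ≡⟨ Σr-cong (λ i → sym (Σr-* {n} (slack i w) _)) ⟩
        Σr (λ i → Σr (λ j → slack i w * (c j * fromℤ (direction i j))))
          ≡⟨ Σr-swap (λ i j → slack i w * (c j * fromℤ (direction i j))) ⟩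
        Σr (λ j → Σr (λ i → slack i w * (c j * fromℤ (direction i j))))
          ≡⟨ Σr-cong (λ j → trans (Σr-cong (λ i → solve 3 (λ x c y → x :* (c :* y) := c :* (y :* x)) refl (slack i w) (c j) (fromℤ (direction i j)))) (Σr-* {n} (c j) _)) ⟩
        Σr (λ j → c j * Σr (λ i → fromℤ (direction i j) * slack i w))
          ≡⟨ solve 2 (λ x y → x := (y :+ con (+ 1) :* x) :+ :- y) refl (Σr (λ j → c j * Σr (λ i → fromℤ (direction i j) * slack i w))) ⟨ c , pt v ⟩ ⟩
        (⟨ c , pt v ⟩ + fromℤ (+ 1) * ⟨ c , (λ j → Σr (λ i → fromℤ (direction i j) * slack i w)) ⟩) + - ⟨ c , pt v ⟩
          ≡⟨ cong (_+ - ⟨ c , pt v ⟩) (trans (sym (⟨⟩-step c (pt v) (fromℤ (+ 1)) (λ j → Σr (λ i → fromℤ (direction i j) * slack i w))))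
               (⟨⟩-cong c (λ j → trans (solve 2 (λ x y → x :+ con (+ 1) :* y := x :+ y) refl (fromℤ (v j)) (Σr (λ i → fromℤ (direction i j) * slack i w))) (sym (expand w j))))) ⟩
        ⟨ c , w ⟩ + - ⟨ c , pt v ⟩ ≡⟨ trans (cong (_+ - ⟨ c , pt v ⟩) c-eq) (-‿inverseʳ _) ⟩
        0r ∎

      term-zero : ∀ i → slack i w * γ i ≡ 0r
      term-zero i = trans (solve 1 (λ x → x := :- (:- x)) refl (slack i w * γ i)) (trans (cong -_ (Σr-≥0-vanish {n} (λ i → - (slack i w * γ i))
        (λ i → subst (0r ≤_) (solve 2 (λ s γ → s :* (con (+ 0) :+ :- γ) := :- (s :* γ)) refl (slack i w) (γ i)) (0≤-* (slack-≥0 w∈ i) (≤⇒0≤ (γ≤0′ i (ends i) (ends-ok i)))))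
        (trans (trans (Σr-cong (λ i → solve 1 (λ x → :- x := con (ℤ.- + 1) :* x) refl (slack i w * γ i))) (Σr-* {n} (fromℤ (ℤ.- + 1)) _))
          (trans (cong (fromℤ (ℤ.- + 1) *_) balance) (zeroʳ _))) i)) -0≡0)

      -- The functional also vanishes along a direction in which w has slack, so a step in it stays on the segment.
      module Used (i : Fin n) (s≢0 : slack i w ≢ 0r) where
        γ≡0 : γ i ≡ 0r
        γ≡0 = *-zero-product (slack i w) (γ i) (term-zero i) s≢0

        module Reach {t} (0<t : 0r < t) (inP : InP (pt v +[ t ] direction i)) where
          segment = face _ inP (trans (⟨⟩-step c (pt v) t (pt (direction i))) (trans (cong (λ u → ⟨ c , pt v ⟩ + t * u) γ≡0) (trans (cong (λ u → ⟨ c , pt v ⟩ + u) (zeroʳ t)) (+-identityʳ _))))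
          τ = 1r + - proj₁ segment
          scale : ∀ k → t * fromℤ (δ i k) ≡ τ * slack k w
          scale k = trans (sym (slack-step i t k)) (trans (slack-cong k (proj₂ (proj₂ (proj₂ segment)))) (slack-comb (proj₁ segment) w k))
          t≡ : t ≡ τ * slack i w
          t≡ = trans (solve 1 (λ t → t := t :* con (+ 1)) refl t) (trans (cong (λ z → t * fromℤ z) (sym (δ-diagonal i))) (scale i))
          τ≢0 : τ ≢ 0r
          τ≢0 h = pos⇒≢0 0<t (trans t≡ (trans (cong (_* slack i w) h) (zeroˡ _)))
          off : ∀ k → i ≢ k → slack k w ≡ 0r
          off k p = *-zero-product τ (slack k w) (trans (sym (scale k)) (trans (cong (λ z → t * fromℤ z) (δ-off-diagonal i k p)) (zeroʳ t))) τ≢0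
          t≤slack : t ≤ slack i w
          t≤slack = 0≤⇒≤ (subst (0r ≤_) (trans (solve 2 (λ x s → x :* s := con (+ 1) :* s :+ :- ((con (+ 1) :+ :- x) :* s)) refl (proj₁ segment) (slack i w))
            (trans (cong₂ (λ x y → x * slack i w + - ((y + - proj₁ segment) * slack i w)) (+-identityʳ 1r) (+-identityʳ 1r))
              (cong₂ (λ x y → x + - y) (*-identityˡ _) (sym t≡))))
            (0≤-* (proj₁ (proj₂ segment)) (slack-≥0 w∈ i)))

        conclude : ∀ end → EndOK i end → ∃ λ k → end ≡ just k × w ≐ pt (tip i k)
        -- On a ray a step one longer than the slack of `w` would still lie on the segment, hence
        -- not beyond `w`.
        conclude nothing ray = ⊥-elim (≤⇒≯ (Reach.t≤slack 0<t (step-InP i ray 0<t)) (subst (_< slack i w + 1r) (+-identityʳ _)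
            (subst₂ _<_ (+-comm _ _) (+-comm _ _) (+-mono-< (slack i w) 0<1))))
          where
          0<t : 0r < slack i w + 1r
          0<t = subst (0r <_) (+-comm _ _) (0<-+ 0<1 (slack-≥0 w∈ i))
        conclude (just zero) (() , _)
        conclude (just k@(suc k′)) stop = k , refl , ≐-trans (along i R.off) (≐-trans (λ j → cong (λ u → fromℤ (v j) + u * fromℤ (direction i j))
            (≤-antisym (not-beyond i k stop w∈ R.off) R.t≤slack)) (tip-pt i k))
          where module R = Reach (0<fromℕ k′) (stop-InP i k stop)

      neighbour : ∃ λ i → ∃ λ k → ends i ≡ just k × w ≐ pt (tip i k)
      neighbour = search (Finₚ.any? (λ i → ¬? (slack i w ≟ 0r)))
        where
        search : Dec (∃ λ i → slack i w ≢ 0r) → ∃ λ i → ∃ λ k → ends i ≡ just k × w ≐ pt (tip i k)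
        search (yes (i , s≢0)) = i , Used.conclude i s≢0 (ends i) (ends-ok i)
        search (no none) = ⊥-elim (v≢w (≐-sym (no-slack (λ i → decidable-stable (slack i w ≟ 0r) (λ h → none (i , h))))))

    ListedAt : List IntVec → Fin n → Maybe ℕ → Set
    ListedAt L i nothing  = ⊤
    ListedAt L i (just k) = Any (tip i k ≐ℤ_) L

    listedAt? : ∀ L i end → Dec (ListedAt L i end)
    listedAt? L i nothing  = yes tt
    listedAt? L i (just k) = Any.any? (tip i k ≐ℤ?_) L

    Complete : List IntVec → (Fin n → Maybe ℕ) → Set
    Complete L ends = ∀ i → EndOK i (ends i) × ListedAt L i (ends i)

    complete? : ∀ L ends → Dec (Complete L ends)
    complete? L ends = Finₚ.all? (λ i → endOK? i (ends i) ×-dec listedAt? L i (ends i))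

    -- Turns listing the neighbours of a vertex into a finite check: every frame direction is a ray
    -- or ends at a listed point.
    near : ∀ L ends → Complete L ends → ∀ {y} → Adjacent (pt v) y → Near y L
    near L ends complete {y} adj = conclude (Neighbours.neighbour ends (λ i → proj₁ (complete i)) adj)
      where
      conclude : (∃ λ i → ∃ λ k → ends i ≡ just k × y ≐ pt (tip i k)) → Near y L
      conclude (i , k , end , y≐) = Any.map (λ tip≐ → ≐-trans y≐ (λ j → cong fromℤ (tip≐ j))) (subst (ListedAt L i) end (proj₂ (complete i)))

    EdgeTo : IntVec → Fin n → ℕ → Set
    EdgeTo w i k = (∀ j → tip i k j ≡ w j) × Stop i k × ∃ (λ j → v j ≢ tip i k j)

    edgeTo? : ∀ w i k → Dec (EdgeTo w i k)
    edgeTo? w i k = Finₚ.all? (λ j → tip i k j ℤ.≟ w j) ×-dec stop? i k ×-dec Finₚ.any? (λ j → ¬? (v j ℤ.≟ tip i k j))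

    edge-to : ∀ w i k → IsVertex (pt w) → EdgeTo w i k → Adjacent (pt v) (pt w)
    edge-to w i k vertex-w (tip≡w , stop , differ) = Adjacent-resp (λ _ → refl) tip≐w (edge i k stop (IsVertex-resp (≐-sym tip≐w) vertex-w) differ)
      where
      tip≐w : pt (tip i k) ≐ pt w
      tip≐w j = cong fromℤ (tip≡w j)

-- A heptagon whose shortest edge walk goes back.

module Heptagon (ℝ : RealField) where
  open RealField ℝ hiding (_-_)

  open Frames ℝ 2 7
    (matrix ( (+ 0 ∷ -[1+ 0 ] ∷ [])
            ∷ (+ 1 ∷ + 0 ∷ [])
            ∷ (+ 0 ∷ + 1 ∷ [])
            ∷ (-[1+ 0 ] ∷ + 1 ∷ [])
            ∷ (-[1+ 0 ] ∷ + 0 ∷ [])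
            ∷ (-[1+ 0 ] ∷ -[1+ 0 ] ∷ [])
            ∷ (-[1+ 0 ] ∷ -[1+ 1 ] ∷ []) ∷ []))
    (lookup (+ 0 ∷ + 1 ∷ + 4 ∷ + 6 ∷ + 3 ∷ + 1 ∷ + 0 ∷ []))

  -- The boundary joins `v` and `w` by two arcs: `v`, `p`, `q`, `w` with three edges, and `v`, `p′`,
  -- (-3,2), `q′`, `w` with four.
  v p q w p′ q′ : IntVec
  v = lookup (+ 0 ∷ + 0 ∷ [])
  p = lookup (+ 1 ∷ + 0 ∷ [])
  q = lookup (+ 1 ∷ + 4 ∷ [])
  w = lookup (-[1+ 1 ] ∷ + 4 ∷ [])
  p′ = lookup (-[1+ 1 ] ∷ + 1 ∷ [])
  q′ = lookup (-[1+ 2 ] ∷ + 3 ∷ [])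

  v-frame : Frame v
  v-frame = frame (lookup (0F ∷ 6F ∷ []))
    (matrix ((-[1+ 1 ] ∷ + 1 ∷ []) ∷ (+ 1 ∷ + 0 ∷ []) ∷ []))

  abstract
    v-isFrame : Frame.IsFrame v-frame
    v-isFrame = from-yes (Frame.isFrame? v-frame)

  p-frame : Frame p
  p-frame = frame (lookup (0F ∷ 1F ∷ []))
    (matrix ((+ 0 ∷ + 1 ∷ []) ∷ (-[1+ 0 ] ∷ + 0 ∷ []) ∷ []))

  abstract
    p-isFrame : Frame.IsFrame p-frame
    p-isFrame = from-yes (Frame.isFrame? p-frame)

  q-frame : Frame q
  q-frame = frame (lookup (1F ∷ 2F ∷ []))
    (matrix ((-[1+ 0 ] ∷ + 0 ∷ []) ∷ (+ 0 ∷ -[1+ 0 ] ∷ []) ∷ []))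

  abstract
    q-isFrame : Frame.IsFrame q-frame
    q-isFrame = from-yes (Frame.isFrame? q-frame)

  w-frame : Frame w
  w-frame = frame (lookup (2F ∷ 3F ∷ []))
    (matrix ((-[1+ 0 ] ∷ -[1+ 0 ] ∷ []) ∷ (+ 1 ∷ + 0 ∷ []) ∷ []))

  abstract
    w-isFrame : Frame.IsFrame w-frame
    w-isFrame = from-yes (Frame.isFrame? w-frame)

  east north west : IntVec
  east  = lookup (+ 1 ∷ + 0 ∷ [])
  north = lookup (+ 0 ∷ + 1 ∷ [])
  west  = lookup (-[1+ 0 ] ∷ + 0 ∷ [])

  route : List IntStep
  route = (east , 1) ∷ (north , 4) ∷ (west , 3) ∷ []

  route-walk : IsWalk (pt v) (pt w) (real route)
  route-walk = Reaches⇒IsWalk v w route (from-yes (reaches? v w route))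
    (At.circuit v-frame v-isFrame 1F 0F refl ∷ At.circuit p-frame p-isFrame 0F 1F refl ∷ At.circuit q-frame q-isFrame 0F 0F refl ∷ [])

  route-e : EdgeW (pt v) (real route)
  route-e = edgeW v route
    ( p , (λ { 0F → refl ; 1F → refl }) , At.edge-to v-frame v-isFrame p 1F 1 (At.vertex p-frame p-isFrame) (from-yes (At.edgeTo? v-frame v-isFrame p 1F 1))
    , q , (λ { 0F → refl ; 1F → refl }) , At.edge-to p-frame p-isFrame q 0F 4 (At.vertex q-frame q-isFrame) (from-yes (At.edgeTo? p-frame p-isFrame q 0F 4))
    , w , (λ { 0F → refl ; 1F → refl }) , At.edge-to q-frame q-isFrame w 0F 3 (At.vertex w-frame w-isFrame) (from-yes (At.edgeTo? q-frame q-isFrame w 0F 3)) , tt)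

  route-f : FeasW (pt v) (real route)
  route-f = feasW v route (from-yes (feasWℤ? v route))

  route-m : MaxW (pt v) (real route)
  route-m = maxW v route (from-yes (maxWℤ? v route))

  near-v : ∀ {y} → Adjacent (pt v) y → Near y (p ∷ p′ ∷ [])
  near-v = At.near v-frame v-isFrame _ ends (from-yes (At.complete? v-frame v-isFrame (p ∷ p′ ∷ []) ends))
    where
    ends : Fin 2 → Maybe ℕ
    ends = lookup (just 1 ∷ just 1 ∷ [])

  near-w : ∀ {y} → Adjacent y (pt w) → Near y (q ∷ q′ ∷ [])
  near-w adj = At.near w-frame w-isFrame _ ends (from-yes (At.complete? w-frame w-isFrame (q ∷ q′ ∷ []) ends)) (Adjacent-sym adj)
    where
    ends : Fin 2 → Maybe ℕ
    ends = lookup (just 1 ∷ just 3 ∷ [])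

  -- The neighbours of the two ends leave four pairs of middle vertices. Three of them are not
  -- edges, each refuted by two feasible points with the same midpoint and a form constant on the
  -- supposed edge.
  only-route : ∀ {y₁ y₂} → Adjacent (pt v) y₁ → Adjacent y₁ y₂ → Adjacent y₂ (pt w) → y₁ ≐ pt p × y₂ ≐ pt q
  only-route {y₁} {y₂} adj₁ adj₂ adj₃ = middle (near-v adj₁) (near-w adj₃)
    where
    middle : Near y₁ (p ∷ p′ ∷ []) → Near y₂ (q ∷ q′ ∷ []) → y₁ ≐ pt p × y₂ ≐ pt q
    middle (here at-p) (here at-q) = at-p , at-q
    middle (here at-p) (there (here at-q′)) = ⊥-elim (not-adjacent p q′ x y a (from-yes (crossing? p q′ x y a)) (Adjacent-resp at-p at-q′ adj₂))
      where
      x = lookup (+ 1 ∷ + 1 ∷ [])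
      y = lookup (-[1+ 2 ] ∷ + 2 ∷ [])
      a = lookup (+ 3 ∷ + 4 ∷ [])
    middle (there (here at-p′)) (here at-q) = ⊥-elim (not-adjacent p′ q x y a (from-yes (crossing? p′ q x y a)) (Adjacent-resp at-p′ at-q adj₂))
      where
      x = lookup (-[1+ 1 ] ∷ + 2 ∷ [])
      y = lookup (+ 1 ∷ + 3 ∷ [])
      a = lookup (+ 1 ∷ -[1+ 0 ] ∷ [])
    middle (there (here at-p′)) (there (here at-q′)) = ⊥-elim (not-adjacent p′ q′ x y a (from-yes (crossing? p′ q′ x y a)) (Adjacent-resp at-p′ at-q′ adj₂))
      where
      x = lookup (-[1+ 2 ] ∷ + 2 ∷ [])
      y = lookup (-[1+ 1 ] ∷ + 2 ∷ [])
      a = lookup (+ 2 ∷ + 1 ∷ [])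

  no-nonbackward-walk : ∀ ws → IsWalk (pt v) (pt w) ws → EdgeW (pt v) ws → NonBack ws → ¬ (length ws ℕ.≤ 3)
  no-nonbackward-walk [] (_ , end) _ _ _ = clash (from-yes (apart? (v ∷ []) (w ∷ []))) (here (λ _ → refl)) (here end)
  no-nonbackward-walk (_ ∷ []) (_ , end) (adj , _) _ _ = clash (from-yes (apart? (p ∷ p′ ∷ []) (w ∷ []))) (near-v adj) (here end)
  no-nonbackward-walk (_ ∷ _ ∷ []) (_ , end) (adj , adj′ , _) _ _ =
    clash (from-yes (apart? (p ∷ p′ ∷ []) (q ∷ q′ ∷ []))) (near-v adj) (near-w (Adjacent-resp (λ _ → refl) end adj′))
  no-nonbackward-walk ((g₁ , _) ∷ _ ∷ (g₃ , _) ∷ []) ((circ₁ , 0<α₁) ∷ _ ∷ (circ₃ , 0<α₃) ∷ [] , end) (adj₁ , adj₂ , adj₃ , _) ((_ ∷ _ ∷ s₃≢ ∷ []) ∷ _) _ =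
      s₃≢ (λ j → trans (g₃≐west j) (opposite j))
    where
    places = only-route adj₁ adj₂ (Adjacent-resp (λ _ → refl) end adj₃)
    g₁≐east : g₁ ≐ℤ east
    g₁≐east = direction-between v p east 0F 0 circ₁ 0<α₁ (λ _ → refl) (proj₁ places) refl λ { 0F → refl ; 1F → refl }
    g₃≐west : g₃ ≐ℤ west
    g₃≐west = direction-between q w west 0F 2 circ₃ 0<α₃ (proj₂ places) end refl λ { 0F → refl ; 1F → refl }
    opposite : ∀ j → west j ≡ ℤ.- g₁ j
    opposite 0F = cong ℤ.-_ (sym (g₁≐east 0F))
    opposite 1F = cong ℤ.-_ (sym (g₁≐east 1F))
  no-nonbackward-walk (_ ∷ _ ∷ _ ∷ _ ∷ _) _ _ _ (ℕ.s≤s (ℕ.s≤s (ℕ.s≤s ())))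

  efmb>efm : Gap ℝ (e ∷ f ∷ m ∷ b ∷ []) (e ∷ f ∷ m ∷ [])
  efmb>efm = P , pt v , pt w , At.vertex v-frame v-isFrame , At.vertex w-frame w-isFrame , 3 , (real route , (route-walk , route-e ∷ route-f ∷ route-m ∷ []) , ℕₚ.≤-refl) ,
    λ { (ws , (walk , edges ∷ _ ∷ _ ∷ nb ∷ []) , len) → no-nonbackward-walk ws walk edges nb len }

-- An unbounded polyhedron whose shortest edge walk repeats a direction.

module Decahedron (ℝ : RealField) where
  open RealField ℝ hiding (_-_)

  open Frames ℝ 3 10
    (matrix ( (-[1+ 0 ] ∷ + 0 ∷ + 0 ∷ [])
            ∷ (+ 0 ∷ -[1+ 0 ] ∷ + 0 ∷ [])
            ∷ (-[1+ 0 ] ∷ + 1 ∷ + 0 ∷ [])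
            ∷ (+ 1 ∷ -[1+ 0 ] ∷ + 0 ∷ [])
            ∷ (+ 0 ∷ -[1+ 1 ] ∷ -[1+ 0 ] ∷ [])
            ∷ (-[1+ 0 ] ∷ -[1+ 0 ] ∷ -[1+ 0 ] ∷ [])
            ∷ (-[1+ 1 ] ∷ + 0 ∷ -[1+ 0 ] ∷ [])
            ∷ (-[1+ 1 ] ∷ + 0 ∷ + 1 ∷ [])
            ∷ (-[1+ 0 ] ∷ -[1+ 0 ] ∷ + 1 ∷ [])
            ∷ (+ 0 ∷ -[1+ 1 ] ∷ + 1 ∷ []) ∷ []))
    (lookup (+ 0 ∷ + 0 ∷ + 3 ∷ + 3 ∷ + 0 ∷ + 1 ∷ + 3 ∷ + 0 ∷ + 1 ∷ + 3 ∷ []))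

  -- One pentagon is `v`, `p`, `o`, `x′`, `x` in the plane of vanishing first coordinate, the other
  -- `o`, `q`, `w`, `y`, `y′` in that of vanishing second coordinate.
  v p o q w x x′ y y′ : IntVec
  v = lookup (+ 0 ∷ + 3 ∷ -[1+ 2 ] ∷ [])
  p = lookup (+ 0 ∷ + 3 ∷ + 0 ∷ [])
  o = lookup (+ 0 ∷ + 0 ∷ + 0 ∷ [])
  q = lookup (+ 3 ∷ + 0 ∷ + 0 ∷ [])
  w = lookup (+ 3 ∷ + 0 ∷ + 3 ∷ [])
  x = lookup (+ 0 ∷ + 2 ∷ -[1+ 2 ] ∷ [])
  x′ = lookup (+ 0 ∷ + 1 ∷ -[1+ 1 ] ∷ [])
  y = lookup (+ 2 ∷ + 0 ∷ + 3 ∷ [])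
  y′ = lookup (+ 1 ∷ + 0 ∷ + 2 ∷ [])

  v-frame : Frame v
  v-frame = frame (lookup (0F ∷ 2F ∷ 6F ∷ []))
    (matrix ((+ 1 ∷ + 1 ∷ -[1+ 1 ] ∷ []) ∷ (+ 0 ∷ -[1+ 0 ] ∷ + 0 ∷ []) ∷ (+ 0 ∷ + 0 ∷ + 1 ∷ []) ∷ []))

  abstract
    v-isFrame : Frame.IsFrame v-frame
    v-isFrame = from-yes (Frame.isFrame? v-frame)

  p-frame : Frame p
  p-frame = frame (lookup (0F ∷ 2F ∷ 7F ∷ []))
    (matrix ((+ 1 ∷ + 1 ∷ + 2 ∷ []) ∷ (+ 0 ∷ -[1+ 0 ] ∷ + 0 ∷ []) ∷ (+ 0 ∷ + 0 ∷ -[1+ 0 ] ∷ []) ∷ []))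

  abstract
    p-isFrame : Frame.IsFrame p-frame
    p-isFrame = from-yes (Frame.isFrame? p-frame)

  o-frame : Frame o
  o-frame = frame (lookup (0F ∷ 1F ∷ 4F ∷ []))
    (matrix ((+ 1 ∷ + 0 ∷ + 0 ∷ []) ∷ (+ 0 ∷ + 1 ∷ -[1+ 1 ] ∷ []) ∷ (+ 0 ∷ + 0 ∷ + 1 ∷ []) ∷ []))

  abstract
    o-isFrame : Frame.IsFrame o-frame
    o-isFrame = from-yes (Frame.isFrame? o-frame)

  q-frame : Frame q
  q-frame = frame (lookup (1F ∷ 3F ∷ 4F ∷ []))
    (matrix ((+ 1 ∷ + 1 ∷ -[1+ 1 ] ∷ []) ∷ (-[1+ 0 ] ∷ + 0 ∷ + 0 ∷ []) ∷ (+ 0 ∷ + 0 ∷ + 1 ∷ []) ∷ []))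

  abstract
    q-isFrame : Frame.IsFrame q-frame
    q-isFrame = from-yes (Frame.isFrame? q-frame)

  w-frame : Frame w
  w-frame = frame (lookup (1F ∷ 3F ∷ 9F ∷ []))
    (matrix ((+ 1 ∷ + 1 ∷ + 2 ∷ []) ∷ (-[1+ 0 ] ∷ + 0 ∷ + 0 ∷ []) ∷ (+ 0 ∷ + 0 ∷ -[1+ 0 ] ∷ []) ∷ []))

  abstract
    w-isFrame : Frame.IsFrame w-frame
    w-isFrame = from-yes (Frame.isFrame? w-frame)

  x-frame : Frame x
  x-frame = frame (lookup (0F ∷ 5F ∷ 6F ∷ []))
    (matrix ((+ 1 ∷ + 1 ∷ -[1+ 1 ] ∷ []) ∷ (+ 0 ∷ + 1 ∷ + 0 ∷ []) ∷ (+ 0 ∷ -[1+ 0 ] ∷ + 1 ∷ []) ∷ []))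

  abstract
    x-isFrame : Frame.IsFrame x-frame
    x-isFrame = from-yes (Frame.isFrame? x-frame)

  y-frame : Frame y
  y-frame = frame (lookup (1F ∷ 8F ∷ 9F ∷ []))
    (matrix ((+ 1 ∷ + 1 ∷ + 2 ∷ []) ∷ (+ 1 ∷ + 0 ∷ + 0 ∷ []) ∷ (-[1+ 0 ] ∷ + 0 ∷ -[1+ 0 ] ∷ []) ∷ []))

  abstract
    y-isFrame : Frame.IsFrame y-frame
    y-isFrame = from-yes (Frame.isFrame? y-frame)

  up south east : IntVec
  up    = lookup (+ 0 ∷ + 0 ∷ + 1 ∷ [])
  south = lookup (+ 0 ∷ -[1+ 0 ] ∷ + 0 ∷ [])
  east  = lookup (+ 1 ∷ + 0 ∷ + 0 ∷ [])

  route : List IntStep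
  route = (up , 3) ∷ (south , 3) ∷ (east , 3) ∷ (up , 3) ∷ []

  route-walk : IsWalk (pt v) (pt w) (real route)
  route-walk = Reaches⇒IsWalk v w route (from-yes (reaches? v w route))
    (At.circuit v-frame v-isFrame 2F 2F refl ∷ At.circuit p-frame p-isFrame 1F 1F refl ∷ At.circuit o-frame o-isFrame 0F 0F refl ∷ At.circuit q-frame q-isFrame 2F 2F refl ∷ [])

  route-e : EdgeW (pt v) (real route)
  route-e = edgeW v route
    ( p , (λ { 0F → refl ; 1F → refl ; 2F → refl }) , At.edge-to v-frame v-isFrame p 2F 3 (At.vertex p-frame p-isFrame) (from-yes (At.edgeTo? v-frame v-isFrame p 2F 3))
    , o , (λ { 0F → refl ; 1F → refl ; 2F → refl }) , At.edge-to p-frame p-isFrame o 1F 3 (At.vertex o-frame o-isFrame) (from-yes (At.edgeTo? p-frame p-isFrame o 1F 3))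
    , q , (λ { 0F → refl ; 1F → refl ; 2F → refl }) , At.edge-to o-frame o-isFrame q 0F 3 (At.vertex q-frame q-isFrame) (from-yes (At.edgeTo? o-frame o-isFrame q 0F 3))
    , w , (λ { 0F → refl ; 1F → refl ; 2F → refl }) , At.edge-to q-frame q-isFrame w 2F 3 (At.vertex w-frame w-isFrame) (from-yes (At.edgeTo? q-frame q-isFrame w 2F 3)) , tt)

  route-f : FeasW (pt v) (real route)
  route-f = feasW v route (from-yes (feasWℤ? v route))

  route-m : MaxW (pt v) (real route)
  route-m = maxW v route (from-yes (maxWℤ? v route))

  near-v : ∀ {z} → Adjacent (pt v) z → Near z (p ∷ x ∷ [])
  near-v = At.near v-frame v-isFrame _ ends (from-yes (At.complete? v-frame v-isFrame (p ∷ x ∷ []) ends))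
    where
    ends : Fin 3 → Maybe ℕ
    ends = lookup (nothing ∷ just 1 ∷ just 3 ∷ [])

  near-p : ∀ {z} → Adjacent (pt p) z → Near z (o ∷ v ∷ [])
  near-p = At.near p-frame p-isFrame _ ends (from-yes (At.complete? p-frame p-isFrame (o ∷ v ∷ []) ends))
    where
    ends : Fin 3 → Maybe ℕ
    ends = lookup (nothing ∷ just 3 ∷ just 3 ∷ [])

  near-x : ∀ {z} → Adjacent (pt x) z → Near z (v ∷ x′ ∷ [])
  near-x = At.near x-frame x-isFrame _ ends (from-yes (At.complete? x-frame x-isFrame (v ∷ x′ ∷ []) ends))
    where
    ends : Fin 3 → Maybe ℕ
    ends = lookup (nothing ∷ just 1 ∷ just 1 ∷ [])

  near-w : ∀ {z} → Adjacent (pt w) z → Near z (q ∷ y ∷ [])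
  near-w = At.near w-frame w-isFrame _ ends (from-yes (At.complete? w-frame w-isFrame (q ∷ y ∷ []) ends))
    where
    ends : Fin 3 → Maybe ℕ
    ends = lookup (nothing ∷ just 1 ∷ just 3 ∷ [])

  near-q : ∀ {z} → Adjacent (pt q) z → Near z (o ∷ w ∷ [])
  near-q = At.near q-frame q-isFrame _ ends (from-yes (At.complete? q-frame q-isFrame (o ∷ w ∷ []) ends))
    where
    ends : Fin 3 → Maybe ℕ
    ends = lookup (nothing ∷ just 3 ∷ just 3 ∷ [])

  near-y : ∀ {z} → Adjacent (pt y) z → Near z (w ∷ y′ ∷ [])
  near-y = At.near y-frame y-isFrame _ ends (from-yes (At.complete? y-frame y-isFrame (w ∷ y′ ∷ []) ends))
    where
    ends : Fin 3 → Maybe ℕ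
    ends = lookup (nothing ∷ just 1 ∷ just 1 ∷ [])

  no-triple : ∀ {z₁ z₂} → Adjacent (pt v) z₁ → Adjacent z₁ z₂ → Adjacent z₂ (pt w) → ⊥
  no-triple {z₁} {z₂} adj₁ adj₂ adj₃ = middle (near-v adj₁) (near-w (Adjacent-sym adj₃))
    where
    middle : Near z₁ (p ∷ x ∷ []) → Near z₂ (q ∷ y ∷ []) → ⊥
    middle (here at-p)         = clash (from-yes (apart? (o ∷ v ∷ []) (q ∷ y ∷ []))) (near-p (Adjacent-resp at-p (λ _ → refl) adj₂))
    middle (there (here at-x)) = clash (from-yes (apart? (v ∷ x′ ∷ []) (q ∷ y ∷ []))) (near-x (Adjacent-resp at-x (λ _ → refl) adj₂))

  -- The walk is followed from both ends. The middle vertex must be listed from either side, and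
  -- only `p` and `q` have a common neighbour, namely `o`.
  only-route : ∀ {z₁ z₂ z₃} → Adjacent (pt v) z₁ → Adjacent z₁ z₂ → Adjacent z₂ z₃ → Adjacent z₃ (pt w) → z₁ ≐ pt p × z₃ ≐ pt q
  only-route {z₁} {z₂} {z₃} adj₁ adj₂ adj₃ adj₄ = middle (near-v adj₁) (near-w (Adjacent-sym adj₄))
    where
    after-p : z₁ ≐ pt p → Near z₂ (o ∷ v ∷ [])
    after-p at-p = near-p (Adjacent-resp at-p (λ _ → refl) adj₂)
    after-x : z₁ ≐ pt x → Near z₂ (v ∷ x′ ∷ [])
    after-x at-x = near-x (Adjacent-resp at-x (λ _ → refl) adj₂)
    before-q : z₃ ≐ pt q → Near z₂ (o ∷ w ∷ [])
    before-q at-q = near-q (Adjacent-resp at-q (λ _ → refl) (Adjacent-sym adj₃))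
    before-y : z₃ ≐ pt y → Near z₂ (w ∷ y′ ∷ [])
    before-y at-y = near-y (Adjacent-resp at-y (λ _ → refl) (Adjacent-sym adj₃))
    middle : Near z₁ (p ∷ x ∷ []) → Near z₃ (q ∷ y ∷ []) → z₁ ≐ pt p × z₃ ≐ pt q
    middle (here at-p)         (here at-q)         = at-p , at-q
    middle (here at-p)         (there (here at-y)) = ⊥-elim (clash (from-yes (apart? (o ∷ v ∷ []) (w ∷ y′ ∷ []))) (after-p at-p) (before-y at-y))
    middle (there (here at-x)) (here at-q)         = ⊥-elim (clash (from-yes (apart? (v ∷ x′ ∷ []) (o ∷ w ∷ []))) (after-x at-x) (before-q at-q))
    middle (there (here at-x)) (there (here at-y)) = ⊥-elim (clash (from-yes (apart? (v ∷ x′ ∷ []) (w ∷ y′ ∷ []))) (after-x at-x) (before-y at-y))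

  no-nonrepetitive-walk : ∀ ws → IsWalk (pt v) (pt w) ws → EdgeW (pt v) ws → NonRep ws → ¬ (length ws ℕ.≤ 4)
  no-nonrepetitive-walk [] (_ , end) _ _ _ = clash (from-yes (apart? (v ∷ []) (w ∷ []))) (here (λ _ → refl)) (here end)
  no-nonrepetitive-walk (_ ∷ []) (_ , end) (adj , _) _ _ = clash (from-yes (apart? (p ∷ x ∷ []) (w ∷ []))) (near-v adj) (here end)
  no-nonrepetitive-walk (_ ∷ _ ∷ []) (_ , end) (adj , adj′ , _) _ _ =
    clash (from-yes (apart? (p ∷ x ∷ []) (q ∷ y ∷ []))) (near-v adj) (near-w (Adjacent-sym (Adjacent-resp (λ _ → refl) end adj′)))
  no-nonrepetitive-walk (_ ∷ _ ∷ _ ∷ []) (_ , end) (adj₁ , adj₂ , adj₃ , _) _ _ = no-triple adj₁ adj₂ (Adjacent-resp (λ _ → refl) end adj₃)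
  no-nonrepetitive-walk ((g₁ , _) ∷ _ ∷ _ ∷ (g₄ , _) ∷ []) ((circ₁ , 0<α₁) ∷ _ ∷ _ ∷ (circ₄ , 0<α₄) ∷ [] , end) (adj₁ , adj₂ , adj₃ , adj₄ , _) ((_ ∷ _ ∷ s₁≢s₄ ∷ []) ∷ _) _ =
      s₁≢s₄ (λ j → trans (g₁≐up j) (sym (g₄≐up j)))
    where
    places = only-route adj₁ adj₂ adj₃ (Adjacent-resp (λ _ → refl) end adj₄)
    g₁≐up : g₁ ≐ℤ up
    g₁≐up = direction-between v p up 2F 2 circ₁ 0<α₁ (λ _ → refl) (proj₁ places) refl λ { 0F → refl ; 1F → refl ; 2F → refl }
    g₄≐up : g₄ ≐ℤ up
    g₄≐up = direction-between q w up 2F 2 circ₄ 0<α₄ (proj₂ places) end refl λ { 0F → refl ; 1F → refl ; 2F → refl }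
  no-nonrepetitive-walk (_ ∷ _ ∷ _ ∷ _ ∷ _ ∷ _) _ _ _ (ℕ.s≤s (ℕ.s≤s (ℕ.s≤s (ℕ.s≤s ()))))

  efmr>efm : Gap ℝ (e ∷ f ∷ m ∷ r ∷ []) (e ∷ f ∷ m ∷ [])
  efmr>efm = P , pt v , pt w , At.vertex v-frame v-isFrame , At.vertex w-frame w-isFrame , 4 , (real route , (route-walk , route-e ∷ route-f ∷ route-m ∷ []) , ℕₚ.≤-refl) ,
    λ { (ws , (walk , edges ∷ _ ∷ _ ∷ nr ∷ []) , len) → no-nonrepetitive-walk ws walk edges nr len }

-- Monotonicity in the set of properties, and assembly of the hierarchy.

weaken : ∀ {ℝ X Y} → (∀ {Q : WalkProp → Set} → All Q X → All Q Y) → CD-≥ ℝ X Y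
weaken select P v₁ v₂ _ _ k (ws , (walk , props) , len) = ws , (walk , select props) , len

theorem1 : (ℝ : RealField) →
  -- (i)
  (CD-> ℝ (e ∷ f ∷ m ∷ b ∷ []) (e ∷ f ∷ m ∷ []) ×
   CD-> ℝ (e ∷ f ∷ m ∷ r ∷ []) (e ∷ f ∷ m ∷ [])) ×
  -- (ii)
  (CD-> ℝ (e ∷ f ∷ m ∷ b ∷ []) (f ∷ m ∷ b ∷ []) ×
   CD-> ℝ (e ∷ f ∷ m ∷ []) (f ∷ m ∷ []) ×
   CD-> ℝ (e ∷ f ∷ m ∷ r ∷ []) (f ∷ m ∷ r ∷ [])) ×
  -- (iii)
  (CD-> ℝ (f ∷ m ∷ b ∷ []) (f ∷ m ∷ []) ×
   CD-> ℝ (f ∷ m ∷ r ∷ []) (f ∷ m ∷ [])) ×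
  -- (iv)
  (CD-> ℝ (f ∷ m ∷ b ∷ []) (f ∷ b ∷ []) ×
   CD-> ℝ (f ∷ m ∷ []) (f ∷ []) ×
   CD-> ℝ (f ∷ m ∷ r ∷ []) (f ∷ r ∷ [])) ×
  -- (v)
  (CD-≥ ℝ (f ∷ b ∷ []) (f ∷ []) ×
   CD-> ℝ (f ∷ r ∷ []) (f ∷ [])) ×
  -- (vi)
  (CD-> ℝ (f ∷ b ∷ r ∷ []) (f ∷ b ∷ []) ×
   CD-≥ ℝ (f ∷ b ∷ r ∷ []) (f ∷ r ∷ [])) ×
  -- (vii)
  CD-> ℝ (f ∷ s ∷ []) (f ∷ b ∷ r ∷ []) ×
  -- (viii)
  CD-> ℝ (f ∷ []) []
theorem1 ℝ =
  ( (weaken (λ { (x ∷ y ∷ z ∷ _) → x ∷ y ∷ z ∷ [] }) , Heptagon.efmb>efm ℝ)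
  , (weaken (λ { (x ∷ y ∷ z ∷ _) → x ∷ y ∷ z ∷ [] }) , Decahedron.efmr>efm ℝ)) ,
  ( (weaken (λ { (_ ∷ xs) → xs }) , Cube.efmb>fmb ℝ)
  , (weaken (λ { (_ ∷ xs) → xs }) , Cube.efm>fm ℝ)
  , (weaken (λ { (_ ∷ xs) → xs }) , Cube.efmr>fmr ℝ)) ,
  ( (weaken (λ { (x ∷ y ∷ _) → x ∷ y ∷ [] }) , Penteract.fmb>fm ℝ)
  , (weaken (λ { (x ∷ y ∷ _) → x ∷ y ∷ [] }) , Tesseract.fmr>fm ℝ)) ,
  ( (weaken (λ { (x ∷ _ ∷ xs) → x ∷ xs }) , Penteract.fmb>fb ℝ)
  , (weaken (λ { (x ∷ _ ∷ xs) → x ∷ xs }) , Penteract.fm>f ℝ)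
  , (weaken (λ { (x ∷ _ ∷ xs) → x ∷ xs }) , Penteract.fmr>fr ℝ)) ,
  ( weaken (λ { (x ∷ _) → x ∷ [] })
  , (weaken (λ { (x ∷ _) → x ∷ [] }) , Tesseract.fr>f ℝ)) ,
  ( (weaken (λ { (x ∷ y ∷ _) → x ∷ y ∷ [] }) , Tesseract.fbr>fb ℝ)
  , weaken (λ { (x ∷ _ ∷ xs) → x ∷ xs })) ,
  (fs≥fbr ℝ , Cube.fs>fbr ℝ) ,
  (weaken (λ _ → []) , Tesseract.f>∅ ℝ)
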